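{- For all integers $k\ge1$ and $n\ge0$, $$e_6(13^{2k}n+\delta_{13,2k})\equiv0\pmod{13^{2k}}.$$
   Context: $q=e^{2\pi i\tau}$, $(q;q)_\infty=\prod_{n\ge1}(1-q^n)$, $E_6(\tau)=1-504\sum_{n\ge1}\sigma_5(n)q^n$ with $\sigma_5(n)=\sum_{d\mid n}d^5$. The numbers $e_6(n)$ are defined by $\sum_{n\ge0}e_6(n)q^n=E_6(\tau)/(q;q)_\infty$. For a prime $\ell\ge5$ and $k\ge1$, $\delta_{\ell,k}$ is the integer with $0<\delta_{\ell,k}<\ell^k$ and $24\delta_{\ell,k}\equiv1\pmod{\ell^k}$. -}

module Defs where

open import Data.Nat as ℕ using (ℕ; zero; suc; _∸_; _^_; _/_)
open import Data.Nat.Divisibility using (_∣?_)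
open import Data.Integer as ℤ using (ℤ; +_)
open import Data.List using (List; map; filter; upTo)
open import Data.Nat.ListAction using (sum)

σ₅ : ℕ → ℕ
σ₅ n = sum (map (λ d → d ^ 5) (filter (λ d → d ∣? n) (map suc (upTo n))))

-- partsAtMost n k = number of partitions of n into parts of size ≤ k
partsAtMost : ℕ → ℕ → ℕ
partsAtMost zero    zero    = 1
partsAtMost (suc _) zero    = 0
partsAtMost n       (suc k) =
  sum (map (λ j → partsAtMost (n ∸ j ℕ.* suc k) k) (upTo (suc (n / suc k))))

p : ℕ → ℕ
p n = partsAtMost n n

E₆coeff : ℕ → ℤ
E₆coeff zero    = + 1
E₆coeff (suc j) = ℤ.- (+ (504 ℕ.* σ₅ (suc j)))

-- e₆(n) = Σ_{j=0}^{n} [qʲ]E₆ · p(n-j)  (Cauchy product of E₆ and 1/(q;q)_∞)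
e₆ : ℕ → ℤ
e₆ n = Data.List.foldr ℤ._+_ (+ 0)
         (map (λ j → E₆coeff j ℤ.* (+ p (n ∸ j))) (upTo (suc n)))

{-# OPTIONS --safe #-}
-- Write Z = η(169τ)/η(τ), u = (η(13τ)/η(τ))², x = u(13τ), and let U keep the exponents divisible
-- by 13.  The series L₀ = E₆, Lₖ₊₁ = U U (Z Lₖ) satisfy Lₖ = (q;q)_∞ Σ e₆(169ᵏ m − (169ᵏ − 1)/24) qᵐ,
-- so it suffices that 169ᵏ divides Lₖ.  For a weight six form W on Γ₀(13) with E₆ = W B(13u), put
-- X = W (ℤ + ℤu + ℤu² + u³ ℤ[13u]) and X′ = W u ℤ[13u].  Then U (Z X) ⊆ X′ and U X′ ⊆ 169 X; since
-- 13u is integral of degree 13 over ℤ[13x] and U is linear over series in q¹³, this has to be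
-- checked only on finitely many generators, where it is a computation with polynomials.
--
-- Level 13 is reached through differential equations.  Ramanujan's equations for E₂, E₄, E₆
-- follow from Liouville's method applied to sums over ax + by = n.  The expressions of E₄, E₆
-- at τ and 13τ through u and Du/u generate an ideal stable under D, hence satisfy a
-- linear system with a regular singularity at q = 0, and vanish because their first 14
-- coefficients do.  Comparing j(13τ) as a function of 1/u and of 13x gives the
-- equation of degree 13 between u and x; with Z² = u x it splits and yields an equation for Z.
-- Finally 13 U f is the trace of multiplication by f on ℤ[[q]] over ℤ[[q¹³]], computed in the
-- basis 1, u, …, u⁶, Z, Zu, …, Zu⁵.
module Submission where

open import Defs
open import Data.Nat using (ℕ; _^_; _≤_; _<_)
open import Data.Integer using (+_; _-_)
open import Data.Integer.Divisibility using (_∣_)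
import Data.Nat as N
open import Data.Nat as ℕ using (zero; suc; _∸_; _/_)
import Data.Nat.Properties as ℕₚ
open import Data.Nat.Divisibility as ℕ∣ using (divides; _∣?_)
open import Data.Nat.DivMod using (m<n⇒m/n≡0; m/n≡1+[m∸n]/n)
open import Data.Nat.ListAction using () renaming (sum to sumₗ)
open import Data.Nat.Tactic.RingSolver using () renaming (solve-∀ to ℕ-solve)
open import Data.Integer as ℤ using (ℤ; -[1+_])
import Data.Integer.Properties as ℤₚ
open import Data.Integer.Tactic.RingSolver using (solve-∀)
open import Data.Bool.Base using (Bool; true; false; _∧_; if_then_else_)
open import Data.Empty using (⊥-elim)
open import Data.Fin using (#_)
open import Data.Fin.Base using (Fin; zero; suc; toℕ; inject≤)
open import Data.List.Base as List using (List; []; _∷_; foldr; map; filter; applyUpTo; upTo)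
import Data.List.Properties as Listₚ
open import Data.Product using (_×_; _,_; proj₁; proj₂; ∃; Σ)
open import Data.Sum using (inj₁; inj₂)
open import Data.Vec.Base as Vec using (Vec; []; _∷_; lookup)
import Data.Vec.Properties as Vecₚ
open import Function.Base using (_∘_; id)
open import Level using (0ℓ)
open import Relation.Binary using (IsEquivalence)
open import Relation.Binary.PropositionalEquality as ≡ using (_≡_; _≢_; refl; cong; cong₂; sym; trans; subst; module ≡-Reasoning)
import Relation.Binary.Reasoning.Setoid as SetoidReasoning
open import Relation.Nullary using (Dec; yes; no; ¬_)
open import Relation.Nullary.Decidable using (⌊_⌋)
open import Algebra.Bundles using (AbelianGroup; CommutativeRing)
import Algebra.Properties.Group as GroupProperties
import Algebra.Properties.Ring as RingProperties

-- `W` is not a series in q¹³, so the linearity of `U` alone gives no hold on `U (W ⊛ f)`. What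
-- helps is that E₆(13τ) and Δ(13τ) are series in q¹³ and are, up to explicit functions of u, equal
-- to W and W². Their quotient writes W as a series in q¹³ times x/u¹³ times a polynomial in u. The
-- series leaves `U`, and only polynomials in x, u and Z remain under it. The price is the
-- denominator B(13u)(1 + 6u + 13u²): each of the finitely many checks also has to show that it
-- divides out exactly.
--
-- The number of initial coefficients is dictated by the linear system. At q = 0 its exponents are
-- 0, 1 and 13, so a solution that vanishes up to q¹³ cannot begin anywhere later.
--
-- The coordinates of x/u¹³ and the quotients in the checks are treated as guesses and certified by
-- multiplying back.

-- Normal forms of integer polynomials, and proofs of ring identities by evaluation.

module PolynomialNormalisation where

  -- Nested Horner form; trailing zeros are allowed, so equality is tested by null on the difference.
  Poly : ℕ → Set
  Poly zero    = ℤ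
  Poly (suc n) = List (Poly n)

  0ᵖ : ∀ {n} → Poly n
  0ᵖ {zero}  = + 0
  0ᵖ {suc n} = []

  conᵖ : ∀ {n} → ℤ → Poly n
  conᵖ {zero}  c = c
  conᵖ {suc n} c = conᵖ c ∷ []

  varᵖ : ∀ {n} → Fin n → Poly n
  varᵖ {suc n} zero    = 0ᵖ ∷ conᵖ (+ 1) ∷ []
  varᵖ {suc n} (suc i) = varᵖ i ∷ []

  infixl 6 _+ᵖ_
  infixl 7 _*ᵖ_

  _+ᵖ_ : ∀ {n} → Poly n → Poly n → Poly n
  _+ᵖ_ {zero}  a       b       = a ℤ.+ b
  _+ᵖ_ {suc n} []      q       = q
  _+ᵖ_ {suc n} (a ∷ p) []      = a ∷ p
  _+ᵖ_ {suc n} (a ∷ p) (b ∷ q) = (a +ᵖ b) ∷ (p +ᵖ q)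

  -ᵖ_ : ∀ {n} → Poly n → Poly n
  -ᵖ_ {zero}  a       = ℤ.- a
  -ᵖ_ {suc n} []      = []
  -ᵖ_ {suc n} (a ∷ p) = -ᵖ a ∷ -ᵖ p

  null : ∀ {n} → Poly n → Bool
  null {zero}  (+ 0) = true
  null {zero}  _     = false
  null {suc n} []      = true
  null {suc n} (a ∷ p) = null a ∧ null p

  _*ᵖ_ : ∀ {n} → Poly n → Poly n → Poly n
  scaleᵖ : ∀ {n} → Poly n → Poly (suc n) → Poly (suc n)
  scaleᵖ a []      = []
  scaleᵖ a (b ∷ q) = (a *ᵖ b) ∷ scaleᵖ a q
  _*ᵖ_ {zero}  a       b = a ℤ.* b
  _*ᵖ_ {suc n} []      q = []
  -- A zero coefficient only shifts, so multiplying by a variable or a sparse polynomial does not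
  -- produce rows of zeros.
  _*ᵖ_ {suc n} (a ∷ p) q = if null a then 0ᵖ ∷ (p *ᵖ q) else scaleᵖ a q +ᵖ (0ᵖ ∷ (p *ᵖ q))

  powᵖ : ∀ {n} → Poly n → ℕ → Poly n
  powᵖ p zero    = conᵖ (+ 1)
  powᵖ p (suc k) = p *ᵖ powᵖ p k

  infixl 6 _:+_ _:-_
  infixl 7 _:*_
  infixr 8 _:^_
  infix  9 :-_

  -- First-order syntax, because the same expression is later evaluated in ℤ and in power series,
  -- substituted into by `sub` and differentiated by `∂`. The node `poly` keeps long univariate
  -- polynomials as coefficient lists.
  data Expr (n : ℕ) : Set where
    var  : Fin n → Expr n
    con  : ℤ → Expr n
    _:+_ _:*_ _:-_ : Expr n → Expr n → Expr n
    :-_  : Expr n → Expr n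
    _:^_ : Expr n → ℕ → Expr n
    poly : List ℤ → Expr n → Expr n

  norm : ∀ {n} → Expr n → Poly n
  normPoly : ∀ {n} → List ℤ → Poly n → Poly n
  normPoly []      x = 0ᵖ
  normPoly (c ∷ p) x = conᵖ c +ᵖ (x *ᵖ normPoly p x)
  norm (var i)    = varᵖ i
  norm (con c)    = conᵖ c
  norm (e :+ e′)  = norm e +ᵖ norm e′
  norm (e :- e′)  = norm e +ᵖ -ᵖ (norm e′)
  norm (e :* e′)  = norm e *ᵖ norm e′
  norm (:- e)     = -ᵖ (norm e)
  norm (e :^ k)   = powᵖ (norm e) k
  norm (poly p e) = normPoly p (norm e)

  sub : ∀ {m n} → Expr m → Vec (Expr n) m → Expr n
  sub (var i)    σ = lookup σ i
  sub (con c)    σ = con c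
  sub (e :+ e′)  σ = sub e σ :+ sub e′ σ
  sub (e :- e′)  σ = sub e σ :- sub e′ σ
  sub (e :* e′)  σ = sub e σ :* sub e′ σ
  sub (:- e)     σ = :- sub e σ
  sub (e :^ k)   σ = sub e σ :^ k
  sub (poly p e) σ = poly p (sub e σ)

  module Eval {c ℓ} (R : CommutativeRing c ℓ) (ι : ℤ → CommutativeRing.Carrier R)
              (ι-+ : ∀ a b → CommutativeRing._≈_ R (ι (a ℤ.+ b)) (CommutativeRing._+_ R (ι a) (ι b)))
              (ι-* : ∀ a b → CommutativeRing._≈_ R (ι (a ℤ.* b)) (CommutativeRing._*_ R (ι a) (ι b)))
              (ι-0 : CommutativeRing._≈_ R (ι (+ 0)) (CommutativeRing.0# R))
              (ι-1 : CommutativeRing._≈_ R (ι (+ 1)) (CommutativeRing.1# R)) where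

    open CommutativeRing R hiding (zero; _-_) renaming (refl to refl≈; sym to sym≈; trans to trans≈)
    open SetoidReasoning setoid
    open RingProperties ring using (-‿distribˡ-*; -‿distribʳ-*; -0#≈0#; -‿+-comm)

    infixr 8 _↑_
    _↑_ : Carrier → ℕ → Carrier
    x ↑ zero  = ι (+ 1)
    x ↑ suc k = x * (x ↑ k)

    ev : List ℤ → Carrier → Carrier
    ev []      x = ι (+ 0)
    ev (c ∷ p) x = ι c + x * ev p x

    ⟦_⟧ : ∀ {n} → Expr n → Vec Carrier n → Carrier
    ⟦ var i ⟧ ρ    = lookup ρ i
    ⟦ con c ⟧ ρ    = ι c
    ⟦ e :+ e′ ⟧ ρ  = ⟦ e ⟧ ρ + ⟦ e′ ⟧ ρ
    ⟦ e :- e′ ⟧ ρ  = ⟦ e ⟧ ρ + - ⟦ e′ ⟧ ρ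
    ⟦ e :* e′ ⟧ ρ  = ⟦ e ⟧ ρ * ⟦ e′ ⟧ ρ
    ⟦ :- e ⟧ ρ     = - ⟦ e ⟧ ρ
    ⟦ e :^ k ⟧ ρ   = ⟦ e ⟧ ρ ↑ k
    ⟦ poly p e ⟧ ρ = ev p (⟦ e ⟧ ρ)

    ⟦_⟧ᵖ : ∀ {n} → Poly n → Vec Carrier n → Carrier
    ⟦_⟧ᵖ {zero}  c       []      = ι c
    ⟦_⟧ᵖ {suc n} []      (x ∷ ρ) = 0#
    ⟦_⟧ᵖ {suc n} (a ∷ p) (x ∷ ρ) = ⟦ a ⟧ᵖ ρ + x * ⟦ p ⟧ᵖ (x ∷ ρ)

    ι-neg : ∀ a → ι (ℤ.- a) ≈ - ι a
    ι-neg a = begin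
      ι (ℤ.- a)                       ≈⟨ +-identityʳ _ ⟨
      ι (ℤ.- a) + 0#                  ≈⟨ +-congˡ (-‿inverseʳ (ι a)) ⟨
      ι (ℤ.- a) + (ι a + - ι a)       ≈⟨ +-assoc _ _ _ ⟨
      (ι (ℤ.- a) + ι a) + - ι a       ≈⟨ +-congʳ (ι-+ (ℤ.- a) a) ⟨
      ι (ℤ.- a ℤ.+ a) + - ι a         ≡⟨ ≡.cong (λ t → ι t + - ι a) (ℤₚ.+-inverseˡ a) ⟩
      ι (+ 0) + - ι a                 ≈⟨ +-congʳ ι-0 ⟩
      0# + - ι a                      ≈⟨ +-identityˡ _ ⟩
      - ι a                           ∎

    interchange : ∀ a b c d → (a + b) + (c + d) ≈ (a + c) + (b + d)
    interchange a b c d = begin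
      (a + b) + (c + d)  ≈⟨ +-assoc a b (c + d) ⟩
      a + (b + (c + d))  ≈⟨ +-congˡ (+-assoc b c d) ⟨
      a + ((b + c) + d)  ≈⟨ +-congˡ (+-congʳ (+-comm b c)) ⟩
      a + ((c + b) + d)  ≈⟨ +-congˡ (+-assoc c b d) ⟩
      a + (c + (b + d))  ≈⟨ +-assoc a c (b + d) ⟨
      (a + c) + (b + d)  ∎

    0ᵖ-sound : ∀ n (ρ : Vec Carrier n) → ⟦ 0ᵖ {n} ⟧ᵖ ρ ≈ 0#
    0ᵖ-sound zero    []      = ι-0
    0ᵖ-sound (suc n) (x ∷ ρ) = refl≈

    con-sound : ∀ {n} c (ρ : Vec Carrier n) → ⟦ conᵖ {n} c ⟧ᵖ ρ ≈ ι c
    con-sound c []      = refl≈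
    con-sound c (x ∷ ρ) = begin
      ⟦ conᵖ c ⟧ᵖ ρ + x * 0#  ≈⟨ +-cong (con-sound c ρ) (zeroʳ x) ⟩
      ι c + 0#                ≈⟨ +-identityʳ _ ⟩
      ι c                     ∎

    var-sound : ∀ {n} (i : Fin n) (ρ : Vec Carrier n) → ⟦ varᵖ i ⟧ᵖ ρ ≈ lookup ρ i
    var-sound zero (x ∷ ρ) = begin
      ⟦ 0ᵖ ⟧ᵖ ρ + x * (⟦ conᵖ (+ 1) ⟧ᵖ ρ + x * 0#)
        ≈⟨ +-cong (0ᵖ-sound _ ρ) (*-congˡ (+-cong (trans≈ (con-sound (+ 1) ρ) ι-1) (zeroʳ x))) ⟩
      0# + x * (1# + 0#)  ≈⟨ +-identityˡ _ ⟩
      x * (1# + 0#)       ≈⟨ *-congˡ (+-identityʳ 1#) ⟩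
      x * 1#              ≈⟨ *-identityʳ x ⟩
      x                   ∎
    var-sound (suc i) (x ∷ ρ) = begin
      ⟦ varᵖ i ⟧ᵖ ρ + x * 0#  ≈⟨ +-cong (var-sound i ρ) (zeroʳ x) ⟩
      lookup ρ i + 0#         ≈⟨ +-identityʳ _ ⟩
      lookup ρ i              ∎

    +-sound : ∀ {n} (p q : Poly n) (ρ : Vec Carrier n) → ⟦ p +ᵖ q ⟧ᵖ ρ ≈ ⟦ p ⟧ᵖ ρ + ⟦ q ⟧ᵖ ρ
    +-sound {zero}  a       b       []      = ι-+ a b
    +-sound {suc n} []      q       (x ∷ ρ) = sym≈ (+-identityˡ _)
    +-sound {suc n} (a ∷ p) []      (x ∷ ρ) = sym≈ (+-identityʳ _)
    +-sound {suc n} (a ∷ p) (b ∷ q) (x ∷ ρ) = begin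
      ⟦ a +ᵖ b ⟧ᵖ ρ + x * ⟦ p +ᵖ q ⟧ᵖ (x ∷ ρ)
        ≈⟨ +-cong (+-sound a b ρ) (trans≈ (*-congˡ (+-sound p q (x ∷ ρ))) (distribˡ x _ _)) ⟩
      (⟦ a ⟧ᵖ ρ + ⟦ b ⟧ᵖ ρ) + (x * ⟦ p ⟧ᵖ (x ∷ ρ) + x * ⟦ q ⟧ᵖ (x ∷ ρ))
        ≈⟨ interchange _ _ _ _ ⟩
      (⟦ a ⟧ᵖ ρ + x * ⟦ p ⟧ᵖ (x ∷ ρ)) + (⟦ b ⟧ᵖ ρ + x * ⟦ q ⟧ᵖ (x ∷ ρ)) ∎

    neg-sound : ∀ {n} (p : Poly n) (ρ : Vec Carrier n) → ⟦ -ᵖ p ⟧ᵖ ρ ≈ - ⟦ p ⟧ᵖ ρ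
    neg-sound {zero}  a       []      = ι-neg a
    neg-sound {suc n} []      (x ∷ ρ) = sym≈ -0#≈0#
    neg-sound {suc n} (a ∷ p) (x ∷ ρ) = begin
      ⟦ -ᵖ a ⟧ᵖ ρ + x * ⟦ -ᵖ p ⟧ᵖ (x ∷ ρ)  ≈⟨ +-cong (neg-sound a ρ) (*-congˡ (neg-sound p (x ∷ ρ))) ⟩
      - ⟦ a ⟧ᵖ ρ + x * - ⟦ p ⟧ᵖ (x ∷ ρ)    ≈⟨ +-congˡ (-‿distribʳ-* x _) ⟨
      - ⟦ a ⟧ᵖ ρ + - (x * ⟦ p ⟧ᵖ (x ∷ ρ))  ≈⟨ -‿+-comm _ _ ⟩
      - (⟦ a ⟧ᵖ ρ + x * ⟦ p ⟧ᵖ (x ∷ ρ))    ∎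

    null-sound : ∀ {n} (p : Poly n) (ρ : Vec Carrier n) → null p ≡ true → ⟦ p ⟧ᵖ ρ ≈ 0#
    null-sound {zero}  (+ zero) []      eq = ι-0
    null-sound {suc n} []       (x ∷ ρ) eq = refl≈
    null-sound {suc n} (a ∷ p)  (x ∷ ρ) eq with null a in a≡ | null p in p≡
    ... | true | true = begin
      ⟦ a ⟧ᵖ ρ + x * ⟦ p ⟧ᵖ (x ∷ ρ)  ≈⟨ +-cong (null-sound a ρ a≡) (*-congˡ (null-sound p (x ∷ ρ) p≡)) ⟩
      0# + x * 0#                    ≈⟨ +-identityˡ _ ⟩
      x * 0#                         ≈⟨ zeroʳ x ⟩
      0#                             ∎

    *-sound : ∀ {n} (p q : Poly n) (ρ : Vec Carrier n) → ⟦ p *ᵖ q ⟧ᵖ ρ ≈ ⟦ p ⟧ᵖ ρ * ⟦ q ⟧ᵖ ρ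
    scale-sound : ∀ {n} (a : Poly n) (q : Poly (suc n)) x (ρ : Vec Carrier n) →
                  ⟦ scaleᵖ a q ⟧ᵖ (x ∷ ρ) ≈ ⟦ a ⟧ᵖ ρ * ⟦ q ⟧ᵖ (x ∷ ρ)
    scale-sound a []      x ρ = sym≈ (zeroʳ _)
    scale-sound a (b ∷ q) x ρ = begin
      ⟦ a *ᵖ b ⟧ᵖ ρ + x * ⟦ scaleᵖ a q ⟧ᵖ (x ∷ ρ)  ≈⟨ +-cong (*-sound a b ρ) (*-congˡ (scale-sound a q x ρ)) ⟩
      ⟦ a ⟧ᵖ ρ * ⟦ b ⟧ᵖ ρ + x * (⟦ a ⟧ᵖ ρ * Q)       ≈⟨ +-congˡ (*-assoc x _ Q) ⟨
      ⟦ a ⟧ᵖ ρ * ⟦ b ⟧ᵖ ρ + (x * ⟦ a ⟧ᵖ ρ) * Q       ≈⟨ +-congˡ (*-congʳ (*-comm x _)) ⟩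
      ⟦ a ⟧ᵖ ρ * ⟦ b ⟧ᵖ ρ + (⟦ a ⟧ᵖ ρ * x) * Q       ≈⟨ +-congˡ (*-assoc _ x Q) ⟩
      ⟦ a ⟧ᵖ ρ * ⟦ b ⟧ᵖ ρ + ⟦ a ⟧ᵖ ρ * (x * Q)       ≈⟨ distribˡ _ _ _ ⟨
      ⟦ a ⟧ᵖ ρ * (⟦ b ⟧ᵖ ρ + x * Q)                  ∎
      where Q = ⟦ q ⟧ᵖ (x ∷ ρ)

    *-sound {zero}  a       b []      = ι-* a b
    *-sound {suc n} []      q (x ∷ ρ) = sym≈ (zeroˡ _)
    *-sound {suc n} (a ∷ p) q (x ∷ ρ) with null a in a≡
    ... | true = begin
      ⟦ 0ᵖ ⟧ᵖ ρ + x * ⟦ p *ᵖ q ⟧ᵖ (x ∷ ρ)                ≈⟨ +-cong (trans≈ (0ᵖ-sound _ ρ) (sym≈ (trans≈ (*-congʳ (null-sound a ρ a≡)) (zeroˡ _)))) (*-congˡ (*-sound p q (x ∷ ρ))) ⟩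
      ⟦ a ⟧ᵖ ρ * Q + x * (⟦ p ⟧ᵖ (x ∷ ρ) * Q)              ≈⟨ +-congˡ (*-assoc x _ Q) ⟨
      ⟦ a ⟧ᵖ ρ * Q + (x * ⟦ p ⟧ᵖ (x ∷ ρ)) * Q              ≈⟨ distribʳ Q _ _ ⟨
      (⟦ a ⟧ᵖ ρ + x * ⟦ p ⟧ᵖ (x ∷ ρ)) * Q                  ∎
      where Q = ⟦ q ⟧ᵖ (x ∷ ρ)
    ... | false = begin
      ⟦ scaleᵖ a q +ᵖ (0ᵖ ∷ (p *ᵖ q)) ⟧ᵖ (x ∷ ρ)          ≈⟨ +-sound (scaleᵖ a q) (0ᵖ ∷ (p *ᵖ q)) (x ∷ ρ) ⟩
      ⟦ scaleᵖ a q ⟧ᵖ (x ∷ ρ) + (⟦ 0ᵖ ⟧ᵖ ρ + x * ⟦ p *ᵖ q ⟧ᵖ (x ∷ ρ))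
        ≈⟨ +-cong (scale-sound a q x ρ) (trans≈ (+-congʳ (0ᵖ-sound _ ρ)) (+-identityˡ _)) ⟩
      ⟦ a ⟧ᵖ ρ * Q + x * ⟦ p *ᵖ q ⟧ᵖ (x ∷ ρ)             ≈⟨ +-congˡ (*-congˡ (*-sound p q (x ∷ ρ))) ⟩
      ⟦ a ⟧ᵖ ρ * Q + x * (⟦ p ⟧ᵖ (x ∷ ρ) * Q)              ≈⟨ +-congˡ (*-assoc x _ Q) ⟨
      ⟦ a ⟧ᵖ ρ * Q + (x * ⟦ p ⟧ᵖ (x ∷ ρ)) * Q              ≈⟨ distribʳ Q _ _ ⟨
      (⟦ a ⟧ᵖ ρ + x * ⟦ p ⟧ᵖ (x ∷ ρ)) * Q                  ∎
      where Q = ⟦ q ⟧ᵖ (x ∷ ρ)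

    pow-sound : ∀ {n} (p : Poly n) k (ρ : Vec Carrier n) → ⟦ powᵖ p k ⟧ᵖ ρ ≈ ⟦ p ⟧ᵖ ρ ↑ k
    pow-sound p zero    ρ = con-sound (+ 1) ρ
    pow-sound p (suc k) ρ = trans≈ (*-sound p (powᵖ p k) ρ) (*-congˡ (pow-sound p k ρ))

    ^-cong : ∀ {x y} k → x ≈ y → x ↑ k ≈ y ↑ k
    ^-cong zero    p = refl≈
    ^-cong (suc k) p = *-cong p (^-cong k p)

    ev-cong : ∀ p {x y} → x ≈ y → ev p x ≈ ev p y
    ev-cong []      eq = refl≈
    ev-cong (c ∷ p) eq = +-congˡ (*-cong eq (ev-cong p eq))

    normPoly-sound : ∀ {n} p (x : Poly n) (ρ : Vec Carrier n) → ⟦ normPoly p x ⟧ᵖ ρ ≈ ev p (⟦ x ⟧ᵖ ρ)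
    normPoly-sound []      x ρ = trans≈ (0ᵖ-sound _ ρ) (sym≈ ι-0)
    normPoly-sound (c ∷ p) x ρ = trans≈ (+-sound (conᵖ c) (x *ᵖ normPoly p x) ρ)
      (+-cong (con-sound c ρ) (trans≈ (*-sound x (normPoly p x) ρ) (*-congˡ (normPoly-sound p x ρ))))

    norm-sound : ∀ {n} (e : Expr n) (ρ : Vec Carrier n) → ⟦ norm e ⟧ᵖ ρ ≈ ⟦ e ⟧ ρ
    norm-sound (var i)    ρ = var-sound i ρ
    norm-sound (con c)    ρ = con-sound c ρ
    norm-sound (e :+ e′)  ρ = trans≈ (+-sound (norm e) (norm e′) ρ) (+-cong (norm-sound e ρ) (norm-sound e′ ρ))
    norm-sound (e :- e′)  ρ = trans≈ (+-sound (norm e) (-ᵖ (norm e′)) ρ)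
      (+-cong (norm-sound e ρ) (trans≈ (neg-sound (norm e′) ρ) (-‿cong (norm-sound e′ ρ))))
    norm-sound (e :* e′)  ρ = trans≈ (*-sound (norm e) (norm e′) ρ) (*-cong (norm-sound e ρ) (norm-sound e′ ρ))
    norm-sound (:- e)     ρ = trans≈ (neg-sound (norm e) ρ) (-‿cong (norm-sound e ρ))
    norm-sound (e :^ k)   ρ = trans≈ (pow-sound (norm e) k ρ) (^-cong k (norm-sound e ρ))
    norm-sound (poly p e) ρ = trans≈ (normPoly-sound p (norm e) ρ) (ev-cong p (norm-sound e ρ))

    sub-sound : ∀ {m n} (e : Expr m) (σ : Vec (Expr n) m) (ρ : Vec Carrier n) →
                ⟦ sub e σ ⟧ ρ ≡ ⟦ e ⟧ (Vec.map (λ t → ⟦ t ⟧ ρ) σ)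
    sub-sound (var i)    σ ρ = ≡.sym (Vecₚ.lookup-map i (λ t → ⟦ t ⟧ ρ) σ)
    sub-sound (con c)    σ ρ = ≡.refl
    sub-sound (e :+ e′)  σ ρ = ≡.cong₂ _+_ (sub-sound e σ ρ) (sub-sound e′ σ ρ)
    sub-sound (e :- e′)  σ ρ = ≡.cong₂ (λ x y → x + - y) (sub-sound e σ ρ) (sub-sound e′ σ ρ)
    sub-sound (e :* e′)  σ ρ = ≡.cong₂ _*_ (sub-sound e σ ρ) (sub-sound e′ σ ρ)
    sub-sound (:- e)     σ ρ = ≡.cong -_ (sub-sound e σ ρ)
    sub-sound (e :^ k)   σ ρ = ≡.cong (_↑ k) (sub-sound e σ ρ)
    sub-sound (poly p e) σ ρ = ≡.cong (ev p) (sub-sound e σ ρ)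

    -- The premise mentions no ring element, so integer arithmetic alone decides it and `refl`
    -- proves it.
    solve : ∀ {n} (e e′ : Expr n) → null (norm (e :- e′)) ≡ true → (ρ : Vec Carrier n) → ⟦ e ⟧ ρ ≈ ⟦ e′ ⟧ ρ
    solve e e′ eq ρ = begin
      ⟦ e ⟧ ρ                                ≈⟨ +-identityʳ _ ⟨
      ⟦ e ⟧ ρ + 0#                           ≈⟨ +-congˡ (-‿inverseˡ (⟦ e′ ⟧ ρ)) ⟨
      ⟦ e ⟧ ρ + (- ⟦ e′ ⟧ ρ + ⟦ e′ ⟧ ρ)      ≈⟨ +-assoc _ _ _ ⟨
      (⟦ e ⟧ ρ + - ⟦ e′ ⟧ ρ) + ⟦ e′ ⟧ ρ      ≈⟨ +-congʳ (norm-sound (e :- e′) ρ) ⟨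
      ⟦ norm (e :- e′) ⟧ᵖ ρ + ⟦ e′ ⟧ ρ       ≈⟨ +-congʳ (null-sound (norm (e :- e′)) ρ eq) ⟩
      0# + ⟦ e′ ⟧ ρ                          ≈⟨ +-identityˡ _ ⟩
      ⟦ e′ ⟧ ρ                               ∎

open PolynomialNormalisation

-- The commutative ring of formal power series over ℤ.

module PowerSeries where

  Series : Set
  Series = ℕ → ℤ

  infix 4 _≈_
  -- A record instead of the bare pointwise statement, so that both series can be recovered from the
  -- type of a proof and stay implicit.
  record _≈_ (f g : Series) : Set where
    constructor mk
    field at : ∀ n → f n ≡ g n
  open _≈_ public

  ≈-refl : ∀ {f} → f ≈ f
  ≈-refl = mk λ _ → refl

  ≈-sym : ∀ {f g} → f ≈ g → g ≈ f
  ≈-sym p = mk λ n → sym (at p n)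

  ≈-trans : ∀ {f g h} → f ≈ g → g ≈ h → f ≈ h
  ≈-trans p r = mk λ n → trans (at p n) (at r n)

  infixl 6 _⊕_
  infixl 7 _⊛_

  _⊕_ : Series → Series → Series
  (f ⊕ g) n = f n ℤ.+ g n

  ⊖_ : Series → Series
  (⊖ f) n = ℤ.- f n

  shift : Series → Series
  shift f n = f (suc n)

  -- The recursion follows f = f 0 + q · `shift f`. Inductions on the exponent therefore have to let
  -- the left factor vary.
  _⊛_ : Series → Series → Series
  (f ⊛ g) zero    = f 0 ℤ.* g 0
  (f ⊛ g) (suc n) = f 0 ℤ.* g (suc n) ℤ.+ (shift f ⊛ g) n

  const : ℤ → Series
  const c zero    = c
  const c (suc n) = + 0

  ⊕-cong : ∀ {f f′ g g′} → f ≈ f′ → g ≈ g′ → f ⊕ g ≈ f′ ⊕ g′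
  ⊕-cong p r = mk λ n → cong₂ ℤ._+_ (at p n) (at r n)

  ⊕-congˡ : ∀ f {g g′} → g ≈ g′ → f ⊕ g ≈ f ⊕ g′
  ⊕-congˡ f = ⊕-cong {f} ≈-refl

  ⊕-congʳ : ∀ g {f f′} → f ≈ f′ → f ⊕ g ≈ f′ ⊕ g
  ⊕-congʳ g p = ⊕-cong {g = g} p ≈-refl

  ⊖-cong : ∀ {f g} → f ≈ g → ⊖ f ≈ ⊖ g
  ⊖-cong p = mk λ n → cong ℤ.-_ (at p n)

  -- Only the coefficients up to n of the factors enter.
  ⊛-local : ∀ n {f f′ g g′} → (∀ i → i ℕ.≤ n → f i ≡ f′ i) → (∀ i → i ℕ.≤ n → g i ≡ g′ i) →
            (f ⊛ g) n ≡ (f′ ⊛ g′) n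
  ⊛-local zero    p r = cong₂ ℤ._*_ (p 0 ℕ.z≤n) (r 0 ℕ.z≤n)
  ⊛-local (suc n) p r = cong₂ ℤ._+_ (cong₂ ℤ._*_ (p 0 ℕ.z≤n) (r (suc n) ℕₚ.≤-refl))
    (⊛-local n (λ i i≤n → p (suc i) (ℕ.s≤s i≤n)) (λ i i≤n → r i (ℕₚ.m≤n⇒m≤1+n i≤n)))

  ⊛-cong : ∀ {f f′ g g′} → f ≈ f′ → g ≈ g′ → f ⊛ g ≈ f′ ⊛ g′
  ⊛-cong p r = mk λ n → ⊛-local n (λ i _ → at p i) (λ i _ → at r i)

  ⊛-congˡ : ∀ {f g g′} → g ≈ g′ → f ⊛ g ≈ f ⊛ g′
  ⊛-congˡ = ⊛-cong ≈-refl

  ⊛-congʳ : ∀ {f f′ g} → f ≈ f′ → f ⊛ g ≈ f′ ⊛ g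
  ⊛-congʳ p = ⊛-cong p ≈-refl

  -- The product peels its left factor; peeling the right one as well is what turns commutativity
  -- into an induction.
  ⊛-suc-right : ∀ f g n → (f ⊛ g) (suc n) ≡ f (suc n) ℤ.* g 0 ℤ.+ (f ⊛ shift g) n
  ⊛-suc-right f g zero    = ℤₚ.+-comm (f 0 ℤ.* g 1) (f 1 ℤ.* g 0)
  ⊛-suc-right f g (suc n) = trans (cong (λ t → f 0 ℤ.* g (suc (suc n)) ℤ.+ t) (⊛-suc-right (shift f) g n))
    (swap (f 0 ℤ.* g (suc (suc n))) (f (suc (suc n)) ℤ.* g 0) _)
    where
    swap : ∀ a b c → a ℤ.+ (b ℤ.+ c) ≡ b ℤ.+ (a ℤ.+ c)
    swap = solve-∀

  ⊛-comm : ∀ f g → f ⊛ g ≈ g ⊛ f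
  ⊛-comm f g = mk (λ n → go n f g)
    where
    go : ∀ n f g → (f ⊛ g) n ≡ (g ⊛ f) n
    go zero    f g = ℤₚ.*-comm (f 0) (g 0)
    go (suc n) f g = trans (⊛-suc-right f g n)
      (cong₂ ℤ._+_ (ℤₚ.*-comm (f (suc n)) (g 0)) (go n f (shift g)))

  ⊛-distribʳ : ∀ h f g → (f ⊕ g) ⊛ h ≈ f ⊛ h ⊕ g ⊛ h
  ⊛-distribʳ h f g = mk (λ n → go n f g)
    where
    rearrange : ∀ a b c d e → (a ℤ.+ b) ℤ.* c ℤ.+ (d ℤ.+ e) ≡ (a ℤ.* c ℤ.+ d) ℤ.+ (b ℤ.* c ℤ.+ e)
    rearrange = solve-∀
    go : ∀ n f g → ((f ⊕ g) ⊛ h) n ≡ (f ⊛ h ⊕ g ⊛ h) n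
    go zero    f g = ℤₚ.*-distribʳ-+ (h 0) (f 0) (g 0)
    go (suc n) f g = trans (cong (λ t → (f 0 ℤ.+ g 0) ℤ.* h (suc n) ℤ.+ t) (go n (shift f) (shift g)))
      (rearrange (f 0) (g 0) (h (suc n)) _ _)

  ⊛-distribˡ : ∀ h f g → h ⊛ (f ⊕ g) ≈ h ⊛ f ⊕ h ⊛ g
  ⊛-distribˡ h f g = ≈-trans (⊛-comm h (f ⊕ g)) (≈-trans (⊛-distribʳ h f g) (⊕-cong (⊛-comm f h) (⊛-comm g h)))

  infixr 8 _·_
  _·_ : ℤ → Series → Series
  (c · f) n = c ℤ.* f n

  ·-⊛ : ∀ c f g → (c · f) ⊛ g ≈ c · (f ⊛ g)
  ·-⊛ c f g = mk (λ n → go n f)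
    where
    rearrange : ∀ c a b d → c ℤ.* a ℤ.* b ℤ.+ c ℤ.* d ≡ c ℤ.* (a ℤ.* b ℤ.+ d)
    rearrange = solve-∀
    go : ∀ n f → ((c · f) ⊛ g) n ≡ c ℤ.* (f ⊛ g) n
    go zero    f = ℤₚ.*-assoc c (f 0) (g 0)
    go (suc n) f = trans (cong (λ t → c ℤ.* f 0 ℤ.* g (suc n) ℤ.+ t) (go n (shift f))) (rearrange c (f 0) (g (suc n)) _)

  ⊛-assoc : ∀ f g h → (f ⊛ g) ⊛ h ≈ f ⊛ (g ⊛ h)
  ⊛-assoc f g h = mk (λ n → go n f)
    where
    rearrange : ∀ a b c d e → a ℤ.* b ℤ.* c ℤ.+ (a ℤ.* d ℤ.+ e) ≡ a ℤ.* (b ℤ.* c ℤ.+ d) ℤ.+ e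
    rearrange = solve-∀
    go : ∀ n f → ((f ⊛ g) ⊛ h) n ≡ (f ⊛ (g ⊛ h)) n
    go zero    f = ℤₚ.*-assoc (f 0) (g 0) (h 0)
    go (suc n) f = trans (cong (λ t → f 0 ℤ.* g 0 ℤ.* h (suc n) ℤ.+ t)
        (trans (at (⊛-distribʳ h (f 0 · shift g) (shift f ⊛ g)) n)
               (cong₂ ℤ._+_ (at (·-⊛ (f 0) (shift g) h) n) (go n (shift f)))))
      (rearrange (f 0) (g 0) (h (suc n)) _ _)

  const-⊛ : ∀ c f → const c ⊛ f ≈ c · f
  const-⊛ c f = mk (go f)
    where
    zeros : ∀ n → ((λ _ → + 0) ⊛ f) n ≡ + 0
    zeros zero    = refl
    zeros (suc n) = trans (ℤₚ.+-identityˡ _) (zeros n)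
    go : ∀ f n → (const c ⊛ f) n ≡ c ℤ.* f n
    go f zero    = refl
    go f (suc n) = trans (cong (λ t → c ℤ.* f (suc n) ℤ.+ t) (go′ f n)) (ℤₚ.+-identityʳ _)
      where
      go′ : ∀ f n → (shift (const c) ⊛ f) n ≡ + 0
      go′ f zero    = refl
      go′ f (suc n) = trans (ℤₚ.+-identityˡ _) (go′ f n)

  ⊛-identityˡ : ∀ f → const (+ 1) ⊛ f ≈ f
  ⊛-identityˡ f = ≈-trans (const-⊛ (+ 1) f) (mk λ n → ℤₚ.*-identityˡ (f n))

  ⊛-identityʳ : ∀ f → f ⊛ const (+ 1) ≈ f
  ⊛-identityʳ f = ≈-trans (⊛-comm f _) (⊛-identityˡ f)

  const-0 : ∀ n → const (+ 0) n ≡ + 0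
  const-0 zero    = refl
  const-0 (suc n) = refl

  ≈-isEquivalence : IsEquivalence _≈_
  ≈-isEquivalence = record { refl = ≈-refl ; sym = ≈-sym ; trans = ≈-trans }

  seriesRing : CommutativeRing 0ℓ 0ℓ
  seriesRing = record
    { Carrier = Series ; _≈_ = _≈_ ; _+_ = _⊕_ ; _*_ = _⊛_ ; -_ = ⊖_
    ; 0# = const (+ 0) ; 1# = const (+ 1)
    ; isCommutativeRing = record
      { isRing = record
        { +-isAbelianGroup = record
          { isGroup = record
            { isMonoid = record
              { isSemigroup = record
                { isMagma = record { isEquivalence = ≈-isEquivalence ; ∙-cong = ⊕-cong }
                ; assoc = λ f g h → mk λ n → ℤₚ.+-assoc (f n) (g n) (h n) }
              ; identity = (λ f → mk λ n → trans (cong (ℤ._+ f n) (const-0 n)) (ℤₚ.+-identityˡ (f n)))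
                         , (λ f → mk λ n → trans (cong (λ t → f n ℤ.+ t) (const-0 n)) (ℤₚ.+-identityʳ (f n))) }
            ; inverse = (λ f → mk λ n → trans (ℤₚ.+-inverseˡ (f n)) (sym (const-0 n)))
                      , (λ f → mk λ n → trans (ℤₚ.+-inverseʳ (f n)) (sym (const-0 n)))
            ; ⁻¹-cong = ⊖-cong }
          ; comm = λ f g → mk λ n → ℤₚ.+-comm (f n) (g n) }
        ; *-cong = ⊛-cong
        ; *-assoc = ⊛-assoc
        ; *-identity = ⊛-identityˡ , ⊛-identityʳ
        ; distrib = ⊛-distribˡ , ⊛-distribʳ }
      ; *-comm = ⊛-comm } }

  const-+ : ∀ a b → const (a ℤ.+ b) ≈ const a ⊕ const b
  const-+ a b = mk λ { zero → refl ; (suc n) → refl }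

  const-* : ∀ a b → const (a ℤ.* b) ≈ const a ⊛ const b
  const-* a b = ≈-sym (≈-trans (const-⊛ a (const b)) (mk λ { zero → refl ; (suc n) → ℤₚ.*-zeroʳ a }))

open PowerSeries

-- The operators D, V and U, fixed points, inverses and cancellation.

module Operators where

  open SetoidReasoning (CommutativeRing.setoid seriesRing)

  module S = Eval seriesRing const const-+ const-* ≈-refl ≈-refl
  open S public using (_↑_; ev; ev-cong; ^-cong; ⟦_⟧; ⟦_⟧ᵖ; norm-sound) renaming (solve to solveₛ)
  module Z = Eval ℤₚ.+-*-commutativeRing (λ c → c) (λ _ _ → refl) (λ _ _ → refl) refl refl


  0ₛ 1ₛ : Series
  0ₛ = const (+ 0)
  1ₛ = const (+ 1)

  qs : Series → Series
  qs f zero    = + 0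
  qs f (suc n) = f n

  X : Series
  X = qs 1ₛ

  X-⊛ : ∀ f → X ⊛ f ≈ qs f
  X-⊛ f = mk λ { zero → refl ; (suc n) → trans (ℤₚ.+-identityˡ _) (trans (⊛-local n (λ { zero _ → refl ; (suc i) _ → refl }) (λ _ _ → refl)) (at (⊛-identityˡ f) n)) }

  qs-cong : ∀ {f g} → f ≈ g → qs f ≈ qs g
  qs-cong p = mk λ { zero → refl ; (suc n) → at p n }

  head-tail : ∀ f → f ≈ const (f 0) ⊕ qs (shift f)
  head-tail f = mk λ { zero → sym (ℤₚ.+-identityʳ _) ; (suc n) → sym (ℤₚ.+-identityˡ _) }

  -- The derivation q d/dq.
  D : Series → Series
  D f n = + n ℤ.* f n

  D-cong : ∀ {f g} → f ≈ g → D f ≈ D g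
  D-cong p = mk λ n → cong (+ n ℤ.*_) (at p n)

  D-⊕ : ∀ f g → D (f ⊕ g) ≈ D f ⊕ D g
  D-⊕ f g = mk λ n → ℤₚ.*-distribˡ-+ (+ n) (f n) (g n)

  D-⊖ : ∀ f → D (⊖ f) ≈ ⊖ D f
  D-⊖ f = mk λ n → sym (ℤₚ.neg-distribʳ-* (+ n) (f n))

  D-const : ∀ c → D (const c) ≈ 0ₛ
  D-const c = mk λ { zero → refl ; (suc n) → ℤₚ.*-zeroʳ (+ suc n) }

  suc-*-ℤ : ∀ n a → + suc n ℤ.* a ≡ a ℤ.+ + n ℤ.* a
  suc-*-ℤ n a = trans (ℤₚ.*-distribʳ-+ a (+ 1) (+ n)) (cong (ℤ._+ + n ℤ.* a) (ℤₚ.*-identityˡ a))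

  D-⊛ : ∀ f g → D (f ⊛ g) ≈ D f ⊛ g ⊕ f ⊛ D g
  D-⊛ f g = mk (λ n → go n f)
    where
    zeroCase : ∀ a b → + 0 ℤ.* (a ℤ.* b) ≡ + 0 ℤ.* a ℤ.* b ℤ.+ a ℤ.* (+ 0 ℤ.* b)
    zeroCase = solve-∀
    rearrange : ∀ a b n c d e → (a ℤ.* b ℤ.+ c) ℤ.+ (n ℤ.* (a ℤ.* b) ℤ.+ (d ℤ.+ e)) ≡
                + 0 ℤ.* a ℤ.* b ℤ.+ (d ℤ.+ c) ℤ.+ (a ℤ.* (b ℤ.+ n ℤ.* b) ℤ.+ e)
    rearrange = solve-∀
    shift-D : ∀ f i → shift (D f) i ≡ (D (shift f) ⊕ shift f) i
    shift-D f i = trans (suc-*-ℤ i (f (suc i))) (ℤₚ.+-comm (f (suc i)) _)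
    go : ∀ n f → D (f ⊛ g) n ≡ (D f ⊛ g ⊕ f ⊛ D g) n
    go zero    f = zeroCase (f 0) (g 0)
    go (suc n) f = trans (suc-*-ℤ n _) (trans
      (cong (λ t → (a ℤ.* b ℤ.+ c) ℤ.+ t) (trans (ℤₚ.*-distribˡ-+ (+ n) (a ℤ.* b) c)
        (cong (λ t → + n ℤ.* (a ℤ.* b) ℤ.+ t) (go n (shift f)))))
      (trans (rearrange a b (+ n) c d e)
        (cong₂ ℤ._+_ (cong (λ t → + 0 ℤ.* a ℤ.* b ℤ.+ t)
          (sym (trans (⊛-local n {g = g} (λ i _ → shift-D f i) (λ _ _ → refl)) (at (⊛-distribʳ g (D (shift f)) (shift f)) n))))
          (cong (λ t → a ℤ.* t ℤ.+ e) (sym (suc-*-ℤ n b))))))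
      where
      a = f 0
      b = g (suc n)
      c = (shift f ⊛ g) n
      d = (D (shift f) ⊛ g) n
      e = (shift f ⊛ D g) n

  -- spread j f is q^j f(q^13).
  spread : ℕ → Series → Series
  spread zero    f zero    = f 0
  spread zero    f (suc n) = spread 12 (shift f) n
  spread (suc j) f zero    = + 0
  spread (suc j) f (suc n) = spread j f n

  V U : Series → Series
  V = spread 0
  U f n = f (n ℕ.* 13)

  spread-cong : ∀ j {f g} → f ≈ g → spread j f ≈ spread j g
  spread-cong j p = mk (λ n → go j n p)
    where
    go : ∀ j n {f g} → f ≈ g → spread j f n ≡ spread j g n
    go zero    zero    p = at p 0
    go zero    (suc n) p = go 12 n (mk λ i → at p (suc i))
    go (suc j) zero    p = refl
    go (suc j) (suc n) p = go j n p

  V-cong : ∀ {f g} → f ≈ g → V f ≈ V g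
  V-cong = spread-cong 0

  U-cong : ∀ {f g} → f ≈ g → U f ≈ U g
  U-cong p = mk λ n → at p (n ℕ.* 13)

  spread-⊕ : ∀ j f g → spread j (f ⊕ g) ≈ spread j f ⊕ spread j g
  spread-⊕ j f g = mk (λ n → go j n f g)
    where
    go : ∀ j n f g → spread j (f ⊕ g) n ≡ spread j f n ℤ.+ spread j g n
    go zero    zero    f g = refl
    go zero    (suc n) f g = go 12 n (shift f) (shift g)
    go (suc j) zero    f g = refl
    go (suc j) (suc n) f g = go j n f g

  spread-· : ∀ j c f → spread j (c · f) ≈ c · spread j f
  spread-· j c f = mk (λ n → go j n f)
    where
    go : ∀ j n f → spread j (c · f) n ≡ c ℤ.* spread j f n
    go zero    zero    f = refl
    go zero    (suc n) f = go 12 n (shift f)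
    go (suc j) zero    f = sym (ℤₚ.*-zeroʳ c)
    go (suc j) (suc n) f = go j n f

  spread-⊛ : ∀ j f g → spread j (f ⊛ g) ≈ spread j f ⊛ V g
  spread-⊛ j f g = mk (λ n → sym (go j n f))
    where
    go : ∀ j n f → (spread j f ⊛ V g) n ≡ spread j (f ⊛ g) n
    go zero    zero    f = refl
    go zero    (suc n) f = trans (cong₂ ℤ._+_ (sym (at (spread-· 12 (f 0) (shift g)) n)) (go 12 n (shift f)))
                                 (sym (at (spread-⊕ 12 (f 0 · shift g) (shift f ⊛ g)) n))
    go (suc j) zero    f = refl
    go (suc j) (suc n) f = trans (ℤₚ.+-identityˡ _) (go j n f)

  V-⊕ : ∀ f g → V (f ⊕ g) ≈ V f ⊕ V g
  V-⊕ = spread-⊕ 0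

  V-⊛ : ∀ f g → V (f ⊛ g) ≈ V f ⊛ V g
  V-⊛ = spread-⊛ 0

  V-const : ∀ c → V (const c) ≈ const c
  V-const c = mk λ { zero → refl ; (suc n) → zeros 12 n }
    where
    zeros : ∀ j n → spread j (shift (const c)) n ≡ + 0
    zeros zero    zero    = refl
    zeros zero    (suc n) = trans (at (spread-cong 12 (mk λ _ → refl)) n) (zeros 12 n)
    zeros (suc j) zero    = refl
    zeros (suc j) (suc n) = zeros j n

  V-⊖ : ∀ f → V (⊖ f) ≈ ⊖ V f
  V-⊖ f = begin
    V (⊖ f)               ≈⟨ V-cong (mk λ n → sym (ℤₚ.-1*i≡-i (f n))) ⟩
    V (-[1+ 0 ] · f)      ≈⟨ spread-· 0 -[1+ 0 ] f ⟩
    -[1+ 0 ] · V f        ≈⟨ mk (λ n → ℤₚ.-1*i≡-i (V f n)) ⟩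
    ⊖ V f                 ∎

  V-ev : ∀ p x → V (ev p x) ≈ ev p (V x)
  V-ev []      x = V-const (+ 0)
  V-ev (c ∷ p) x = ≈-trans (V-⊕ (const c) (x ⊛ ev p x))
    (⊕-cong (V-const c) (≈-trans (V-⊛ x (ev p x)) (⊛-congˡ (V-ev p x))))

  V-↑ : ∀ x k → V (x ↑ k) ≈ V x ↑ k
  V-↑ x zero    = V-const (+ 1)
  V-↑ x (suc k) = ≈-trans (V-⊛ x (x ↑ k)) (⊛-congˡ (V-↑ x k))

  -- Proved for every j at once, because the recursion of `spread` passes through all residues;
  -- `D-V` is the case j = 0.
  D-spread : ∀ j n f → + n ℤ.* spread j f n ≡ spread j (λ m → + (m ℕ.* 13 ℕ.+ j) ℤ.* f m) n
  D-spread-suc : ∀ j n f → + suc n ℤ.* spread j f n ≡ spread j (λ m → + suc (m ℕ.* 13 ℕ.+ j) ℤ.* f m) n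
  D-spread-suc j n f = trans (suc-*-ℤ n (spread j f n)) (trans
    (cong (λ t → spread j f n ℤ.+ t) (D-spread j n f))
    (trans (sym (at (spread-⊕ j f (λ m → + (m ℕ.* 13 ℕ.+ j) ℤ.* f m)) n))
      (at (spread-cong j (mk λ m → sym (suc-*-ℤ (m ℕ.* 13 ℕ.+ j) (f m)))) n)))
  D-spread zero    zero    f = refl
  D-spread zero    (suc n) f = trans (D-spread-suc 12 n (shift f))
    (at (spread-cong 12 {λ m → + suc (m ℕ.* 13 ℕ.+ 12) ℤ.* f (suc m)} (mk λ m → cong (λ t → + t ℤ.* f (suc m)) (step m))) n)
    where
    step : ∀ m → suc (m ℕ.* 13 ℕ.+ 12) ≡ suc m ℕ.* 13 ℕ.+ 0
    step m = trans (cong suc (ℕₚ.+-comm (m ℕ.* 13) 12)) (sym (ℕₚ.+-identityʳ _))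
  D-spread (suc j) zero    f = refl
  D-spread (suc j) (suc n) f = trans (D-spread-suc j n f)
    (at (spread-cong j {λ m → + suc (m ℕ.* 13 ℕ.+ j) ℤ.* f m} (mk λ m → cong (λ t → + t ℤ.* f m) (sym (ℕₚ.+-suc (m ℕ.* 13) j)))) n)

  D-V : ∀ f → D (V f) ≈ const (+ 13) ⊛ V (D f)
  D-V f = ≈-trans (mk λ n → D-spread 0 n f) (≈-trans
    (spread-cong 0 (mk λ m → trans (cong (λ t → + t ℤ.* f m) (trans (ℕₚ.+-identityʳ _) (ℕₚ.*-comm m 13)))
      (trans (cong (ℤ._* f m) (ℤₚ.pos-* 13 m)) (ℤₚ.*-assoc (+ 13) (+ m) (f m)))))
    (≈-trans (spread-· 0 (+ 13) (D f)) (≈-sym (const-⊛ (+ 13) _))))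

  -- V f has exponents divisible by 13 only, so it acts as a scalar for U. Every later evaluation of
  -- U rests on this linearity.
  U-V : ∀ f g → U (V f ⊛ g) ≈ f ⊛ U g
  U-V f g = mk (λ n → go n f)
    where
    skip : ∀ j n f → (spread j f ⊛ g) (j ℕ.+ n) ≡ (V f ⊛ g) n
    skip zero    n f = refl
    skip (suc j) n f = trans (ℤₚ.+-identityˡ _) (skip j n f)
    go : ∀ n f → U (V f ⊛ g) n ≡ (f ⊛ U g) n
    go zero    f = refl
    go (suc n) f = cong (λ t → f 0 ℤ.* g (suc n ℕ.* 13) ℤ.+ t) (trans (skip 12 (n ℕ.* 13) (shift f)) (go n (shift f)))

  -- Contraction in the q-adic sense: a coefficient of the image sees only strictly earlier ones.
  -- Fixed points then exist uniquely; they provide inverses here and coordinates in a basis later.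
  Contraction : (Series → Series) → Set
  Contraction Ξ = ∀ n {f g} → (∀ i → i ℕ.< n → f i ≡ g i) → Ξ f n ≡ Ξ g n

  module _ (Ξ : Series → Series) (contr : Contraction Ξ) where
    private
      iterate : ℕ → Series
      iterate zero    = 0ₛ
      iterate (suc n) = Ξ (iterate n)

      agree : ∀ m k i → i ℕ.< m → i ℕ.< k → iterate m i ≡ iterate k i
      agree (suc m) (suc k) i (ℕ.s≤s i≤m) (ℕ.s≤s i≤k) =
        contr i λ j j<i → agree m k j (ℕₚ.<-≤-trans j<i i≤m) (ℕₚ.<-≤-trans j<i i≤k)

    fix : Series
    -- After n + 1 iterations the coefficients up to n no longer change.
    fix n = iterate (suc n) n

    fix-fixed : fix ≈ Ξ fix
    fix-fixed = mk λ n → contr n λ i i<n → agree n (suc i) i i<n (ℕₚ.n<1+n i)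

    fix-unique : ∀ {f g} → f ≈ Ξ f → g ≈ Ξ g → f ≈ g
    fix-unique {f} {g} p r = mk λ n → go (suc n) n (ℕₚ.n<1+n n)
      where
      go : ∀ m i → i ℕ.< m → f i ≡ g i
      go (suc m) i (ℕ.s≤s i≤m) = trans (at p i) (trans (contr i λ j j<i → go m j (ℕₚ.<-≤-trans j<i i≤m)) (sym (at r i)))

  qs-contraction : ∀ h c → Contraction (λ g → c ⊕ qs (h ⊛ g))
  qs-contraction h c zero    p = refl
  qs-contraction h c (suc n) p = cong (λ t → c (suc n) ℤ.+ t) (⊛-local n (λ _ _ → refl) (λ i i≤n → p i (ℕ.s≤s i≤n)))

  -- For f = 1 + q f₁ the inverse solves g = 1 - q f₁ g. The constant term of f is never read, so
  -- this is an inverse only if that term is 1.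
  inv : Series → Series
  inv f = fix (λ g → 1ₛ ⊕ qs (⊖ shift f ⊛ g)) (qs-contraction (⊖ shift f) 1ₛ)

  one-plus-X : ∀ f → f 0 ≡ + 1 → f ≈ 1ₛ ⊕ X ⊛ shift f
  one-plus-X f f0 = ≈-trans (head-tail f) (⊕-cong (mk λ n → cong (λ c → const c n) f0) (≈-sym (X-⊛ (shift f))))

  pattern v0 = var zero
  pattern v1 = var (suc zero)
  pattern v2 = var (suc (suc zero))
  pattern v3 = var (suc (suc (suc zero)))
  pattern v4 = var (suc (suc (suc (suc zero))))
  pattern v5 = var (suc (suc (suc (suc (suc zero)))))
  pattern v6 = var (suc (suc (suc (suc (suc (suc zero))))))

  ⊛-inv : ∀ f → f 0 ≡ + 1 → f ⊛ inv f ≈ 1ₛ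
  ⊛-inv f f0 = begin
    f ⊛ g                              ≈⟨ ⊛-congʳ (one-plus-X f f0) ⟩
    (1ₛ ⊕ X ⊛ shift f) ⊛ g             ≈⟨ solveₛ ((con (+ 1) :+ v0 :* v1) :* v2) (v2 :- v0 :* (:- v1 :* v2)) refl (X ∷ shift f ∷ g ∷ []) ⟩
    g ⊕ ⊖ (X ⊛ (⊖ shift f ⊛ g))        ≈⟨ ⊕-cong (fix-fixed _ (qs-contraction (⊖ shift f) 1ₛ)) (⊖-cong (X-⊛ _)) ⟩
    (1ₛ ⊕ t) ⊕ ⊖ t                      ≈⟨ solveₛ ((con (+ 1) :+ v0) :- v0) (con (+ 1)) refl (t ∷ []) ⟩
    1ₛ                                 ∎
    where
    g = inv f
    t = qs (⊖ shift f ⊛ g)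

  -- As ℤ has no zero divisors, the lowest coefficient of g vanishes; then the argument repeats for
  -- `shift g`.
  cancel-0 : ∀ f g → ¬ f 0 ≡ + 0 → f ⊛ g ≈ 0ₛ → g ≈ 0ₛ
  cancel-0 f g f0 p = mk λ n → trans (go n g (λ i _ → trans (at p i) (const-0 i))) (sym (const-0 n))
    where
    go : ∀ n g → (∀ i → i ℕ.≤ n → (f ⊛ g) i ≡ + 0) → g n ≡ + 0
    go-0 : ∀ g → (f ⊛ g) 0 ≡ + 0 → g 0 ≡ + 0
    go-0 g p with ℤₚ.i*j≡0⇒i≡0∨j≡0 (f 0) p
    ... | inj₁ f0≡0 = ⊥-elim (f0 f0≡0)
    ... | inj₂ g0≡0 = g0≡0
    go zero    g p = go-0 g (p 0 ℕ.z≤n)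
    go (suc n) g p = go n (shift g) λ i i≤n → trans
      (sym (trans (⊛-suc-right f g i) (trans (cong (λ t → f (suc i) ℤ.* t ℤ.+ (f ⊛ shift g) i) (go-0 g (p 0 ℕ.z≤n)))
        (trans (cong (ℤ._+ (f ⊛ shift g) i) (ℤₚ.*-zeroʳ (f (suc i)))) (ℤₚ.+-identityˡ _)))))
      (p (suc i) (ℕ.s≤s i≤n))

  cancel-X : ∀ k g → X ↑ k ⊛ g ≈ 0ₛ → g ≈ 0ₛ
  cancel-X zero    g p = ≈-trans (≈-sym (⊛-identityˡ g)) p
  cancel-X (suc k) g p = cancel-X k g (mk λ n → trans (trans (sym (at (≈-trans (⊛-assoc X (X ↑ k) g) (X-⊛ _)) (suc n))) (at p (suc n))) (sym (const-0 n)))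

  minus-0 : ∀ {f g} → f ⊕ ⊖ g ≈ 0ₛ → f ≈ g
  minus-0 {f} {g} p = mk λ n → ℤₚ.i-j≡0⇒i≡j (f n) (g n) (trans (at p n) (const-0 n))

  0-minus : ∀ {f g} → f ≈ g → f ⊕ ⊖ g ≈ 0ₛ
  0-minus {f} {g} p = mk λ n → trans (ℤₚ.i≡j⇒i-j≡0 (at p n)) (sym (const-0 n))

  cancelˡ : ∀ f {g h} → ¬ f 0 ≡ + 0 → f ⊛ g ≈ f ⊛ h → g ≈ h
  cancelˡ f {g} {h} f0 p = minus-0 (cancel-0 f _ f0 (begin
    f ⊛ (g ⊕ ⊖ h)          ≈⟨ solveₛ (v0 :* (v1 :- v2)) (v0 :* v1 :- v0 :* v2) refl (f ∷ g ∷ h ∷ []) ⟩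
    f ⊛ g ⊕ ⊖ (f ⊛ h)      ≈⟨ 0-minus p ⟩
    0ₛ                     ∎))

  cancelˡ-X : ∀ k {g h} → X ↑ k ⊛ g ≈ X ↑ k ⊛ h → g ≈ h
  cancelˡ-X k {g} {h} p = minus-0 (cancel-X k _ (begin
    X ↑ k ⊛ (g ⊕ ⊖ h)              ≈⟨ solveₛ (v0 :* (v1 :- v2)) (v0 :* v1 :- v0 :* v2) refl (X ↑ k ∷ g ∷ h ∷ []) ⟩
    X ↑ k ⊛ g ⊕ ⊖ (X ↑ k ⊛ h)      ≈⟨ 0-minus p ⟩
    0ₛ                             ∎))

open Operators

-- Finite sums over the solutions of ax + by = n.

module ConvolutionSums where

  sum : ℕ → (ℕ → ℤ) → ℤ
  sum zero    F = + 0
  sum (suc N) F = sum N F ℤ.+ F N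

  sum-cong-< : ∀ N {F G} → (∀ i → i ℕ.< N → F i ≡ G i) → sum N F ≡ sum N G
  sum-cong-< zero    p = refl
  sum-cong-< (suc N) p = cong₂ ℤ._+_ (sum-cong-< N λ i i<N → p i (ℕₚ.m<n⇒m<1+n i<N)) (p N (ℕₚ.n<1+n N))

  sum-cong : ∀ N {F G} → (∀ i → F i ≡ G i) → sum N F ≡ sum N G
  sum-cong N p = sum-cong-< N (λ i _ → p i)

  interchange : ∀ a b c d → (a ℤ.+ b) ℤ.+ (c ℤ.+ d) ≡ (a ℤ.+ c) ℤ.+ (b ℤ.+ d)
  interchange = solve-∀

  sum-+ : ∀ N F G → sum N (λ i → F i ℤ.+ G i) ≡ sum N F ℤ.+ sum N G
  sum-+ zero    F G = refl
  sum-+ (suc N) F G = trans (cong (ℤ._+ (F N ℤ.+ G N)) (sum-+ N F G)) (interchange (sum N F) _ _ _)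

  sum-* : ∀ N c F → sum N (λ i → c ℤ.* F i) ≡ c ℤ.* sum N F
  sum-* zero    c F = sym (ℤₚ.*-zeroʳ c)
  sum-* (suc N) c F = trans (cong (ℤ._+ c ℤ.* F N) (sum-* N c F)) (sym (ℤₚ.*-distribˡ-+ c _ _))

  sum-*ʳ : ∀ N c F → sum N (λ i → F i ℤ.* c) ≡ sum N F ℤ.* c
  sum-*ʳ N c F = trans (sum-cong N λ i → ℤₚ.*-comm (F i) c) (trans (sum-* N c F) (ℤₚ.*-comm c _))

  sum-0 : ∀ N {F} → (∀ i → i ℕ.< N → F i ≡ + 0) → sum N F ≡ + 0
  sum-0 zero    p = refl
  sum-0 (suc N) p = cong₂ ℤ._+_ (sum-0 N λ i i<N → p i (ℕₚ.m<n⇒m<1+n i<N)) (p N (ℕₚ.n<1+n N))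

  sum-swap : ∀ M N (F : ℕ → ℕ → ℤ) → sum M (λ i → sum N (F i)) ≡ sum N (λ j → sum M (λ i → F i j))
  sum-swap zero    N F = sym (sum-0 N λ _ _ → refl)
  sum-swap (suc M) N F = trans (cong (ℤ._+ sum N (F M)) (sum-swap M N F)) (sym (sum-+ N _ _))

  sum-split : ∀ M N F → sum (M ℕ.+ N) F ≡ sum M F ℤ.+ sum N (λ i → F (M ℕ.+ i))
  sum-split M zero    F = trans (cong (λ m → sum m F) (ℕₚ.+-identityʳ M)) (sym (ℤₚ.+-identityʳ _))
  sum-split M (suc N) F = trans (cong (λ m → sum m F) (ℕₚ.+-suc M N))
    (trans (cong (ℤ._+ F (M ℕ.+ N)) (sum-split M N F)) (ℤₚ.+-assoc (sum M F) _ _))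

  sum-extend : ∀ M N F → (∀ i → M ℕ.≤ i → F i ≡ + 0) → M ℕ.≤ N → sum N F ≡ sum M F
  sum-extend M N F p M≤N = trans (cong (λ m → sum m F) (sym (ℕₚ.m+[n∸m]≡n M≤N))) (trans (sum-split M (N ∸ M) F)
    (trans (cong (λ t → sum M F ℤ.+ t) (sum-0 (N ∸ M) λ i _ → p _ (ℕₚ.m≤m+n M i))) (ℤₚ.+-identityʳ _)))

  square-split : ∀ N (F : ℕ → ℕ → ℤ) → sum N (λ x → sum N (F x)) ≡
    (sum N (λ x → sum x (F x)) ℤ.+ sum N (λ x → F x x)) ℤ.+ sum N (λ y → sum y (λ x → F x y))
  square-split zero    F = refl
  square-split (suc N) F = trans (cong (ℤ._+ (sum N (F N) ℤ.+ F N N)) (trans (sum-+ N _ _) (cong (ℤ._+ sum N (λ x → F x N)) (square-split N F))))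
    (rearrange (sum N (λ x → sum x (F x))) (sum N (λ x → F x x)) (sum N (λ y → sum y (λ x → F x y)))
      (sum N (λ x → F x N)) (sum N (F N)) (F N N))
    where
    rearrange : ∀ a b c d e f → (((a ℤ.+ b) ℤ.+ c) ℤ.+ d) ℤ.+ (e ℤ.+ f) ≡ ((a ℤ.+ e) ℤ.+ (b ℤ.+ f)) ℤ.+ (c ℤ.+ d)
    rearrange = solve-∀

  split-row : ∀ N F x → x ℕ.< N → (∀ y → N ℕ.≤ y → F y ≡ + 0) →
              sum N F ≡ (sum x F ℤ.+ F x) ℤ.+ sum N (λ d → F (x ℕ.+ suc d))
  split-row N F x x<N p = trans (sym (sum-extend N (suc x ℕ.+ N) F p (ℕₚ.m≤n+m N (suc x))))
    (trans (sum-split (suc x) N F) (cong (λ t → sum x F ℤ.+ F x ℤ.+ t) (sum-cong N λ d → cong F (sym (ℕₚ.+-suc x d)))))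

  +-cancelˡ : ∀ a {b c} → a ℤ.+ b ≡ a ℤ.+ c → b ≡ c
  +-cancelˡ a = GroupProperties.∙-cancelˡ (AbelianGroup.group ℤₚ.+-0-abelianGroup) a _ _

  -- A pair x < y is written with y = x + d + 1. Since d then runs over the whole range below N, F
  -- has to vanish once its second argument reaches N.
  upper-triangle : ∀ N (F : ℕ → ℕ → ℤ) → (∀ x y → N ℕ.≤ y → F x y ≡ + 0) →
    sum N (λ y → sum y (λ x → F x y)) ≡ sum N (λ x → sum N (λ d → F x (x ℕ.+ suc d)))
  upper-triangle N F p = +-cancelˡ (sum N (λ x → sum x (F x)) ℤ.+ sum N (λ x → F x x))
    (trans (sym (square-split N F)) (trans (sum-cong-< N λ x x<N → split-row N (F x) x x<N (p x))
      (trans (sum-+ N _ _) (cong (ℤ._+ sum N (λ x → sum N (λ d → F x (x ℕ.+ suc d)))) (sum-+ N _ _)))))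

  trichotomy : ∀ N (F : ℕ → ℕ → ℤ) → (∀ x y → N ℕ.≤ y → F x y ≡ + 0) → (∀ x y → N ℕ.≤ x → F x y ≡ + 0) →
    sum N (λ x → sum N (F x)) ≡
    (sum N (λ x → sum N (λ d → F x (x ℕ.+ suc d))) ℤ.+ sum N (λ y → sum N (λ d → F (y ℕ.+ suc d) y))) ℤ.+ sum N (λ x → F x x)
  trichotomy N F p r = trans (square-split N F) (trans
    (cong₂ (λ s t → (s ℤ.+ sum N (λ x → F x x)) ℤ.+ t) (upper-triangle N (λ y x → F x y) (λ x y → r y x)) (upper-triangle N F p))
    (rearrange (sum N (λ y → sum N (λ d → F (y ℕ.+ suc d) y))) (sum N (λ x → F x x)) _))
    where
    rearrange : ∀ a b c → (a ℤ.+ b) ℤ.+ c ≡ (c ℤ.+ a) ℤ.+ b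
    rearrange = solve-∀

  -- δ m is the series q^m.
  δ : ℕ → Series
  δ zero    zero    = + 1
  δ zero    (suc n) = + 0
  δ (suc m) zero    = + 0
  δ (suc m) (suc n) = δ m n

  δ-> : ∀ m n → n ℕ.< m → δ m n ≡ + 0
  δ-> (suc m) zero    _          = refl
  δ-> (suc m) (suc n) (ℕ.s≤s lt) = δ-> m n lt

  -- A factor of the n-th coefficient of qᵐ matters only for m = n, so that equation may be used to
  -- rewrite it.
  δ-*-cong : ∀ m n {a b} → (m ≡ n → a ≡ b) → a ℤ.* δ m n ≡ b ℤ.* δ m n
  δ-*-cong zero    zero    p = cong (ℤ._* + 1) (p refl)
  δ-*-cong zero    (suc n) {a} {b} p = trans (ℤₚ.*-zeroʳ a) (sym (ℤₚ.*-zeroʳ b))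
  δ-*-cong (suc m) zero    {a} {b} p = trans (ℤₚ.*-zeroʳ a) (sym (ℤₚ.*-zeroʳ b))
  δ-*-cong (suc m) (suc n) p = δ-*-cong m n λ m≡n → p (cong suc m≡n)

  δ-⊛ : ∀ m k → δ m ⊛ δ k ≈ δ (m ℕ.+ k)
  δ-⊛ m k = mk (λ n → go m n)
    where
    go : ∀ m n → (δ m ⊛ δ k) n ≡ δ (m ℕ.+ k) n
    go zero    n       = trans (⊛-local n {f′ = 1ₛ} {g = δ k} (λ { zero _ → refl ; (suc i) _ → refl }) (λ _ _ → refl)) (at (⊛-identityˡ (δ k)) n)
    go (suc m) zero    = refl
    go (suc m) (suc n) = trans (ℤₚ.+-identityˡ _) (go m n)

  sumₛ : ℕ → (ℕ → Series) → Series
  sumₛ N F n = sum N (λ i → F i n)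

  sumₛ-⊛ : ∀ N F g → sumₛ N F ⊛ g ≈ sumₛ N (λ i → F i ⊛ g)
  sumₛ-⊛ zero    F g = ≈-trans (⊛-congʳ {g = g} (mk λ n → sym (const-0 n))) (≈-trans (const-⊛ (+ 0) g) (mk λ _ → refl))
  sumₛ-⊛ (suc N) F g = ≈-trans (⊛-distribʳ g (sumₛ N F) (F N)) (⊕-cong (sumₛ-⊛ N F g) ≈-refl)

  ⊛-sumₛ : ∀ N F g → g ⊛ sumₛ N F ≈ sumₛ N (λ i → g ⊛ F i)
  ⊛-sumₛ N F g = ≈-trans (⊛-comm g _) (≈-trans (sumₛ-⊛ N F g) (mk λ n → sum-cong N λ i → at (⊛-comm (F i) g) n))

  ⟪_⟫ : Expr 2 → ℕ → ℕ → ℤ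
  ⟪ h ⟫ a b = Z.⟦ h ⟧ (+ suc a ∷ + suc b ∷ [])

  module _ (N n : ℕ) (n≤N : n ℕ.≤ N) where

    -- The indices are one less than the positive integers that they stand for. As n ≤ N, every
    -- solution of the equations below lies inside the box of side N.
    four : (ℕ → ℕ → ℤ) → (ℕ → ℕ → ℕ → ℕ → ℕ) → ℤ
    four h e = sum N λ a → sum N λ b → sum N λ x → sum N λ y → h a b ℤ.* δ (e a b x y) n

    full skew : (ℕ → ℕ → ℤ) → ℤ
    full h = four h λ a b x y → suc a ℕ.* suc x ℕ.+ suc b ℕ.* suc y
    skew h = four h λ a b x y → (suc a ℕ.+ suc b) ℕ.* suc x ℕ.+ suc b ℕ.* suc y

    equalMultipliers equalDivisors : (ℕ → ℕ → ℤ) → ℤ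
    equalMultipliers h = sum N λ a → sum N λ b → sum N λ x → h a b ℤ.* δ ((suc a ℕ.+ suc b) ℕ.* suc x) n
    equalDivisors h = sum N λ a → sum N λ x → sum N λ y → h a a ℤ.* δ (suc a ℕ.* (suc x ℕ.+ suc y)) n

    vanish : ∀ c k → n ℕ.< k → c ℤ.* δ k n ≡ + 0
    vanish c k n<k = trans (cong (c ℤ.*_) (δ-> k n n<k)) (ℤₚ.*-zeroʳ c)

    n<⋆ˡ : ∀ a x → N ℕ.≤ a → n ℕ.< suc a ℕ.* suc x
    n<⋆ˡ a x N≤a = ℕₚ.≤-<-trans (ℕₚ.≤-trans n≤N N≤a) (ℕₚ.≤-trans (ℕₚ.n<1+n a) (ℕₚ.m≤m*n (suc a) (suc x)))

    n<⋆ʳ : ∀ a x → N ℕ.≤ x → n ℕ.< suc a ℕ.* suc x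
    n<⋆ʳ a x N≤x = subst (n ℕ.<_) (ℕₚ.*-comm (suc x) (suc a)) (n<⋆ˡ x a N≤x)

    +ˡ : ∀ k l → n ℕ.< k → n ℕ.< k ℕ.+ l
    +ˡ k l lt = ℕₚ.<-≤-trans lt (ℕₚ.m≤m+n k l)

    +ʳ : ∀ k l → n ℕ.< l → n ℕ.< k ℕ.+ l
    +ʳ k l lt = ℕₚ.<-≤-trans lt (ℕₚ.m≤n+m l k)

    sum2-cong : ∀ {F G : ℕ → ℕ → ℤ} → (∀ x y → F x y ≡ G x y) → sum N (λ x → sum N (F x)) ≡ sum N (λ x → sum N (G x))
    sum2-cong p = sum-cong N λ x → sum-cong N (p x)

    sum2-+ : ∀ (F G : ℕ → ℕ → ℤ) → sum N (λ x → sum N (λ y → F x y ℤ.+ G x y)) ≡ sum N (λ x → sum N (F x)) ℤ.+ sum N (λ x → sum N (G x))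
    sum2-+ F G = trans (sum-cong N λ x → sum-+ N (F x) (G x)) (sum-+ N _ _)

    -- Trichotomy of x and y in ax + by = n.
    full-by-multipliers : ∀ h → full h ≡ (skew h ℤ.+ skew (λ a b → h b a)) ℤ.+ equalMultipliers h
    full-by-multipliers h = begin
      full h
        ≡⟨ sum2-cong (λ a b → trichotomy N _
             (λ x y N≤y → vanish (h a b) _ (+ʳ (suc a ℕ.* suc x) (suc b ℕ.* suc y) (n<⋆ʳ b y N≤y)))
             (λ x y N≤x → vanish (h a b) _ (+ˡ (suc a ℕ.* suc x) (suc b ℕ.* suc y) (n<⋆ʳ a x N≤x)))) ⟩
      sum N (λ a → sum N λ b → (P₁ a b ℤ.+ P₂ a b) ℤ.+ P₃ a b)
        ≡⟨ trans (sum2-+ (λ a b → P₁ a b ℤ.+ P₂ a b) P₃) (cong (ℤ._+ sum N (λ a → sum N (P₃ a))) (sum2-+ P₁ P₂)) ⟩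
      (sum N (λ a → sum N (P₁ a)) ℤ.+ sum N (λ a → sum N (P₂ a))) ℤ.+ sum N (λ a → sum N (P₃ a))
        ≡⟨ cong₂ ℤ._+_ (cong₂ ℤ._+_
             (sum2-cong λ a b → sum2-cong λ x d → cong (λ t → h a b ℤ.* δ t n) (e₁ (suc a) (suc b) (suc x) (suc d)))
             (trans (sum-swap N N P₂) (sum2-cong λ b a → sum2-cong λ y d → cong (λ t → h a b ℤ.* δ t n) (e₂ (suc a) (suc b) (suc y) (suc d)))))
             (sum2-cong λ a b → sum-cong N λ x → cong (λ t → h a b ℤ.* δ t n) (sym (ℕₚ.*-distribʳ-+ (suc x) (suc a) (suc b)))) ⟩
      (skew h ℤ.+ skew (λ a b → h b a)) ℤ.+ equalMultipliers h ∎
      where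
      open ≡-Reasoning
      P₁ P₂ P₃ : ℕ → ℕ → ℤ
      P₁ a b = sum N λ x → sum N λ d → h a b ℤ.* δ (suc a ℕ.* suc x ℕ.+ suc b ℕ.* suc (x ℕ.+ suc d)) n
      P₂ a b = sum N λ y → sum N λ d → h a b ℤ.* δ (suc a ℕ.* suc (y ℕ.+ suc d) ℕ.+ suc b ℕ.* suc y) n
      P₃ a b = sum N λ x → h a b ℤ.* δ (suc a ℕ.* suc x ℕ.+ suc b ℕ.* suc x) n
      e₁ : ∀ a b x d → a ℕ.* x ℕ.+ b ℕ.* (x ℕ.+ d) ≡ (a ℕ.+ b) ℕ.* x ℕ.+ b ℕ.* d
      e₁ = ℕ-solve
      e₂ : ∀ a b y d → a ℕ.* (y ℕ.+ d) ℕ.+ b ℕ.* y ≡ (b ℕ.+ a) ℕ.* y ℕ.+ a ℕ.* d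
      e₂ = ℕ-solve

    -- Trichotomy of a and b in ax + by = n.
    full-by-divisors : ∀ h → full h ≡ (skew (λ a b → h b (b ℕ.+ suc a)) ℤ.+ skew (λ a b → h (b ℕ.+ suc a) b)) ℤ.+ equalDivisors h
    full-by-divisors h = begin
      full h
        ≡⟨ trans (sum-cong N λ a → trans (sum-swap N N _) (sum-cong N λ x → sum-swap N N _)) (trans (sum-swap N N _) (sum-cong N λ x → trans (sum-cong N λ a → refl) (sum-swap N N _))) ⟩
      sum N (λ x → sum N λ y → sum N λ a → sum N λ b → h a b ℤ.* δ (suc a ℕ.* suc x ℕ.+ suc b ℕ.* suc y) n)
        ≡⟨ sum2-cong (λ x y → trichotomy N _
             (λ a b N≤b → vanish (h a b) _ (+ʳ (suc a ℕ.* suc x) (suc b ℕ.* suc y) (n<⋆ˡ b y N≤b)))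
             (λ a b N≤a → vanish (h a b) _ (+ˡ (suc a ℕ.* suc x) (suc b ℕ.* suc y) (n<⋆ˡ a x N≤a)))) ⟩
      sum N (λ x → sum N λ y → (P₁ x y ℤ.+ P₂ x y) ℤ.+ P₃ x y)
        ≡⟨ trans (sum2-+ (λ a b → P₁ a b ℤ.+ P₂ a b) P₃) (cong (ℤ._+ sum N (λ a → sum N (P₃ a))) (sum2-+ P₁ P₂)) ⟩
      (sum N (λ x → sum N (P₁ x)) ℤ.+ sum N (λ x → sum N (P₂ x))) ℤ.+ sum N (λ x → sum N (P₃ x))
        ≡⟨ cong₂ ℤ._+_ (cong₂ ℤ._+_
             (trans (sum-swap N N P₁) (trans (sum-cong N λ y → sum-cong N λ x → sum-swap N N _) (to-T λ d a → h a (a ℕ.+ suc d))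
               ) )
             (to-T′))
             (trans (sum-cong N λ x → sum-swap N N _) (trans (sum-swap N N _)
                (sum2-cong λ a x → sum-cong N λ y → cong (λ t → h a a ℤ.* δ t n) (sym (ℕₚ.*-distribˡ-+ (suc a) (suc x) (suc y)))))) ⟩
      (skew (λ a b → h b (b ℕ.+ suc a)) ℤ.+ skew (λ a b → h (b ℕ.+ suc a) b)) ℤ.+ equalDivisors h ∎
      where
      open ≡-Reasoning
      P₁ P₂ P₃ : ℕ → ℕ → ℤ
      P₁ x y = sum N λ a → sum N λ d → h a (a ℕ.+ suc d) ℤ.* δ (suc a ℕ.* suc x ℕ.+ suc (a ℕ.+ suc d) ℕ.* suc y) n
      P₂ x y = sum N λ b → sum N λ d → h (b ℕ.+ suc d) b ℤ.* δ (suc (b ℕ.+ suc d) ℕ.* suc x ℕ.+ suc b ℕ.* suc y) n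
      P₃ x y = sum N λ a → h a a ℤ.* δ (suc a ℕ.* suc x ℕ.+ suc a ℕ.* suc y) n
      e₁ : ∀ a d x y → a ℕ.* x ℕ.+ (a ℕ.+ d) ℕ.* y ≡ (d ℕ.+ a) ℕ.* y ℕ.+ a ℕ.* x
      e₁ = ℕ-solve
      e₂ : ∀ b d x y → (b ℕ.+ d) ℕ.* x ℕ.+ b ℕ.* y ≡ (d ℕ.+ b) ℕ.* x ℕ.+ b ℕ.* y
      e₂ = ℕ-solve
      outward : (F : ℕ → ℕ → ℕ → ℕ → ℤ) → sum N (λ x → sum N λ y → sum N λ d → sum N λ a → F x y d a) ≡
                                          sum N (λ d → sum N λ a → sum N λ x → sum N λ y → F x y d a)
      outward F = trans (sum-cong N λ x → trans (sum-swap N N _) (sum-cong N λ d → sum-swap N N _))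
        (trans (sum-swap N N _) (sum-cong N λ d → sum-swap N N _))
      to-T : (k : ℕ → ℕ → ℤ) → sum N (λ y → sum N λ x → sum N λ d → sum N λ a → k d a ℤ.* δ (suc a ℕ.* suc x ℕ.+ suc (a ℕ.+ suc d) ℕ.* suc y) n) ≡ skew k
      to-T k = trans (outward (λ y x d a → k d a ℤ.* δ (suc a ℕ.* suc x ℕ.+ suc (a ℕ.+ suc d) ℕ.* suc y) n))
        (sum2-cong λ d a → sum2-cong λ y x → cong (λ t → k d a ℤ.* δ t n) (e₁ (suc a) (suc d) (suc x) (suc y)))
      to-T′ : sum N (λ x → sum N (P₂ x)) ≡ skew (λ a b → h (b ℕ.+ suc a) b)
      to-T′ = trans (sum2-cong λ x y → sum-swap N N _) (trans
        (outward (λ x y d b → h (b ℕ.+ suc d) b ℤ.* δ (suc (b ℕ.+ suc d) ℕ.* suc x ℕ.+ suc b ℕ.* suc y) n))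
        (sum2-cong λ d b → sum2-cong λ x y → cong (λ t → h (b ℕ.+ suc d) b ℤ.* δ t n) (e₂ (suc b) (suc d) (suc x) (suc y))))

open ConvolutionSums

-- Liouville's method for convolutions of divisor sums.

module LiouvilleIdentities where

  -- The Lambert series Σ g(a) q^(ax), cut off at a, x ≤ N. If g is the k-th power, its coefficient
  -- at 1 ≤ n ≤ N is σₖ(n); `L k` takes N = n.
  Λ : ℕ → (ℤ → ℤ) → Series
  Λ N g = sumₛ N λ a → sumₛ N λ x → g (+ suc a) · δ (suc a ℕ.* suc x)

  L : ℕ → Series
  L k n = Λ n (Z._↑ k) n

  Λ-stable : ∀ N n g → n ℕ.≤ N → Λ N g n ≡ Λ n g n
  Λ-stable N n g n≤N = trans
    (sum-extend n N _ (λ a n≤a → sum-0 N λ x _ → vanish n n ℕₚ.≤-refl (g (+ suc a)) _ (n<⋆ˡ n n ℕₚ.≤-refl a x n≤a)) n≤N)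
    (sum-cong n λ a → sum-extend n N _ (λ x n≤x → vanish n n ℕₚ.≤-refl (g (+ suc a)) _ (n<⋆ʳ n n ℕₚ.≤-refl a x n≤x)) n≤N)

  Λ-stable-L : ∀ N n k → n ℕ.≤ N → Λ N (Z._↑ k) n ≡ L k n
  Λ-stable-L N n k = Λ-stable N n (Z._↑ k)

  Λ-cong : ∀ N n {g g′} → (∀ c → g c ≡ g′ c) → Λ N g n ≡ Λ N g′ n
  Λ-cong N n p = sum-cong N λ a → sum-cong N λ x → cong (ℤ._* δ (suc a ℕ.* suc x) n) (p (+ suc a))

  Λ-+ : ∀ N n g g′ → Λ N (λ c → g c ℤ.+ g′ c) n ≡ Λ N g n ℤ.+ Λ N g′ n
  Λ-+ N n g g′ = trans (sum-cong N λ a → trans (sum-cong N λ x → ℤₚ.*-distribʳ-+ (δ (suc a ℕ.* suc x) n) (g (+ suc a)) (g′ (+ suc a))) (sum-+ N _ _)) (sum-+ N _ _)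

  Λ-* : ∀ N n k g → Λ N (λ c → k ℤ.* g c) n ≡ k ℤ.* Λ N g n
  Λ-* N n k g = trans (sum-cong N λ a → trans (sum-cong N λ x → ℤₚ.*-assoc k (g (+ suc a)) (δ (suc a ℕ.* suc x) n)) (sum-* N k _)) (sum-* N k _)

  linearCombination : List ℤ → (ℕ → ℤ) → ℕ → ℤ
  linearCombination []      F k = + 0
  linearCombination (c ∷ p) F k = c ℤ.* F k ℤ.+ linearCombination p F (suc k)

  Λ-ev : ∀ N n p k → Λ N (λ c → c Z.↑ k ℤ.* Z.ev p c) n ≡ linearCombination p (λ j → Λ N (Z._↑ j) n) k
  Λ-ev N n []      k = sum-0 N λ a _ → sum-0 N λ x _ → trans (cong (ℤ._* δ (suc a ℕ.* suc x) n) (ℤₚ.*-zeroʳ ((+ suc a) Z.↑ k))) (ℤₚ.*-zeroˡ (δ (suc a ℕ.* suc x) n))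
  Λ-ev N n (c ∷ p) k = trans (Λ-cong N n λ m → rearrange (m Z.↑ k) c m (Z.ev p m))
    (trans (Λ-+ N n (λ m → c ℤ.* m Z.↑ k) (λ m → m Z.↑ suc k ℤ.* Z.ev p m)) (cong₂ ℤ._+_ (Λ-* N n c (Z._↑ k)) (Λ-ev N n p (suc k))))
    where
    rearrange : ∀ t c m e → t ℤ.* (c ℤ.+ m ℤ.* e) ≡ c ℤ.* t ℤ.+ m ℤ.* t ℤ.* e
    rearrange = solve-∀

  rowsE : ∀ {n} → List (List ℤ) → Expr n → Expr n → Expr n
  rowsE []       x y = con (+ 0)
  rowsE (r ∷ rs) x y = poly r y :+ x :* rowsE rs x y

  monomialsE : List (ℤ × ℕ × ℕ) → Expr 2
  monomialsE []                 = con (+ 0)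
  monomialsE ((c , i , j) ∷ ms) = con c :* (v0 :^ i :* v1 :^ j) :+ monomialsE ms

  products : List (ℤ × ℕ × ℕ) → Series
  products []                 n = + 0
  products ((c , i , j) ∷ ms) n = c ℤ.* (L i ⊛ L j) n ℤ.+ products ms n

  ·-⊛-· : ∀ c d f g → (c · f) ⊛ (d · g) ≈ (c ℤ.* d) · (f ⊛ g)
  ·-⊛-· c d f g = ≈-trans (·-⊛ c f (d · g)) (mk λ n → trans (cong (c ℤ.*_) (trans (at (⊛-comm f (d · g)) n) (trans (at (·-⊛ d g f) n) (cong (d ℤ.*_) (at (⊛-comm g f) n)))))
    (sym (ℤₚ.*-assoc c d _)))

  module _ (n : ℕ) where

    fullₙ : (ℕ → ℕ → ℤ) → ℤ
    fullₙ = full n n ℕₚ.≤-refl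

    full-+ : ∀ h h′ → fullₙ (λ a b → h a b ℤ.+ h′ a b) ≡ fullₙ h ℤ.+ fullₙ h′
    full-+ h h′ = trans (sum2-cong n n ℕₚ.≤-refl λ a b → trans (sum2-cong n n ℕₚ.≤-refl λ x y → ℤₚ.*-distribʳ-+ (δ (suc a ℕ.* suc x ℕ.+ suc b ℕ.* suc y) n) (h a b) (h′ a b))
      (sum2-+ n n ℕₚ.≤-refl _ _)) (sum2-+ n n ℕₚ.≤-refl _ _)

    full-* : ∀ k h → fullₙ (λ a b → k ℤ.* h a b) ≡ k ℤ.* fullₙ h
    full-* k h = trans (sum-cong n λ a → trans (sum-cong n λ b → trans (sum-cong n λ x → trans (sum-cong n λ y → ℤₚ.*-assoc k (h a b) _) (sum-* n k _)) (sum-* n k _)) (sum-* n k _)) (sum-* n k _)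

    full-cong : ∀ {h h′} → (∀ a b → h a b ≡ h′ a b) → fullₙ h ≡ fullₙ h′
    full-cong p = sum2-cong n n ℕₚ.≤-refl λ a b → sum2-cong n n ℕₚ.≤-refl λ x y → cong (ℤ._* δ (suc a ℕ.* suc x ℕ.+ suc b ℕ.* suc y) n) (p a b)

    full-monomial : ∀ i j → fullₙ (λ a b → (+ suc a) Z.↑ i ℤ.* (+ suc b) Z.↑ j) ≡ (L i ⊛ L j) n
    full-monomial i j = sym (trans
      (⊛-local n {f′ = Λ n (Z._↑ i)} {g′ = Λ n (Z._↑ j)} (λ m m≤n → sym (Λ-stable-L n m i m≤n)) (λ m m≤n → sym (Λ-stable-L n m j m≤n)))
      (trans (at (sumₛ-⊛ n _ _) n) (sum-cong n λ a →
        trans (at (sumₛ-⊛ n _ _) n) (trans (sum-cong n λ x →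
          trans (at (⊛-sumₛ n _ _) n) (sum-cong n λ b →
            trans (at (⊛-sumₛ n _ _) n) (sum-cong n λ y →
              trans (at (·-⊛-· ((+ suc a) Z.↑ i) ((+ suc b) Z.↑ j) (δ (suc a ℕ.* suc x)) (δ (suc b ℕ.* suc y))) n)
                (cong ((+ suc a) Z.↑ i ℤ.* (+ suc b) Z.↑ j ℤ.*_) (at (δ-⊛ (suc a ℕ.* suc x) (suc b ℕ.* suc y)) n)))))
          (sum-swap n n _)))))

    full-monomials : ∀ ms → fullₙ ⟪ monomialsE ms ⟫ ≡ products ms n
    full-monomials []                 = sum-0 n λ a _ → sum-0 n λ b _ → sum-0 n λ x _ → sum-0 n λ y _ → ℤₚ.*-zeroˡ (δ (suc a ℕ.* suc x ℕ.+ suc b ℕ.* suc y) n)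
    full-monomials ((c , i , j) ∷ ms) = trans (full-+ (λ a b → c ℤ.* ((+ suc a) Z.↑ i ℤ.* (+ suc b) Z.↑ j)) ⟪ monomialsE ms ⟫)
      (cong₂ ℤ._+_ (trans (full-* c _) (cong (c ℤ.*_) (full-monomial i j))) (full-monomials ms))

  sum-const : ∀ N c → sum N (λ _ → c) ≡ + N ℤ.* c
  sum-const zero    c = sym (ℤₚ.*-zeroˡ c)
  sum-const (suc N) c = trans (cong (ℤ._+ c) (sum-const N c)) (trans (ℤₚ.+-comm _ c) (sym (suc-*-ℤ N c)))

  -- Put h₁(a, b) = h₂(a + b, b). Comparing x with y for h₁, and a with b for h₂, produces the same
  -- skew sums. They cancel in the difference h₁ - h₂, whose monomials sum to products of the `L`;
  -- what remains are the two diagonal contributions, both of which are divisor sums.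
  shear : Expr 2 → Expr 2
  shear h = sub h (v0 :+ v1 ∷ v1 ∷ [])

  -- rows is den times the sum of h₂(y, y − a) over 1 ≤ a ≤ x, as a polynomial in x and y.
  module Identity (h₂ : Expr 2) (den : ℤ) (rows : List (List ℤ)) (pol : List ℤ)
    (ms : List (ℤ × ℕ × ℕ)) (κ : ℤ) (e : ℕ)
    (symmetric₁ : null (norm (shear h₂ :- sub (shear h₂) (v1 ∷ v0 ∷ []))) ≡ true)
    (symmetric₂ : null (norm (shear h₂ :- sub h₂ (v1 ∷ v0 :+ v1 ∷ []))) ≡ true)
    (diagonal   : null (norm {1} (sub h₂ (v0 ∷ v0 ∷ []) :- con κ :* v0 :^ suc e)) ≡ true)
    (difference : null (norm (shear h₂ :- (h₂ :+ monomialsE ms))) ≡ true)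
    (sum-base   : null (norm {1} (rowsE rows (con (+ 0)) v0 :- con (+ 0))) ≡ true)
    (sum-step   : null (norm {2} (rowsE rows (con (+ 1) :+ v0) v1 :-
                    (rowsE rows v0 v1 :+ con den :* sub (shear h₂) (con (+ 1) :+ v0 ∷ v1 :- (con (+ 1) :+ v0) ∷ [])))) ≡ true)
    (sum-closed : null (norm {1} (rowsE rows v0 (con (+ 1) :+ v0) :- poly pol (con (+ 1) :+ v0))) ≡ true)
    where

    private
      h₁ : Expr 2
      h₁ = shear h₂

      H₁ : ℤ → ℤ → ℤ
      H₁ a b = Z.⟦ h₁ ⟧ (a ∷ b ∷ [])

      closed : ∀ m c → den ℤ.* sum m (λ a → H₁ (+ suc a) (c ℤ.- + suc a)) ≡ Z.⟦ rowsE rows v0 v1 ⟧ (+ m ∷ c ∷ [])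
      closed zero    c = trans (ℤₚ.*-zeroʳ den) (trans (sym (Z.solve (rowsE rows (con (+ 0)) v0) (con (+ 0)) sum-base (c ∷ []))) (rows-sub rows))
        where
        rows-sub : ∀ rs → Z.⟦ rowsE rs (con (+ 0)) v0 ⟧ (c ∷ []) ≡ Z.⟦ rowsE rs v0 v1 ⟧ (+ 0 ∷ c ∷ [])
        rows-sub []       = refl
        rows-sub (r ∷ rs) = cong (λ t → Z.ev r c ℤ.+ + 0 ℤ.* t) (rows-sub rs)
      closed (suc m) c = trans (ℤₚ.*-distribˡ-+ den _ _) (trans
        (cong₂ ℤ._+_ (closed m c) (cong (den ℤ.*_) (sym (Z.sub-sound h₁ (con (+ 1) :+ v0 ∷ v1 :- (con (+ 1) :+ v0) ∷ []) (+ m ∷ c ∷ [])))))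
        (trans (sym (Z.solve (rowsE rows (con (+ 1) :+ v0) v1) (rowsE rows v0 v1 :+ con den :* sub h₁ (con (+ 1) :+ v0 ∷ v1 :- (con (+ 1) :+ v0) ∷ [])) sum-step (+ m ∷ c ∷ []))) (rows-sub rows)))
        where
        rows-sub : ∀ rs → Z.⟦ rowsE rs (con (+ 1) :+ v0) v1 ⟧ (+ m ∷ c ∷ []) ≡ Z.⟦ rowsE rs v0 v1 ⟧ (+ suc m ∷ c ∷ [])
        rows-sub []       = refl
        rows-sub (r ∷ rs) = cong (λ t → Z.ev r c ℤ.+ + suc m ℤ.* t) (rows-sub rs)

      closed-diagonal : ∀ m → den ℤ.* sum m (λ a → H₁ (+ suc a) (+ suc m ℤ.- + suc a)) ≡ Z.ev pol (+ suc m)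
      closed-diagonal m = trans (closed m (+ suc m)) (trans (sym (rows-sub rows)) (Z.solve (rowsE rows v0 (con (+ 1) :+ v0)) (poly pol (con (+ 1) :+ v0)) sum-closed (+ m ∷ [])))
        where
        rows-sub : ∀ rs → Z.⟦ rowsE rs v0 (con (+ 1) :+ v0) ⟧ (+ m ∷ []) ≡ Z.⟦ rowsE rs v0 v1 ⟧ (+ m ∷ + suc m ∷ [])
        rows-sub []       = refl
        rows-sub (r ∷ rs) = cong (λ t → Z.ev r (+ suc m) ℤ.+ + m ℤ.* t) (rows-sub rs)

    module _ (n : ℕ) where
      private
        n≤n = ℕₚ.≤-refl {n}

        -- The diagonal x = y leaves (a + b)x = n. For fixed c = a + b the sum of h₁(a, c - a) over
        -- 0 < a < c is a polynomial in c, namely `pol` over `den`.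
        equalMultipliers-closed : den ℤ.* equalMultipliers n n n≤n ⟪ h₁ ⟫ ≡ linearCombination pol (λ j → L j n) 0
        equalMultipliers-closed = begin
          den ℤ.* equalMultipliers n n n≤n ⟪ h₁ ⟫
            ≡⟨ cong (den ℤ.*_) (trans (sum-cong n λ a → sum-swap n n _) (sum-swap n n _)) ⟩
          den ℤ.* sum n (λ x → sum n λ a → sum n λ b → ⟪ h₁ ⟫ a b ℤ.* δ ((suc a ℕ.+ suc b) ℕ.* suc x) n)
            ≡⟨ cong (den ℤ.*_) (sum-cong n λ x → sum-cong n λ a → sum-cong n λ b →
                 cong (λ t → H₁ (+ suc a) t ℤ.* δ ((suc a ℕ.+ suc b) ℕ.* suc x) n) (sym (cancel (+ suc a) (+ suc b)))) ⟩
          den ℤ.* sum n (λ x → sum n λ a → sum n λ b → G x a (a ℕ.+ suc b))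
            ≡⟨ cong (den ℤ.*_) (sum-cong n λ x → sym (upper-triangle n (G x) λ a m n≤m → vanish n n n≤n (H₁ (+ suc a) (+ suc m ℤ.- + suc a)) _ (n<⋆ˡ n n n≤n m x n≤m))) ⟩
          den ℤ.* sum n (λ x → sum n λ m → sum m λ a → G x a m)
            ≡⟨ cong (den ℤ.*_) (sum-cong n λ x → sum-cong n λ m → sum-*ʳ m (δ (suc m ℕ.* suc x) n) _) ⟩
          den ℤ.* sum n (λ x → sum n λ m → sum m (λ a → H₁ (+ suc a) (+ suc m ℤ.- + suc a)) ℤ.* δ (suc m ℕ.* suc x) n)
            ≡⟨ trans (sym (sum-* n den _)) (sum-cong n λ x → trans (sym (sum-* n den _)) (sum-cong n λ m →
                 trans (sym (ℤₚ.*-assoc den _ _)) (cong (ℤ._* δ (suc m ℕ.* suc x) n) (closed-diagonal m)))) ⟩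
          sum n (λ x → sum n λ m → Z.ev pol (+ suc m) ℤ.* δ (suc m ℕ.* suc x) n)
            ≡⟨ sum-swap n n _ ⟩
          Λ n (Z.ev pol) n
            ≡⟨ Λ-cong n n {Z.ev pol} {λ c → c Z.↑ 0 ℤ.* Z.ev pol c} (λ c → sym (ℤₚ.*-identityˡ (Z.ev pol c))) ⟩
          Λ n (λ c → c Z.↑ 0 ℤ.* Z.ev pol c) n
            ≡⟨ Λ-ev n n pol 0 ⟩
          linearCombination pol (λ j → L j n) 0 ∎
          where
          open ≡-Reasoning
          cancel : ∀ a b → a ℤ.+ b ℤ.- a ≡ b
          cancel = solve-∀
          G : ℕ → ℕ → ℕ → ℤ
          G x a m = H₁ (+ suc a) (+ suc m ℤ.- + suc a) ℤ.* δ (suc m ℕ.* suc x) n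

        -- The diagonal a = b leaves a(x + y) = n, which has n/a - 1 solutions (x, y) for each
        -- divisor a. Each contributes κ a^(e+1), and κ a^(e+1) (n/a - 1) = κ (n a^e - a^(e+1)).
        equalDivisors-closed : equalDivisors n n n≤n ⟪ h₂ ⟫ ≡ κ ℤ.* (+ n ℤ.* L e n ℤ.- L (suc e) n)
        equalDivisors-closed = begin
          equalDivisors n n n≤n ⟪ h₂ ⟫
            ≡⟨ (sum-cong n λ a → sum-cong n λ x → sum-cong n λ y → cong (ℤ._* δ (suc a ℕ.* (suc x ℕ.+ suc y)) n)
                 (trans (sym (Z.sub-sound h₂ (v0 ∷ v0 ∷ []) (+ suc a ∷ []))) (Z.solve (sub h₂ (v0 ∷ v0 ∷ [])) (con κ :* v0 :^ suc e) diagonal (+ suc a ∷ [])))) ⟩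
          sum n (λ a → sum n λ x → sum n λ d → F a x (x ℕ.+ suc d))
            ≡⟨ (sum-cong n λ a → sym (upper-triangle n (F a) λ x y n≤y → vanish n n n≤n (κ ℤ.* (+ suc a) Z.↑ suc e) _ (n<⋆ʳ n n n≤n a y n≤y))) ⟩
          sum n (λ a → sum n λ y → sum y λ x → F a x y)
            ≡⟨ (sum-cong n λ a → sum-cong n λ y → trans (sum-const y _) (term a y)) ⟩
          sum n (λ a → sum n λ y → κ ℤ.* ((+ n ℤ.* (+ suc a) Z.↑ e ℤ.+ -[1+ 0 ] ℤ.* (+ suc a) Z.↑ suc e) ℤ.* δ (suc a ℕ.* suc y) n))
            ≡⟨ trans (sum-cong n λ a → sum-* n κ _) (sum-* n κ _) ⟩
          κ ℤ.* Λ n (λ c → + n ℤ.* c Z.↑ e ℤ.+ -[1+ 0 ] ℤ.* c Z.↑ suc e) n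
            ≡⟨ cong (κ ℤ.*_) (trans (Λ-+ n n (λ c → + n ℤ.* c Z.↑ e) (λ c → -[1+ 0 ] ℤ.* c Z.↑ suc e)) (cong₂ ℤ._+_ (Λ-* n n (+ n) (Z._↑ e)) (trans (Λ-* n n -[1+ 0 ] (Z._↑ suc e)) (ℤₚ.-1*i≡-i (L (suc e) n))))) ⟩
          κ ℤ.* (+ n ℤ.* L e n ℤ.- L (suc e) n) ∎
          where
          open ≡-Reasoning
          F : ℕ → ℕ → ℕ → ℤ
          F a x y = κ ℤ.* (+ suc a) Z.↑ suc e ℤ.* δ (suc a ℕ.* suc y) n
          rearrange : ∀ y k a t d → y ℤ.* (k ℤ.* (a ℤ.* t) ℤ.* d) ≡ k ℤ.* ((a ℤ.* (+ 1 ℤ.+ y) ℤ.* t ℤ.+ -[1+ 0 ] ℤ.* (a ℤ.* t)) ℤ.* d)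
          rearrange = solve-∀
          term : ∀ a y → + y ℤ.* F a 0 y ≡ κ ℤ.* ((+ n ℤ.* (+ suc a) Z.↑ e ℤ.+ -[1+ 0 ] ℤ.* (+ suc a) Z.↑ suc e) ℤ.* δ (suc a ℕ.* suc y) n)
          term a y = trans (rearrange (+ y) κ (+ suc a) ((+ suc a) Z.↑ e) (δ (suc a ℕ.* suc y) n))
            (cong (κ ℤ.*_) (δ-*-cong (suc a ℕ.* suc y) n λ ay≡n → cong (λ t → t ℤ.* (+ suc a) Z.↑ e ℤ.+ -[1+ 0 ] ℤ.* (+ suc a) Z.↑ suc e)
              (trans (sym (ℤₚ.pos-* (suc a) (suc y))) (cong +_ ay≡n))))

        skew₁ : ℤ
        skew₁ = skew n n n≤n ⟪ h₁ ⟫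

        skew-cong : ∀ {h h′} → (∀ a b → h a b ≡ h′ a b) → skew n n n≤n h ≡ skew n n n≤n h′
        skew-cong p = sum2-cong n n n≤n λ a b → sum2-cong n n n≤n λ x y → cong (ℤ._* δ ((suc a ℕ.+ suc b) ℕ.* suc x ℕ.+ suc b ℕ.* suc y) n) (p a b)

        full₁ : fullₙ n ⟪ h₁ ⟫ ≡ (skew₁ ℤ.+ skew₁) ℤ.+ equalMultipliers n n n≤n ⟪ h₁ ⟫
        full₁ = trans (full-by-multipliers n n n≤n ⟪ h₁ ⟫) (cong (λ t → (skew₁ ℤ.+ t) ℤ.+ equalMultipliers n n n≤n ⟪ h₁ ⟫)
          (skew-cong λ a b → sym (trans (Z.solve h₁ (sub h₁ (v1 ∷ v0 ∷ [])) symmetric₁ (+ suc a ∷ + suc b ∷ [])) (Z.sub-sound h₁ (v1 ∷ v0 ∷ []) (+ suc a ∷ + suc b ∷ [])))))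

        full₂ : fullₙ n ⟪ h₂ ⟫ ≡ (skew₁ ℤ.+ skew₁) ℤ.+ equalDivisors n n n≤n ⟪ h₂ ⟫
        full₂ = trans (full-by-divisors n n n≤n ⟪ h₂ ⟫) (cong (ℤ._+ equalDivisors n n n≤n ⟪ h₂ ⟫) (cong₂ ℤ._+_
          (skew-cong λ a b → trans (cong (λ t → Z.⟦ h₂ ⟧ (+ suc b ∷ + t ∷ [])) (ℕₚ.+-comm (suc b) (suc a)))
            (sym (trans (Z.solve h₁ (sub h₂ (v1 ∷ v0 :+ v1 ∷ [])) symmetric₂ (+ suc a ∷ + suc b ∷ [])) (Z.sub-sound h₂ (v1 ∷ v0 :+ v1 ∷ []) (+ suc a ∷ + suc b ∷ [])))))
          (skew-cong λ a b → trans (cong (λ t → Z.⟦ h₂ ⟧ (+ t ∷ + suc b ∷ [])) (ℕₚ.+-comm (suc b) (suc a)))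
            (sym (Z.sub-sound h₂ (v0 :+ v1 ∷ v1 ∷ []) (+ suc a ∷ + suc b ∷ []))))))

      identity : den ℤ.* products ms n ≡ linearCombination pol (λ j → L j n) 0 ℤ.- den ℤ.* (κ ℤ.* (+ n ℤ.* L e n ℤ.- L (suc e) n))
      identity = trans (rearrange den (products ms n) (skew₁ ℤ.+ skew₁) _ _ total) (cong₂ (λ s t → s ℤ.- den ℤ.* t) equalMultipliers-closed equalDivisors-closed)
        where
        total : (skew₁ ℤ.+ skew₁) ℤ.+ equalMultipliers n n n≤n ⟪ h₁ ⟫ ≡ ((skew₁ ℤ.+ skew₁) ℤ.+ equalDivisors n n n≤n ⟪ h₂ ⟫) ℤ.+ products ms n
        total = trans (sym full₁) (trans (full-cong n λ a b → Z.solve h₁ (h₂ :+ monomialsE ms) difference (+ suc a ∷ + suc b ∷ []))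
          (trans (full-+ n ⟪ h₂ ⟫ ⟪ monomialsE ms ⟫) (cong₂ ℤ._+_ full₂ (full-monomials n ms))))
        expand : ∀ d p t y → d ℤ.* p ≡ d ℤ.* ((t ℤ.+ y) ℤ.+ p ℤ.- t ℤ.- y)
        expand = solve-∀
        collect : ∀ d t x y → d ℤ.* ((t ℤ.+ x) ℤ.- t ℤ.- y) ≡ d ℤ.* x ℤ.- d ℤ.* y
        collect = solve-∀
        rearrange : ∀ d p t x y → t ℤ.+ x ≡ (t ℤ.+ y) ℤ.+ p → d ℤ.* p ≡ d ℤ.* x ℤ.- d ℤ.* y
        rearrange d p t x y eq = trans (expand d p t y) (trans (cong (λ s → d ℤ.* (s ℤ.- t ℤ.- y)) (sym eq)) (collect d t x y))

  -- a² - ab + b² is invariant under exchanging a and b and under replacing b by a - b, which yields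
  -- both symmetry conditions. Its powers and (ab(a - b))² inherit them. The integers 6, 30, 420 and
  -- 30 clear the denominators of the power sums.
  module Degree2 = Identity ((v0 :* v0 :- v0 :* v1 :+ v1 :* v1)) (+ 6) (([]) ∷ (+ 1 ∷ -[1+ 2 ] ∷ + 6 ∷ []) ∷ (+ 3 ∷ -[1+ 2 ] ∷ []) ∷ (+ 2 ∷ []) ∷ [])
    (+ 0 ∷ + 1 ∷ -[1+ 5 ] ∷ + 5 ∷ []) ((+ 2 , 1 , 1) ∷ []) (+ 1) 1
    refl refl refl refl refl refl refl

  module Degree4 = Identity ((v0 :* v0 :- v0 :* v1 :+ v1 :* v1) :^ 2) (+ 30) (([]) ∷ (-[1+ 0 ] ∷ + 0 ∷ + 15 ∷ -[1+ 29 ] ∷ + 30 ∷ []) ∷ (+ 0 ∷ -[1+ 14 ] ∷ + 45 ∷ -[1+ 29 ] ∷ []) ∷ (+ 10 ∷ -[1+ 29 ] ∷ + 30 ∷ []) ∷ (+ 15 ∷ -[1+ 14 ] ∷ []) ∷ (+ 6 ∷ []) ∷ [])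
    (+ 0 ∷ -[1+ 0 ] ∷ + 0 ∷ + 10 ∷ -[1+ 29 ] ∷ + 21 ∷ []) ((+ 4 , 3 , 1) ∷ (+ 4 , 1 , 3) ∷ []) (+ 1) 3
    refl refl refl refl refl refl refl

  module Degree6 = Identity ((v0 :* v0 :- v0 :* v1 :+ v1 :* v1) :^ 3) (+ 420) (([]) ∷ (+ 10 ∷ + 0 ∷ -[1+ 83 ] ∷ + 0 ∷ + 420 ∷ -[1+ 629 ] ∷ + 420 ∷ []) ∷ (+ 0 ∷ + 105 ∷ + 0 ∷ -[1+ 734 ] ∷ + 1260 ∷ -[1+ 629 ] ∷ []) ∷ (-[1+ 69 ] ∷ + 0 ∷ + 840 ∷ -[1+ 1469 ] ∷ + 840 ∷ []) ∷ (+ 0 ∷ -[1+ 524 ] ∷ + 1260 ∷ -[1+ 734 ] ∷ []) ∷ (+ 210 ∷ -[1+ 629 ] ∷ + 504 ∷ []) ∷ (+ 210 ∷ -[1+ 209 ] ∷ []) ∷ (+ 60 ∷ []) ∷ [])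
    (+ 0 ∷ + 10 ∷ + 0 ∷ -[1+ 48 ] ∷ + 0 ∷ + 210 ∷ -[1+ 419 ] ∷ + 249 ∷ []) ((+ 6 , 5 , 1) ∷ (+ 14 , 3 , 3) ∷ (+ 6 , 1 , 5) ∷ []) (+ 1) 5
    refl refl refl refl refl refl refl

  -- This invariant vanishes for a = b, and its shear exceeds it by 4a³b³ alone. It thus isolates
  -- the product `L 3 ⊛ L 3`, which the degree six identity mixes with `L 1 ⊛ L 5`.
  module Discriminant = Identity ((v0 :* v1 :* (v0 :- v1)) :^ 2) (+ 30) (([]) ∷ (+ 0 ∷ + 0 ∷ -[1+ 0 ] ∷ + 0 ∷ + 5 ∷ []) ∷ (+ 0 ∷ + 0 ∷ + 0 ∷ -[1+ 14 ] ∷ + 15 ∷ []) ∷ (+ 0 ∷ + 0 ∷ + 10 ∷ -[1+ 29 ] ∷ + 10 ∷ []) ∷ (+ 0 ∷ + 0 ∷ + 15 ∷ -[1+ 14 ] ∷ []) ∷ (+ 0 ∷ + 0 ∷ + 6 ∷ []) ∷ [])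
    (+ 0 ∷ + 0 ∷ + 0 ∷ -[1+ 0 ] ∷ + 0 ∷ + 0 ∷ + 0 ∷ + 1 ∷ []) ((+ 4 , 3 , 3) ∷ []) (+ 0) 1
    refl refl refl refl refl refl refl

open LiouvilleIdentities

-- The generating function of partitions and its logarithmic derivative.

module Partitions where

  open SetoidReasoning (CommutativeRing.setoid seriesRing)

  partsAtMost-suc-< : ∀ n k → n ℕ.< suc k → partsAtMost n (suc k) ≡ partsAtMost n k
  partsAtMost-suc-< zero    k lt rewrite m<n⇒m/n≡0 {0} {suc k} lt = ℕₚ.+-identityʳ _
  partsAtMost-suc-< (suc n) k lt rewrite m<n⇒m/n≡0 {suc n} {suc k} lt = ℕₚ.+-identityʳ _

  partsAtMost-unfold : ∀ n k → partsAtMost n (suc k) ≡ sumₗ (map (λ j → partsAtMost (n ∸ j ℕ.* suc k) k) (upTo (suc (n / suc k))))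
  partsAtMost-unfold zero    k = refl
  partsAtMost-unfold (suc n) k = refl

  partsAtMost-suc-≥ : ∀ n k → suc k ℕ.≤ n → partsAtMost n (suc k) ≡ partsAtMost n k ℕ.+ partsAtMost (n ∸ suc k) (suc k)
  partsAtMost-suc-≥ n k le = trans (partsAtMost-unfold n k) (trans
    (cong (λ q → sumₗ (map f (upTo (suc q)))) (m/n≡1+[m∸n]/n le))
    (cong (λ t → partsAtMost n k ℕ.+ t) (trans (cong sumₗ reindex) (sym (partsAtMost-unfold (n ∸ suc k) k)))))
    where
    f = λ j → partsAtMost (n ∸ j ℕ.* suc k) k
    q = (n ∸ suc k) / suc k
    reindex : map f (applyUpTo suc (suc q)) ≡ map (λ j → partsAtMost (n ∸ suc k ∸ j ℕ.* suc k) k) (upTo (suc q))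
    reindex = trans (Listₚ.map-applyUpTo suc f (suc q)) (trans
      (applyUpTo-cong (λ j → cong (λ t → partsAtMost t k) (sym (ℕₚ.∸-+-assoc n (suc k) (j ℕ.* suc k)))) (suc q))
      (sym (Listₚ.map-applyUpTo id _ (suc q))))
      where
      applyUpTo-cong : ∀ {g h : ℕ → ℕ} → (∀ j → g j ≡ h j) → ∀ m → applyUpTo g m ≡ applyUpTo h m
      applyUpTo-cong p zero    = refl
      applyUpTo-cong p (suc m) = cong₂ _∷_ (p 0) (applyUpTo-cong (p ∘ suc) m)

  Gₖ : ℕ → Series
  Gₖ k n = + partsAtMost n k

  G : Series
  G n = + p n

  δ-⊛-< : ∀ m f n → n ℕ.< m → (δ m ⊛ f) n ≡ + 0
  δ-⊛-< (suc m) f zero    _          = refl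
  δ-⊛-< (suc m) f (suc n) (ℕ.s≤s lt) = trans (ℤₚ.+-identityˡ _) (δ-⊛-< m f n lt)

  δ-0 : δ 0 ≈ 1ₛ
  δ-0 = mk λ { zero → refl ; (suc n) → refl }

  δ-⊛-≥ : ∀ m f n → (δ m ⊛ f) (m ℕ.+ n) ≡ f n
  δ-⊛-≥ zero    f n = at (≈-trans (⊛-congʳ δ-0) (⊛-identityˡ f)) n
  δ-⊛-≥ (suc m) f n = trans (ℤₚ.+-identityˡ _) (δ-⊛-≥ m f n)

  -- One factor of Euler's product, (1 - q^(k+1)) Gₖ₊₁ = Gₖ, with the negative term moved across. A
  -- partition either has no part k + 1 or loses one.
  Gₖ-suc : ∀ k → Gₖ (suc k) ≈ Gₖ k ⊕ δ (suc k) ⊛ Gₖ (suc k)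
  Gₖ-suc k = mk go
    where
    go : ∀ n → Gₖ (suc k) n ≡ (Gₖ k ⊕ δ (suc k) ⊛ Gₖ (suc k)) n
    go n with n ℕₚ.<? suc k
    ... | yes lt = trans (cong +_ (partsAtMost-suc-< n k lt)) (sym (trans (cong (λ t → Gₖ k n ℤ.+ t) (δ-⊛-< (suc k) _ n lt)) (ℤₚ.+-identityʳ _)))
    ... | no ≮  = trans (cong +_ (partsAtMost-suc-≥ n k le)) (cong (λ t → Gₖ k n ℤ.+ t)
        (sym (trans (cong (δ (suc k) ⊛ Gₖ (suc k)) (sym (ℕₚ.m+[n∸m]≡n le))) (δ-⊛-≥ (suc k) _ (n ∸ suc k)))))
      where le = ℕₚ.≮⇒≥ ≮

  Gₖ-stable : ∀ n j → partsAtMost n (n ℕ.+ j) ≡ partsAtMost n n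
  Gₖ-stable n zero    = cong (partsAtMost n) (ℕₚ.+-identityʳ n)
  Gₖ-stable n (suc j) = trans (cong (partsAtMost n) (ℕₚ.+-suc n j)) (trans (partsAtMost-suc-< n (n ℕ.+ j) (ℕ.s≤s (ℕₚ.m≤m+n n j))) (Gₖ-stable n j))

  -- i qⁱ/(1 - qⁱ), the logarithmic derivative of 1/(1 - qⁱ).
  lambert : ℕ → Series
  lambert i = const (+ i) ⊛ (δ i ⊛ inv (1ₛ ⊕ ⊖ δ i))

  1-δ-inv : ∀ i → (1ₛ ⊕ ⊖ δ (suc i)) ⊛ inv (1ₛ ⊕ ⊖ δ (suc i)) ≈ 1ₛ
  1-δ-inv i = ⊛-inv _ refl

  D-δ : ∀ i → D (δ i) ≈ const (+ i) ⊛ δ i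
  D-δ i = mk λ n → trans (δ-*-cong i n {+ n} {+ i} (λ i≡n → cong +_ (sym i≡n))) (sym (at (const-⊛ (+ i) (δ i)) n))

  lamberts : ℕ → Series
  lamberts zero    = 0ₛ
  lamberts (suc k) = lamberts k ⊕ lambert (suc k)

  D-Gₖ : ∀ k → D (Gₖ k) ≈ Gₖ k ⊛ lamberts k
  D-Gₖ zero    = ≈-trans (mk λ { zero → refl ; (suc n) → ℤₚ.*-zeroʳ (+ suc n) }) (solveₛ (con (+ 0)) (v0 :* con (+ 0)) refl (Gₖ 0 ∷ []))
  D-Gₖ (suc k) = cancelˡ c (λ ()) (begin
    c ⊛ D G₁
      ≈⟨ solveₛ ((con (+ 1) :- v0) :* v1) (v1 :- v0 :* v1) refl (q ∷ D G₁ ∷ []) ⟩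
    D G₁ ⊕ ⊖ (q ⊛ D G₁)
      ≈⟨ ⊕-cong (≈-trans (D-cong (Gₖ-suc k)) (≈-trans (D-⊕ G₀ (q ⊛ G₁)) (⊕-cong (D-Gₖ k) (≈-trans (D-⊛ q G₁) (⊕-cong (⊛-congʳ (D-δ (suc k))) ≈-refl))))) ≈-refl ⟩
    (G₀ ⊛ l ⊕ (const (+ suc k) ⊛ q ⊛ G₁ ⊕ q ⊛ D G₁)) ⊕ ⊖ (q ⊛ D G₁)
      ≈⟨ solveₛ ((v0 :* v1 :+ (v2 :* v3 :+ v4)) :- v4) (v0 :* v1 :+ v2 :* v3 :* con (+ 1)) refl (G₀ ∷ l ∷ const (+ suc k) ⊛ q ∷ G₁ ∷ q ⊛ D G₁ ∷ []) ⟩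
    G₀ ⊛ l ⊕ const (+ suc k) ⊛ q ⊛ G₁ ⊛ 1ₛ
      ≈⟨ ⊕-cong (⊛-congʳ G₀≈) (⊛-congˡ (≈-sym (1-δ-inv k))) ⟩
    (G₁ ⊕ ⊖ (q ⊛ G₁)) ⊛ l ⊕ const (+ suc k) ⊛ q ⊛ G₁ ⊛ (c ⊛ i)
      ≈⟨ solveₛ ((v0 :- v1 :* v0) :* v2 :+ v3 :* v1 :* v0 :* ((con (+ 1) :- v1) :* v4)) ((con (+ 1) :- v1) :* (v0 :* (v2 :+ v3 :* (v1 :* v4)))) refl
           (G₁ ∷ q ∷ l ∷ const (+ suc k) ∷ i ∷ []) ⟩
    c ⊛ (G₁ ⊛ lamberts (suc k)) ∎)
    where
    q = δ (suc k)
    c = 1ₛ ⊕ ⊖ q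
    i = inv c
    l = lamberts k
    G₀ = Gₖ k
    G₁ = Gₖ (suc k)
    G₀≈ : G₀ ≈ G₁ ⊕ ⊖ (q ⊛ G₁)
    G₀≈ = ≈-trans (solveₛ v0 ((v0 :+ v1) :- v1) refl (G₀ ∷ q ⊛ G₁ ∷ [])) (⊕-cong (≈-sym (Gₖ-suc k)) ≈-refl)

  -- The finite geometric sum telescopes, and its error term q^((i+1)(N+1)) lies beyond the exponent
  -- n.
  lambert-truncated : ∀ i N n → n ℕ.≤ N → lambert (suc i) n ≡ sum N (λ x → + suc i ℤ.* δ (suc i ℕ.* suc x) n)
  lambert-truncated i N n n≤N = sym (trans (sum-* N (+ suc i) _) (trans (cong (+ suc i ℤ.*_) (trans (at eq n)
    (⊛-local n {g = inv c} (λ m m≤n → trans (cong (λ t → q m ℤ.- t) (δ-> (suc i ℕ.* suc N) m (ℕₚ.≤-<-trans m≤n (n<⋆ʳ N n n≤N i N ℕₚ.≤-refl)))) (ℤₚ.+-identityʳ _)) (λ _ _ → refl))))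
    (sym (at (const-⊛ (+ suc i) _) n))))
    where
    q = δ (suc i)
    c = 1ₛ ⊕ ⊖ q
    t : ℕ → Series
    t N = sumₛ N (λ x → δ (suc i ℕ.* suc x))
    telescope : ∀ N → c ⊛ t N ≈ q ⊕ ⊖ δ (suc i ℕ.* suc N)
    telescope zero = ≈-trans (⊛-congˡ (mk λ n → sym (const-0 n))) (≈-trans (solveₛ (v0 :* con (+ 0)) (v1 :- v1) refl (c ∷ q ∷ []))
      (⊕-congˡ q (⊖-cong {δ (suc i)} (mk λ n → cong (λ m → δ m n) (sym (ℕₚ.*-identityʳ (suc i)))))))
    telescope (suc N) = begin
      c ⊛ (t N ⊕ q′)                    ≈⟨ solveₛ ((con (+ 1) :- v0) :* (v1 :+ v2)) ((con (+ 1) :- v0) :* v1 :+ (v2 :- v0 :* v2)) refl (q ∷ t N ∷ q′ ∷ []) ⟩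
      c ⊛ t N ⊕ (q′ ⊕ ⊖ (q ⊛ q′))       ≈⟨ ⊕-cong (telescope N) (⊕-congˡ q′ (⊖-cong (δ-⊛ (suc i) (suc i ℕ.* suc N)))) ⟩
      (q ⊕ ⊖ q′) ⊕ (q′ ⊕ ⊖ q″)          ≈⟨ solveₛ ((v0 :- v1) :+ (v1 :- v2)) (v0 :- v2) refl (q ∷ q′ ∷ q″ ∷ []) ⟩
      q ⊕ ⊖ q″                          ≈⟨ ⊕-congˡ q (⊖-cong {q″} (mk λ n → cong (λ m → δ m n) (sym (ℕₚ.*-suc (suc i) (suc N))))) ⟩
      q ⊕ ⊖ δ (suc i ℕ.* suc (suc N))   ∎
      where
      q′ = δ (suc i ℕ.* suc N)
      q″ = δ (suc i ℕ.+ suc i ℕ.* suc N)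
    eq : t N ≈ (q ⊕ ⊖ δ (suc i ℕ.* suc N)) ⊛ inv c
    eq = begin
      t N                                      ≈⟨ ⊛-identityˡ (t N) ⟨
      1ₛ ⊛ t N                                 ≈⟨ ⊛-congʳ (1-δ-inv i) ⟨
      (c ⊛ inv c) ⊛ t N                        ≈⟨ solveₛ ((v0 :* v1) :* v2) ((v0 :* v2) :* v1) refl (c ∷ inv c ∷ t N ∷ []) ⟩
      (c ⊛ t N) ⊛ inv c                        ≈⟨ ⊛-congʳ (telescope N) ⟩
      (q ⊕ ⊖ δ (suc i ℕ.* suc N)) ⊛ inv c      ∎

  lamberts-truncated : ∀ N n k → n ℕ.≤ N → lamberts k n ≡ sum k (λ a → sum N (λ x → + suc a ℤ.* δ (suc a ℕ.* suc x) n))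
  lamberts-truncated N n zero    n≤N = const-0 n
  lamberts-truncated N n (suc k) n≤N = cong₂ ℤ._+_ (lamberts-truncated N n k n≤N) (lambert-truncated k N n n≤N)

  -- Coefficients up to n are not affected by parts larger than n, so the identity for the finite
  -- product with k = n already decides the coefficient at n.
  D-G : D G ≈ G ⊛ L 1
  D-G = mk λ n → trans (at (D-Gₖ n) n) (⊛-local n
    (λ i i≤n → cong +_ (trans (cong (partsAtMost i) (sym (ℕₚ.m+[n∸m]≡n i≤n))) (Gₖ-stable i (n ∸ i))))
    (λ i i≤n → trans (lamberts-truncated n i n i≤n) (trans
      (sum-cong n λ a → sum-cong n λ x → cong (ℤ._* δ (suc a ℕ.* suc x) i) (sym (ℤₚ.*-identityʳ (+ suc a))))
      (Λ-stable-L n i 1 i≤n))))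

open Partitions

-- U as a trace over the series in q¹³.

module Trace where

  open SetoidReasoning (CommutativeRing.setoid seriesRing)

  coord : ℕ → Series → Series
  coord l f n = f (n ℕ.* 13 ℕ.+ l)

  sumₛ-cong : ∀ N {F F′ : ℕ → Series} → (∀ i → i ℕ.< N → F i ≈ F′ i) → sumₛ N F ≈ sumₛ N F′
  sumₛ-cong N p = mk λ n → sum-cong-< N λ i i<N → at (p i i<N) n

  sumₛ-⊕ : ∀ N F F′ → sumₛ N (λ i → F i ⊕ F′ i) ≈ sumₛ N F ⊕ sumₛ N F′
  sumₛ-⊕ N F F′ = mk λ n → sum-+ N (λ i → F i n) (λ i → F′ i n)

  sumₛ-swap : ∀ M N (F : ℕ → ℕ → Series) → sumₛ M (λ i → sumₛ N (F i)) ≈ sumₛ N (λ j → sumₛ M (λ i → F i j))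
  sumₛ-swap M N F = mk λ n → sum-swap M N (λ i j → F i j n)

  coord-cong : ∀ l {f g} → f ≈ g → coord l f ≈ coord l g
  coord-cong l p = mk λ n → at p (n ℕ.* 13 ℕ.+ l)

  -- Multiplication by q^(13-l) moves the residue l to the residue 0, one place later. In this way
  -- the linearity of U passes to every coordinate.
  coord-as-U : ∀ l f → l ℕ.≤ 13 → coord l f ≈ shift (U (δ (13 ∸ l) ⊛ f))
  coord-as-U l f l≤13 = mk λ n → sym (trans (cong (δ (13 ∸ l) ⊛ f) (index n)) (δ-⊛-≥ (13 ∸ l) f (n ℕ.* 13 ℕ.+ l)))
    where
    index : ∀ n → suc n ℕ.* 13 ≡ (13 ∸ l) ℕ.+ (n ℕ.* 13 ℕ.+ l)
    index n = trans (cong (ℕ._+ n ℕ.* 13) (sym (ℕₚ.m∸n+n≡m l≤13))) (trans (ℕₚ.+-assoc (13 ∸ l) l (n ℕ.* 13)) (cong ((13 ∸ l) ℕ.+_) (ℕₚ.+-comm l (n ℕ.* 13))))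

  coord-V : ∀ l r f → l ℕ.< 13 → coord l (V r ⊛ f) ≈ r ⊛ coord l f
  coord-V l r f l<13 = begin
    coord l (V r ⊛ f)                  ≈⟨ coord-as-U l (V r ⊛ f) (ℕₚ.<⇒≤ l<13) ⟩
    shift (U (δ d ⊛ (V r ⊛ f)))        ≈⟨ mk (λ n → at (≈-trans (U-cong (solveₛ (v0 :* (v1 :* v2)) (v1 :* (v0 :* v2)) refl (δ d ∷ V r ∷ f ∷ []))) (U-V r (δ d ⊛ f))) (suc n)) ⟩
    shift (r ⊛ U (δ d ⊛ f))            ≈⟨ mk (λ n → trans (⊛-suc-right r (U (δ d ⊛ f)) n) (trans (cong (λ t → r (suc n) ℤ.* t ℤ.+ (r ⊛ shift (U (δ d ⊛ f))) n) (δ-⊛-< d f 0 (ℕₚ.m<n⇒0<n∸m l<13)))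
                                            (trans (cong (ℤ._+ (r ⊛ shift (U (δ d ⊛ f))) n) (ℤₚ.*-zeroʳ (r (suc n)))) (ℤₚ.+-identityˡ _)))) ⟩
    r ⊛ shift (U (δ d ⊛ f))            ≈⟨ ⊛-congˡ (coord-as-U l f (ℕₚ.<⇒≤ l<13)) ⟨
    r ⊛ coord l f                      ∎
    where d = 13 ∸ l

  spread-as-δ : ∀ l f → spread l f ≈ δ l ⊛ V f
  spread-as-δ l f = mk λ n → go l n
    where
    go : ∀ l n → spread l f n ≡ (δ l ⊛ V f) n
    go zero    n       = sym (at (≈-trans (⊛-congʳ δ-0) (⊛-identityˡ (V f))) n)
    go (suc l) zero    = refl
    go (suc l) (suc n) = trans (go l n) (sym (ℤₚ.+-identityˡ _))

  -- The part of h supported on exponents congruent to l modulo 13.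
  part : ℕ → Series → Series
  part l h = spread l (coord l h)

  -- This locality makes the map `Ξ` below a contraction. The helper carries an offset c because
  -- `spread` lowers the residue while it advances the exponent.
  part-local : ∀ l m {h h′} → h m ≡ h′ m → part l h m ≡ part l h′ m
  part-local l m {h} {h′} eq = trans (unpad h) (trans (go l m 0 h h′ (trans (cong h (ℕₚ.+-identityʳ m)) (trans eq (cong h′ (sym (ℕₚ.+-identityʳ m)))))) (sym (unpad h′)))
    where
    offset : ℕ → ℕ → Series → Series
    offset j c h n = h (n ℕ.* 13 ℕ.+ j ℕ.+ c)
    unpad : ∀ h → part l h m ≡ spread l (offset l 0 h) m
    unpad h = at (spread-cong l (mk λ n → cong h (sym (ℕₚ.+-identityʳ _)))) m
    go : ∀ j m c h h′ → h (m ℕ.+ c) ≡ h′ (m ℕ.+ c) → spread j (offset j c h) m ≡ spread j (offset j c h′) m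
    reindex₀ : ∀ c h → shift (offset 0 c h) ≈ offset 12 (suc c) h
    reindex₀ c h = mk λ n → cong h (trans (cong (λ t → 13 ℕ.+ t ℕ.+ c) (ℕₚ.+-identityʳ (n ℕ.* 13))) (trans (cong (λ t → suc (t ℕ.+ c)) (ℕₚ.+-comm 12 (n ℕ.* 13))) (sym (ℕₚ.+-suc _ c))))
    reindex : ∀ j c h → offset (suc j) c h ≈ offset j (suc c) h
    reindex j c h = mk λ n → cong h (trans (cong (ℕ._+ c) (ℕₚ.+-suc (n ℕ.* 13) j)) (sym (ℕₚ.+-suc _ c)))
    go zero    zero    c h h′ eq = eq
    go zero    (suc m) c h h′ eq = trans (at (spread-cong 12 (reindex₀ c h)) m)
      (trans (go 12 m (suc c) h h′ (trans (cong h (ℕₚ.+-suc m c)) (trans eq (cong h′ (sym (ℕₚ.+-suc m c)))))) (sym (at (spread-cong 12 (reindex₀ c h′)) m)))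
    go (suc j) zero    c h h′ eq = refl
    go (suc j) (suc m) c h h′ eq = trans (at (spread-cong j (reindex j c h)) m)
      (trans (go j m (suc c) h h′ (trans (cong h (ℕₚ.+-suc m c)) (trans eq (cong h′ (sym (ℕₚ.+-suc m c)))))) (sym (at (spread-cong j (reindex j c h′)) m)))

  sum-single : ∀ N F k → k ℕ.< N → (∀ i → i ≢ k → F i ≡ + 0) → sum N F ≡ F k
  sum-single (suc N) F k (ℕ.s≤s k≤N) p with ℕₚ.m≤n⇒m<n∨m≡n k≤N
  ... | inj₁ k<N  = trans (cong₂ ℤ._+_ (sum-single N F k k<N p) (p N (λ N≡k → ℕₚ.<⇒≢ k<N (sym N≡k)))) (ℤₚ.+-identityʳ (F k))
  ... | inj₂ refl = trans (cong (ℤ._+ F N) (sum-0 N λ i i<N → p i (ℕₚ.<⇒≢ i<N))) (ℤₚ.+-identityˡ (F N))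

  spread-< : ∀ j n f → n ℕ.< j → spread j f n ≡ + 0
  spread-< (suc j) zero    f lt         = refl
  spread-< (suc j) (suc n) f (ℕ.s≤s lt) = spread-< j n f lt

  spread-≢ : ∀ j n f → n ℕ.< 13 → j ≢ n → spread j f n ≡ + 0
  spread-≢ zero    zero    f lt         ≢ = ⊥-elim (≢ refl)
  spread-≢ zero    (suc n) f (ℕ.s≤s lt) ≢ = spread-< 12 n (shift f) lt
  spread-≢ (suc j) zero    f lt         ≢ = refl
  spread-≢ (suc j) (suc n) f lt         ≢ = spread-≢ j n f (ℕₚ.<-trans (ℕₚ.n<1+n n) lt) (λ j≡n → ≢ (cong suc j≡n))

  spread-≡ : ∀ n f → spread n f n ≡ f 0
  spread-≡ zero    f = refl
  spread-≡ (suc n) f = spread-≡ n f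

  spread-+ : ∀ i j f n → spread (i ℕ.+ j) f (i ℕ.+ n) ≡ spread j f n
  spread-+ zero    j f n = refl
  spread-+ (suc i) j f n = spread-+ i j f n

  spread-13 : ∀ l n f → l ℕ.< 13 → spread l f (13 ℕ.+ n) ≡ spread l (shift f) n
  spread-13 l n f (ℕ.s≤s l≤12) = trans (cong (spread l f) (sym index)) (trans
    (trans (cong (λ t → spread t f (l ℕ.+ suc ((12 ∸ l) ℕ.+ n))) (sym (ℕₚ.+-identityʳ l))) (spread-+ l 0 f (suc ((12 ∸ l) ℕ.+ n))))
    (trans (cong (λ t → spread t (shift f) ((12 ∸ l) ℕ.+ n)) (sym (ℕₚ.m∸n+n≡m l≤12))) (spread-+ (12 ∸ l) l (shift f) n)))
    where
    index : l ℕ.+ suc ((12 ∸ l) ℕ.+ n) ≡ 13 ℕ.+ n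
    index = trans (ℕₚ.+-suc l _) (cong suc (trans (sym (ℕₚ.+-assoc l (12 ∸ l) n)) (cong (ℕ._+ n) (ℕₚ.m+[n∸m]≡n l≤12))))

  parts : ∀ f → sumₛ 13 (λ l → part l f) ≈ f
  parts f = mk (λ n → go n f)
    where
    base : ∀ n f → n ℕ.< 13 → sumₛ 13 (λ l → part l f) n ≡ f n
    base n f n<13 = trans (sum-single 13 (λ l → part l f n) n n<13 λ l l≢n → spread-≢ l n (coord l f) n<13 l≢n) (spread-≡ n (coord n f))
    go : ∀ n f → sumₛ 13 (λ l → part l f) n ≡ f n
    go (suc (suc (suc (suc (suc (suc (suc (suc (suc (suc (suc (suc (suc n))))))))))))) f =
      trans (sum-cong-< 13 λ l l<13 → spread-13 l n (coord l f) l<13) (go n (λ i → f (13 ℕ.+ i)))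
    go 0 f = base 0 f (ℕₚ.≤ᵇ⇒≤ 1 13 _)
    go 1 f = base 1 f (ℕₚ.≤ᵇ⇒≤ 2 13 _)
    go 2 f = base 2 f (ℕₚ.≤ᵇ⇒≤ 3 13 _)
    go 3 f = base 3 f (ℕₚ.≤ᵇ⇒≤ 4 13 _)
    go 4 f = base 4 f (ℕₚ.≤ᵇ⇒≤ 5 13 _)
    go 5 f = base 5 f (ℕₚ.≤ᵇ⇒≤ 6 13 _)
    go 6 f = base 6 f (ℕₚ.≤ᵇ⇒≤ 7 13 _)
    go 7 f = base 7 f (ℕₚ.≤ᵇ⇒≤ 8 13 _)
    go 8 f = base 8 f (ℕₚ.≤ᵇ⇒≤ 9 13 _)
    go 9 f = base 9 f (ℕₚ.≤ᵇ⇒≤ 10 13 _)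
    go 10 f = base 10 f (ℕₚ.≤ᵇ⇒≤ 11 13 _)
    go 11 f = base 11 f (ℕₚ.≤ᵇ⇒≤ 12 13 _)
    go 12 f = base 12 f (ℕₚ.≤ᵇ⇒≤ 13 13 _)

  δ-≢ : ∀ m n → m ≢ n → δ m n ≡ + 0
  δ-≢ zero    zero    ≢ = ⊥-elim (≢ refl)
  δ-≢ zero    (suc n) ≢ = refl
  δ-≢ (suc m) zero    ≢ = refl
  δ-≢ (suc m) (suc n) ≢ = δ-≢ m n (λ m≡n → ≢ (cong suc m≡n))

  δ-≡ : ∀ n → δ n n ≡ + 1
  δ-≡ zero    = refl
  δ-≡ (suc n) = δ-≡ n

  coord-δ-≡ : ∀ l → l ℕ.< 13 → coord l (δ l) ≈ 1ₛ
  coord-δ-≡ l l<13 = mk λ { zero → δ-≡ l ; (suc n) → δ-≢ l _ (ℕₚ.<⇒≢ (ℕₚ.<-≤-trans l<13 (ℕₚ.≤-trans (ℕₚ.m≤m+n 13 (n ℕ.* 13)) (ℕₚ.m≤m+n _ l)))) }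

  coord-δ-≢ : ∀ l k → k ℕ.< 13 → k ≢ l → coord l (δ k) ≈ 0ₛ
  coord-δ-≢ l k k<13 k≢l = mk λ { zero → δ-≢ k l k≢l ; (suc n) → δ-≢ k _ (ℕₚ.<⇒≢ (ℕₚ.<-≤-trans k<13 (ℕₚ.≤-trans (ℕₚ.m≤m+n 13 (n ℕ.* 13)) (ℕₚ.m≤m+n _ l)))) }

  coord-spread : ∀ l (r : ℕ → Series) → l ℕ.< 13 → coord l (sumₛ 13 (λ k → spread k (r k))) ≈ r l
  coord-spread l r l<13 = mk λ n → trans
    (sum-cong-< 13 {G = λ k → (r k ⊛ coord l (δ k)) n} λ k k<13 → at (≈-trans (coord-cong l (≈-trans (spread-as-δ k (r k)) (⊛-comm (δ k) (V (r k))))) (coord-V l (r k) (δ k) l<13)) n)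
    (trans (sum-cong-< 13 {G = λ k → (r k ⊛ single k) n} λ k k<13 → at (⊛-congˡ (coord-single k k<13)) n)
    (trans (sum-single 13 (λ k → (r k ⊛ single k) n) l l<13 (λ k k≢l → at (vanishing k k≢l) n))
      (at (≈-trans (⊛-congˡ (single-≡ l)) (⊛-identityʳ (r l))) n)))
    where
    single : ℕ → Series
    single k = const (δ k l)
    single-≡ : ∀ k → const (δ k k) ≈ 1ₛ
    single-≡ k = mk λ n → cong (λ t → const t n) (δ-≡ k)
    coord-single : ∀ k → k ℕ.< 13 → coord l (δ k) ≈ single k
    coord-single k k<13 with k ℕ.≟ l
    ... | yes refl = ≈-trans (coord-δ-≡ l l<13) (≈-sym (single-≡ l))
    ... | no k≢l   = ≈-trans (coord-δ-≢ l k k<13 k≢l) (mk λ n → cong (λ t → const t n) (sym (δ-≢ k l k≢l)))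
    vanishing : ∀ k → k ≢ l → r k ⊛ single k ≈ (λ _ → + 0)
    vanishing k k≢l = ≈-trans (⊛-congˡ {r k} {single k} {0ₛ} (mk λ n → cong (λ t → const t n) (δ-≢ k l k≢l)))
      (≈-trans (solveₛ (v0 :* con (+ 0)) (con (+ 0)) refl (r k ∷ [])) (mk const-0))

  V-sumₛ : ∀ N F → V (sumₛ N F) ≈ sumₛ N (λ i → V (F i))
  V-sumₛ zero    F = ≈-trans (V-cong {sumₛ 0 F} {0ₛ} (mk λ n → sym (const-0 n))) (≈-trans (V-const (+ 0)) (mk const-0))
  V-sumₛ (suc N) F = ≈-trans (V-⊕ (sumₛ N F) (F N)) (⊕-congʳ (V (F N)) (V-sumₛ N F))

  -- A basis of ℤ[[q]] over ℤ[[q¹³]], its l-th member starting with q^l.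
  module Basis (g̃ : ℕ → Series) (g̃-0 : ∀ l → g̃ l 0 ≡ + 1) where

    g t : ℕ → Series
    g l = δ l ⊛ g̃ l
    t l = shift (g̃ l)

    private
      -- If h = Σ q^l rₗ(q¹³), then Σ gₗ rₗ(q¹³) equals h plus terms of higher order, as g̃ₗ = 1 + q
      -- tₗ. Requiring the sum to be f is the fixed point equation of `Ξ f`, and the coordinates of
      -- f in the basis g are those of h in the basis q^l.
      Ξ : Series → Series → Series
      Ξ f h = f ⊕ ⊖ sumₛ 13 (λ l → qs (part l h ⊛ t l))

      contraction : ∀ f → Contraction (Ξ f)
      contraction f n {h} {h′} p = cong (λ s → f n ℤ.- s) (sum-cong 13 λ l → go l n p)
        where
        go : ∀ l n → (∀ i → i ℕ.< n → h i ≡ h′ i) → qs (part l h ⊛ t l) n ≡ qs (part l h′ ⊛ t l) n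
        go l zero    p = refl
        go l (suc n) p = ⊛-local n (λ i i≤n → part-local l i {h} {h′} (p i (ℕ.s≤s i≤n))) (λ _ _ → refl)

      part-g̃ : ∀ l h → part l h ⊛ g̃ l ≈ part l h ⊕ qs (part l h ⊛ t l)
      part-g̃ l h = begin
        part l h ⊛ g̃ l                      ≈⟨ ⊛-congˡ (one-plus-X (g̃ l) (g̃-0 l)) ⟩
        part l h ⊛ (1ₛ ⊕ X ⊛ t l)           ≈⟨ solveₛ (v0 :* (con (+ 1) :+ v1 :* v2)) (v0 :+ v1 :* (v0 :* v2)) refl (part l h ∷ X ∷ t l ∷ []) ⟩
        part l h ⊕ X ⊛ (part l h ⊛ t l)     ≈⟨ ⊕-congˡ (part l h) (X-⊛ (part l h ⊛ t l)) ⟩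
        part l h ⊕ qs (part l h ⊛ t l)      ∎

      V-g : ∀ l r → V r ⊛ g l ≈ spread l r ⊛ g̃ l
      V-g l r = ≈-trans (solveₛ (v0 :* (v1 :* v2)) ((v1 :* v0) :* v2) refl (V r ∷ δ l ∷ g̃ l ∷ [])) (⊛-congʳ (≈-sym (spread-as-δ l r)))

      expand : ∀ h → sumₛ 13 (λ l → V (coord l h) ⊛ g l) ≈ h ⊕ sumₛ 13 (λ l → qs (part l h ⊛ t l))
      expand h = begin
        sumₛ 13 (λ l → V (coord l h) ⊛ g l)                               ≈⟨ sumₛ-cong 13 (λ l _ → ≈-trans (V-g l (coord l h)) (part-g̃ l h)) ⟩
        sumₛ 13 (λ l → part l h ⊕ qs (part l h ⊛ t l))                    ≈⟨ sumₛ-⊕ 13 (λ l → part l h) (λ l → qs (part l h ⊛ t l)) ⟩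
        sumₛ 13 (λ l → part l h) ⊕ sumₛ 13 (λ l → qs (part l h ⊛ t l))    ≈⟨ ⊕-congʳ (sumₛ 13 (λ l → qs (part l h ⊛ t l))) (parts h) ⟩
        h ⊕ sumₛ 13 (λ l → qs (part l h ⊛ t l))                           ∎

      pre : Series → Series
      pre f = fix (Ξ f) (contraction f)

    c : ℕ → Series → Series
    c l f = coord l (pre f)

    c-expansion : ∀ f → f ≈ sumₛ 13 (λ l → V (c l f) ⊛ g l)
    c-expansion f = ≈-sym (begin
      sumₛ 13 (λ l → V (c l f) ⊛ g l)       ≈⟨ expand (pre f) ⟩
      pre f ⊕ s                             ≈⟨ ⊕-congʳ s (fix-fixed (Ξ f) (contraction f)) ⟩
      (f ⊕ ⊖ s) ⊕ s                         ≈⟨ solveₛ ((v0 :- v1) :+ v1) v0 refl (f ∷ s ∷ []) ⟩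
      f                                     ∎)
      where s = sumₛ 13 (λ l → qs (part l (pre f) ⊛ t l))


    c-unique : ∀ f (r : ℕ → Series) → f ≈ sumₛ 13 (λ l → V (r l) ⊛ g l) → ∀ l → l ℕ.< 13 → c l f ≈ r l
    c-unique f r p l l<13 = ≈-trans (coord-cong l (fix-unique (Ξ f) (contraction f) (fix-fixed (Ξ f) (contraction f)) h-fixed)) (coord-spread l r l<13)
      where
      h = sumₛ 13 (λ k → spread k (r k))
      s = sumₛ 13 (λ l → qs (part l h ⊛ t l))
      h-fixed : h ≈ Ξ f h
      h-fixed = begin
        h                                             ≈⟨ solveₛ v0 ((v0 :+ v1) :- v1) refl (h ∷ s ∷ []) ⟩
        (h ⊕ s) ⊕ ⊖ s                                 ≈⟨ ⊕-congʳ (⊖ s) (expand h) ⟨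
        sumₛ 13 (λ l → V (coord l h) ⊛ g l) ⊕ ⊖ s     ≈⟨ ⊕-congʳ (⊖ s) (sumₛ-cong 13 {λ l → V (coord l h) ⊛ g l} {λ l → V (r l) ⊛ g l} λ l l<13 → ⊛-congʳ (V-cong (coord-spread l r l<13))) ⟩
        sumₛ 13 (λ l → V (r l) ⊛ g l) ⊕ ⊖ s           ≈⟨ ⊕-congʳ (⊖ s) p ⟨
        f ⊕ ⊖ s                                       ∎

    c-linear : ∀ k N (a F : ℕ → Series) → k ℕ.< 13 → c k (sumₛ N (λ l → V (a l) ⊛ F l)) ≈ sumₛ N (λ l → a l ⊛ c k (F l))
    c-linear k N a F k<13 = c-unique _ (λ k → sumₛ N (λ l → a l ⊛ c k (F l))) (begin
      sumₛ N (λ l → V (a l) ⊛ F l)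
        ≈⟨ sumₛ-cong N (λ l _ → ≈-trans (⊛-congˡ (c-expansion (F l))) (⊛-sumₛ 13 (λ k → V (c k (F l)) ⊛ g k) (V (a l)))) ⟩
      sumₛ N (λ l → sumₛ 13 (λ k → V (a l) ⊛ (V (c k (F l)) ⊛ g k)))
        ≈⟨ sumₛ-swap N 13 (λ l k → V (a l) ⊛ (V (c k (F l)) ⊛ g k)) ⟩
      sumₛ 13 (λ k → sumₛ N (λ l → V (a l) ⊛ (V (c k (F l)) ⊛ g k)))
        ≈⟨ sumₛ-cong 13 (λ k _ → ≈-sym (≈-trans (⊛-congʳ (V-sumₛ N _)) (≈-trans (sumₛ-⊛ N _ (g k))
             (sumₛ-cong N λ l _ → ≈-trans (⊛-congʳ (V-⊛ (a l) (c k (F l)))) (⊛-assoc (V (a l)) _ (g k)))))) ⟩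
      sumₛ 13 (λ k → V (sumₛ N (λ l → a l ⊛ c k (F l))) ⊛ g k) ∎) k k<13

    c-cong : ∀ k {f f′} → k ℕ.< 13 → f ≈ f′ → c k f ≈ c k f′
    c-cong k {f} {f′} k<13 p = c-unique f (λ l → c l f′) (≈-trans p (c-expansion f′)) k k<13

    trace : Series → Series
    trace f = sumₛ 13 (λ k → c k (f ⊛ g k))

    -- Both sides are the trace of multiplication by f, in the bases g and δ.
    trace-U : ∀ f → trace f ≈ const (+ 13) ⊛ U f
    trace-U f = begin
      sumₛ 13 (λ k → c k (f ⊛ g k))
        ≈⟨ sumₛ-cong 13 (λ k k<13 → ≈-trans (c-cong k k<13 (times-g k)) (c-linear k 13 (λ l → coord l (g k)) (λ l → f ⊛ δ l) k<13)) ⟩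
      sumₛ 13 (λ k → sumₛ 13 (λ l → coord l (g k) ⊛ c k (f ⊛ δ l)))
        ≈⟨ sumₛ-swap 13 13 (λ k l → coord l (g k) ⊛ c k (f ⊛ δ l)) ⟩
      sumₛ 13 (λ l → sumₛ 13 (λ k → coord l (g k) ⊛ c k (f ⊛ δ l)))
        ≈⟨ sumₛ-cong 13 (λ l l<13 → ≈-trans (sumₛ-cong 13 λ k _ → ≈-trans (⊛-comm (coord l (g k)) _) (≈-sym (coord-V l (c k (f ⊛ δ l)) (g k) l<13)))
             (coord-cong l (≈-sym (c-expansion (f ⊛ δ l))))) ⟩
      sumₛ 13 (λ l → coord l (f ⊛ δ l))
        -- In the basis 1, q, ..., q¹² every diagonal entry of multiplication by f is the same
        -- series: the residue l part of q^l f is q^l (U f)(q¹³).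
        ≈⟨ sumₛ-cong 13 (λ l _ → mk λ n → trans (at (⊛-comm f (δ l)) (n ℕ.* 13 ℕ.+ l)) (trans (cong (δ l ⊛ f) (ℕₚ.+-comm (n ℕ.* 13) l)) (δ-⊛-≥ l f (n ℕ.* 13)))) ⟩
      sumₛ 13 (λ _ → U f)
        ≈⟨ mk (λ n → trans (sum-const 13 (U f n)) (sym (at (const-⊛ (+ 13) (U f)) n))) ⟩
      const (+ 13) ⊛ U f ∎
      where
      times-g : ∀ k → f ⊛ g k ≈ sumₛ 13 (λ l → V (coord l (g k)) ⊛ (f ⊛ δ l))
      times-g k = begin
        f ⊛ g k                                                 ≈⟨ ⊛-congˡ (parts (g k)) ⟨
        f ⊛ sumₛ 13 (λ l → part l (g k))                        ≈⟨ ⊛-sumₛ 13 (λ l → part l (g k)) f ⟩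
        sumₛ 13 (λ l → f ⊛ part l (g k))                        ≈⟨ sumₛ-cong 13 (λ l _ → ≈-trans (⊛-congˡ (spread-as-δ l (coord l (g k))))
                                                                     (solveₛ (v0 :* (v1 :* v2)) (v2 :* (v0 :* v1)) refl (f ∷ δ l ∷ V (coord l (g k)) ∷ []))) ⟩
        sumₛ 13 (λ l → V (coord l (g k)) ⊛ (f ⊛ δ l))           ∎

open Trace

-- Ramanujan's differential equations.

module Ramanujan where

  open SetoidReasoning (CommutativeRing.setoid seriesRing)

  -- E₂, E₄ and E₆.
  P Q R : Series
  P = 1ₛ ⊕ const -[1+ 23 ] ⊛ L 1
  Q = 1ₛ ⊕ const (+ 240) ⊛ L 3
  R = 1ₛ ⊕ const -[1+ 503 ] ⊛ L 5

  D-affine : ∀ c f → D (1ₛ ⊕ const c ⊛ f) ≈ const c ⊛ D f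
  D-affine c f = begin
    D (1ₛ ⊕ const c ⊛ f)                        ≈⟨ D-⊕ 1ₛ (const c ⊛ f) ⟩
    D 1ₛ ⊕ D (const c ⊛ f)                      ≈⟨ ⊕-cong (D-const (+ 1)) (D-⊛ (const c) f) ⟩
    0ₛ ⊕ (D (const c) ⊛ f ⊕ const c ⊛ D f)      ≈⟨ ⊕-congˡ 0ₛ (⊕-congʳ (const c ⊛ D f) (⊛-congʳ (D-const c))) ⟩
    0ₛ ⊕ (0ₛ ⊛ f ⊕ const c ⊛ D f)               ≈⟨ solveₛ (con (+ 0) :+ (con (+ 0) :* v0 :+ v1)) v1 refl (f ∷ const c ⊛ D f ∷ []) ⟩
    const c ⊛ D f                               ∎

  -- Deduces an identity modulo one known relation: the explicit cofactor c makes the first premise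
  -- a pure ring identity, fit for the solver.
  by-multiple : ∀ {f g h k} c → f ⊕ ⊖ g ≈ c ⊛ (h ⊕ ⊖ k) → h ≈ k → f ≈ g
  by-multiple {f} {g} {h} {k} c p h≈k = minus-0 (begin
    f ⊕ ⊖ g           ≈⟨ p ⟩
    c ⊛ (h ⊕ ⊖ k)     ≈⟨ ⊛-congˡ (0-minus h≈k) ⟩
    c ⊛ 0ₛ            ≈⟨ solveₛ (v0 :* con (+ 0)) (con (+ 0)) refl (c ∷ []) ⟩
    0ₛ                ∎)

  convolution-11 : const (+ 12) ⊛ (L 1 ⊛ L 1) ≈ const (+ 5) ⊛ L 3 ⊕ (L 1 ⊕ const -[1+ 5 ] ⊛ D (L 1))
  convolution-11 = mk λ n → trans (at (const-⊛ (+ 12) _) n) (trans (left ((L 1 ⊛ L 1) n)) (trans (Degree2.identity n)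
    (trans (right (L 0 n) (L 1 n) (L 2 n) (L 3 n) (+ n))
      (sym (cong₂ ℤ._+_ (at (const-⊛ (+ 5) _) n) (cong (λ t → L 1 n ℤ.+ t) (at (const-⊛ -[1+ 5 ] _) n)))))))
    where
    left : ∀ x → + 12 ℤ.* x ≡ + 6 ℤ.* (+ 2 ℤ.* x ℤ.+ + 0)
    left = solve-∀
    right : ∀ a b c d n → (+ 0 ℤ.* a ℤ.+ (+ 1 ℤ.* b ℤ.+ (-[1+ 5 ] ℤ.* c ℤ.+ (+ 5 ℤ.* d ℤ.+ + 0)))) ℤ.- + 6 ℤ.* (+ 1 ℤ.* (n ℤ.* b ℤ.- c))
            ≡ + 5 ℤ.* d ℤ.+ (b ℤ.+ -[1+ 5 ] ℤ.* (n ℤ.* b))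
    right = solve-∀

  convolution-13 : const (+ 240) ⊛ (L 1 ⊛ L 3) ≈ const (+ 21) ⊛ L 5 ⊕ (const (+ 10) ⊛ L 3 ⊕ (const -[1+ 0 ] ⊛ L 1 ⊕ const -[1+ 29 ] ⊛ D (L 3)))
  convolution-13 = mk λ n → trans (at (const-⊛ (+ 240) _) n) (trans (left ((L 1 ⊛ L 3) n))
    (trans (cong (λ t → + 30 ℤ.* (+ 4 ℤ.* t ℤ.+ (+ 4 ℤ.* (L 1 ⊛ L 3) n ℤ.+ + 0))) (at (⊛-comm (L 1) (L 3)) n)) (trans (Degree4.identity n)
    (trans (right (L 0 n) (L 1 n) (L 2 n) (L 3 n) (L 4 n) (L 5 n) (+ n))
      (sym (cong₂ ℤ._+_ (at (const-⊛ (+ 21) _) n) (cong₂ ℤ._+_ (at (const-⊛ (+ 10) _) n) (cong₂ ℤ._+_ (at (const-⊛ -[1+ 0 ] _) n) (at (const-⊛ -[1+ 29 ] _) n)))))))))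
    where
    left : ∀ x → + 240 ℤ.* x ≡ + 30 ℤ.* (+ 4 ℤ.* x ℤ.+ (+ 4 ℤ.* x ℤ.+ + 0))
    left = solve-∀
    right : ∀ a b c d e f n → (+ 0 ℤ.* a ℤ.+ (-[1+ 0 ] ℤ.* b ℤ.+ (+ 0 ℤ.* c ℤ.+ (+ 10 ℤ.* d ℤ.+ (-[1+ 29 ] ℤ.* e ℤ.+ (+ 21 ℤ.* f ℤ.+ + 0)))))) ℤ.- + 30 ℤ.* (+ 1 ℤ.* (n ℤ.* d ℤ.- e))
            ≡ + 21 ℤ.* f ℤ.+ (+ 10 ℤ.* d ℤ.+ (-[1+ 0 ] ℤ.* b ℤ.+ -[1+ 29 ] ℤ.* (n ℤ.* d)))
    right = solve-∀

  -- In terms of Eisenstein series this is E₄² = E₈.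
  convolution-33 : const (+ 120) ⊛ (L 3 ⊛ L 3) ≈ L 7 ⊕ const -[1+ 0 ] ⊛ L 3
  convolution-33 = mk λ n → trans (at (const-⊛ (+ 120) _) n) (trans (left ((L 3 ⊛ L 3) n)) (trans (Discriminant.identity n)
    (trans (right (L 0 n) (L 1 n) (L 2 n) (L 3 n) (L 4 n) (L 5 n) (L 6 n) (L 7 n) (+ n))
      (sym (cong (λ t → L 7 n ℤ.+ t) (at (const-⊛ -[1+ 0 ] _) n))))))
    where
    left : ∀ x → + 120 ℤ.* x ≡ + 30 ℤ.* (+ 4 ℤ.* x ℤ.+ + 0)
    left = solve-∀
    right : ∀ a b c d e f g h n → (+ 0 ℤ.* a ℤ.+ (+ 0 ℤ.* b ℤ.+ (+ 0 ℤ.* c ℤ.+ (-[1+ 0 ] ℤ.* d ℤ.+ (+ 0 ℤ.* e ℤ.+ (+ 0 ℤ.* f ℤ.+ (+ 0 ℤ.* g ℤ.+ (+ 1 ℤ.* h ℤ.+ + 0))))))))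
            ℤ.- + 30 ℤ.* (+ 0 ℤ.* (n ℤ.* b ℤ.- c)) ≡ h ℤ.+ -[1+ 0 ] ℤ.* d
    right = solve-∀

  convolution-15 : const (+ 5040) ⊛ (L 1 ⊛ L 5) ⊕ const (+ 5880) ⊛ (L 3 ⊛ L 3) ≈
    const (+ 249) ⊛ L 7 ⊕ (const (+ 210) ⊛ L 5 ⊕ (const -[1+ 48 ] ⊛ L 3 ⊕ (const (+ 10) ⊛ L 1 ⊕ const -[1+ 419 ] ⊛ D (L 5))))
  convolution-15 = mk λ n → trans (cong₂ ℤ._+_ (at (const-⊛ (+ 5040) _) n) (at (const-⊛ (+ 5880) _) n)) (trans (left ((L 1 ⊛ L 5) n) ((L 3 ⊛ L 3) n))
    (trans (cong (λ t → + 420 ℤ.* (+ 6 ℤ.* t ℤ.+ (+ 14 ℤ.* (L 3 ⊛ L 3) n ℤ.+ (+ 6 ℤ.* (L 1 ⊛ L 5) n ℤ.+ + 0)))) (at (⊛-comm (L 1) (L 5)) n)) (trans (Degree6.identity n)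
    (trans (right (L 0 n) (L 1 n) (L 2 n) (L 3 n) (L 4 n) (L 5 n) (L 6 n) (L 7 n) (+ n))
      (sym (cong₂ ℤ._+_ (at (const-⊛ (+ 249) _) n) (cong₂ ℤ._+_ (at (const-⊛ (+ 210) _) n) (cong₂ ℤ._+_ (at (const-⊛ -[1+ 48 ] _) n)
        (cong₂ ℤ._+_ (at (const-⊛ (+ 10) _) n) (at (const-⊛ -[1+ 419 ] _) n))))))))))
    where
    left : ∀ x y → + 5040 ℤ.* x ℤ.+ + 5880 ℤ.* y ≡ + 420 ℤ.* (+ 6 ℤ.* x ℤ.+ (+ 14 ℤ.* y ℤ.+ (+ 6 ℤ.* x ℤ.+ + 0)))
    left = solve-∀
    right : ∀ a b c d e f g h n → (+ 0 ℤ.* a ℤ.+ (+ 10 ℤ.* b ℤ.+ (+ 0 ℤ.* c ℤ.+ (-[1+ 48 ] ℤ.* d ℤ.+ (+ 0 ℤ.* e ℤ.+ (+ 210 ℤ.* f ℤ.+ (-[1+ 419 ] ℤ.* g ℤ.+ (+ 249 ℤ.* h ℤ.+ + 0))))))))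
            ℤ.- + 420 ℤ.* (+ 1 ℤ.* (n ℤ.* f ℤ.- g)) ≡ + 249 ℤ.* h ℤ.+ (+ 210 ℤ.* f ℤ.+ (-[1+ 48 ] ℤ.* d ℤ.+ (+ 10 ℤ.* b ℤ.+ -[1+ 419 ] ℤ.* (n ℤ.* f))))
    right = solve-∀

  private
    affine : ∀ {n} → ℤ → Expr n → Expr n
    affine c e = con (+ 1) :+ con c :* e

  D-P : const (+ 12) ⊛ D P ≈ P ⊛ P ⊕ ⊖ Q
  D-P = ≈-trans (⊛-congˡ (D-affine -[1+ 23 ] (L 1)))
    (by-multiple (const -[1+ 47 ]) (solveₛ
      (con (+ 12) :* (con -[1+ 23 ] :* v1) :- (affine -[1+ 23 ] v0 :* affine -[1+ 23 ] v0 :- affine (+ 240) v2))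
      (con -[1+ 47 ] :* (con (+ 12) :* (v0 :* v0) :- (con (+ 5) :* v2 :+ (v0 :+ con -[1+ 5 ] :* v1)))) refl
      (L 1 ∷ D (L 1) ∷ L 3 ∷ [])) convolution-11)

  D-Q : const (+ 3) ⊛ D Q ≈ P ⊛ Q ⊕ ⊖ R
  D-Q = ≈-trans (⊛-congˡ (D-affine (+ 240) (L 3)))
    (by-multiple (const (+ 24)) (solveₛ
      (con (+ 3) :* (con (+ 240) :* v1) :- (affine -[1+ 23 ] v0 :* affine (+ 240) v2 :- affine -[1+ 503 ] v3))
      (con (+ 24) :* (con (+ 240) :* (v0 :* v2) :- (con (+ 21) :* v3 :+ (con (+ 10) :* v2 :+ (con -[1+ 0 ] :* v0 :+ con -[1+ 29 ] :* v1))))) refl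
      (L 1 ∷ D (L 3) ∷ L 3 ∷ L 5 ∷ [])) convolution-13)

  D-R : const (+ 2) ⊛ D R ≈ P ⊛ R ⊕ ⊖ (Q ⊛ Q)
  -- `L 7` is eliminated by 249 times the relation E₄² = E₈. The factor 5 makes the cofactor of what
  -- remains the integer -12.
  D-R = cancelˡ (const (+ 5)) (λ ()) (≈-trans (⊛-congˡ (⊛-congˡ (D-affine -[1+ 503 ] (L 5))))
    (by-multiple (const -[1+ 11 ]) (solveₛ
      (con (+ 5) :* (con (+ 2) :* (con -[1+ 503 ] :* v1)) :- con (+ 5) :* (affine -[1+ 23 ] v0 :* affine -[1+ 503 ] v3 :- affine (+ 240) v2 :* affine (+ 240) v2))
      (con -[1+ 11 ] :* ((con (+ 5040) :* (v0 :* v3) :+ con (+ 5880) :* (v2 :* v2) :+ con (+ 249) :* v4) :-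
        ((con (+ 249) :* v4 :+ (con (+ 210) :* v3 :+ (con -[1+ 48 ] :* v2 :+ (con (+ 10) :* v0 :+ con -[1+ 419 ] :* v1)))) :+ con (+ 249) :* (con (+ 120) :* (v2 :* v2) :+ v2)))) refl
      (L 1 ∷ D (L 5) ∷ L 3 ∷ L 5 ∷ L 7 ∷ [])) (⊕-cong convolution-15 (⊛-congˡ L7))))
    where
    L7 : L 7 ≈ const (+ 120) ⊛ (L 3 ⊛ L 3) ⊕ L 3
    L7 = begin
      L 7                                          ≈⟨ solveₛ v0 ((v0 :+ con -[1+ 0 ] :* v1) :+ v1) refl (L 7 ∷ L 3 ∷ []) ⟩
      (L 7 ⊕ const -[1+ 0 ] ⊛ L 3) ⊕ L 3           ≈⟨ ⊕-congʳ (L 3) convolution-33 ⟨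
      const (+ 120) ⊛ (L 3 ⊛ L 3) ⊕ L 3            ∎

open Ramanujan

-- The eta quotients of level 13 and a ring of seven functions closed under D.

module Level13 where

  open SetoidReasoning (CommutativeRing.setoid seriesRing)

  -- With E = (q;q)_∞: u = (η(13τ)/η(τ))², x = u(13τ), Z = η(169τ)/η(τ), and φ = Du/u.
  E : Series
  E = inv G

  G-E : G ⊛ E ≈ 1ₛ
  G-E = ⊛-inv G refl

  u x Z : Series
  u = X ⊛ (V E ⊛ V E) ⊛ (G ⊛ G)
  x = V u
  Z = X ↑ 7 ⊛ V (V E) ⊛ G

  P′ Q′ R′ φ : Series
  P′ = V P
  Q′ = V Q
  R′ = V R
  φ = 1ₛ ⊕ (const (+ 2) ⊛ L 1 ⊕ const -[1+ 25 ] ⊛ V (L 1))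

  D-E : D E ≈ ⊖ (L 1 ⊛ E)
  D-E = cancelˡ G (λ ()) (minus-0 (begin
    G ⊛ D E ⊕ ⊖ (G ⊛ ⊖ (L 1 ⊛ E))    ≈⟨ solveₛ (v0 :* v3 :- v0 :* (:- (v2 :* v1))) ((v0 :* v2) :* v1 :+ v0 :* v3) refl (G ∷ E ∷ L 1 ∷ D E ∷ []) ⟩
    (G ⊛ L 1) ⊛ E ⊕ G ⊛ D E          ≈⟨ ⊕-congʳ (G ⊛ D E) (⊛-congʳ D-G) ⟨
    D G ⊛ E ⊕ G ⊛ D E                ≈⟨ D-⊛ G E ⟨
    D (G ⊛ E)                        ≈⟨ D-cong G-E ⟩
    D 1ₛ                             ≈⟨ D-const (+ 1) ⟩
    0ₛ                               ∎))

  D-VE : D (V E) ≈ const (+ 13) ⊛ ⊖ (V (L 1) ⊛ V E)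
  D-VE = ≈-trans (D-V E) (⊛-congˡ (≈-trans (V-cong D-E) (≈-trans (V-⊖ (L 1 ⊛ E)) (⊖-cong (V-⊛ (L 1) E)))))

  D-X : D X ≈ X
  D-X = mk λ { zero → refl ; (suc zero) → refl ; (suc (suc n)) → ℤₚ.*-zeroʳ (+ suc (suc n)) }

  D-u : D u ≈ u ⊛ φ
  D-u = begin
    D (X ⊛ (V E ⊛ V E) ⊛ (G ⊛ G))
      ≈⟨ D-⊛ (X ⊛ (V E ⊛ V E)) (G ⊛ G) ⟩
    D (X ⊛ (V E ⊛ V E)) ⊛ (G ⊛ G) ⊕ X ⊛ (V E ⊛ V E) ⊛ D (G ⊛ G)
      ≈⟨ ⊕-cong (⊛-congʳ (≈-trans (D-⊛ X (V E ⊛ V E)) (⊕-cong (⊛-congʳ D-X) (⊛-congˡ (D-⊛ (V E) (V E)))))) (⊛-congˡ (D-⊛ G G)) ⟩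
    (X ⊛ (V E ⊛ V E) ⊕ X ⊛ (D (V E) ⊛ V E ⊕ V E ⊛ D (V E))) ⊛ (G ⊛ G) ⊕ X ⊛ (V E ⊛ V E) ⊛ (D G ⊛ G ⊕ G ⊛ D G)
      ≈⟨ ⊕-cong (⊛-congʳ (⊕-congˡ (X ⊛ (V E ⊛ V E)) (⊛-congˡ (⊕-cong (⊛-congʳ D-VE) (⊛-congˡ D-VE))))) (⊛-congˡ (⊕-cong (⊛-congʳ D-G) (⊛-congˡ D-G))) ⟩
    (X ⊛ (V E ⊛ V E) ⊕ X ⊛ (const (+ 13) ⊛ (⊖ (V (L 1) ⊛ V E)) ⊛ V E ⊕ V E ⊛ (const (+ 13) ⊛ ⊖ (V (L 1) ⊛ V E)))) ⊛ (G ⊛ G)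
      ⊕ X ⊛ (V E ⊛ V E) ⊛ (G ⊛ L 1 ⊛ G ⊕ G ⊛ (G ⊛ L 1))
      ≈⟨ solveₛ ((v0 :* (v1 :* v1) :+ v0 :* (con (+ 13) :* (:- (v3 :* v1)) :* v1 :+ v1 :* (con (+ 13) :* (:- (v3 :* v1))))) :* (v2 :* v2)
                  :+ v0 :* (v1 :* v1) :* (v2 :* v4 :* v2 :+ v2 :* (v2 :* v4)))
                ((v0 :* (v1 :* v1) :* (v2 :* v2)) :* (con (+ 1) :+ (con (+ 2) :* v4 :+ con -[1+ 25 ] :* v3))) refl
                (X ∷ V E ∷ G ∷ V (L 1) ∷ L 1 ∷ []) ⟩
    u ⊛ φ ∎

  V-affine : ∀ c f → V (1ₛ ⊕ const c ⊛ f) ≈ 1ₛ ⊕ const c ⊛ V f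
  V-affine c f = ≈-trans (V-⊕ 1ₛ (const c ⊛ f)) (⊕-cong (V-const (+ 1)) (≈-trans (V-⊛ (const c) f) (⊛-congʳ (V-const c))))

  -- φ is the weight two form (13 E₂(13τ) - E₂(τ))/12. Hence P′ can be eliminated in favour of P and
  -- φ, and seven generators suffice.
  13P′ : const (+ 13) ⊛ P′ ≈ P ⊕ const (+ 12) ⊛ φ
  13P′ = ≈-trans (⊛-congˡ (V-affine -[1+ 23 ] (L 1))) (solveₛ
    (con (+ 13) :* (con (+ 1) :+ con -[1+ 23 ] :* v1))
    ((con (+ 1) :+ con -[1+ 23 ] :* v0) :+ con (+ 12) :* (con (+ 1) :+ (con (+ 2) :* v0 :+ con -[1+ 25 ] :* v1))) refl
    (L 1 ∷ V (L 1) ∷ []))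

  -- The factor 144 clears the denominators in the derivatives of P, φ, Q, R, Q′, R′, u.
  dvar : Fin 7 → Expr 7
  dvar zero = con (+ 12) :* (v0 :* v0 :- v2)
  dvar (suc zero) = con (+ 24) :* v0 :* v1 :+ con (+ 144) :* v1 :* v1 :- con (+ 169) :* v4 :+ v2
  dvar (suc (suc zero)) = con (+ 48) :* (v0 :* v2 :- v3)
  dvar (suc (suc (suc zero))) = con (+ 72) :* (v0 :* v3 :- v2 :* v2)
  dvar (suc (suc (suc (suc zero)))) = con (+ 48) :* ((v0 :+ con (+ 12) :* v1) :* v4 :- con (+ 13) :* v5)
  dvar (suc (suc (suc (suc (suc zero))))) = con (+ 72) :* ((v0 :+ con (+ 12) :* v1) :* v5 :- con (+ 13) :* v4 :* v4)
  dvar (suc (suc (suc (suc (suc (suc zero)))))) = con (+ 144) :* v6 :* v1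

  ρ : Vec Series 7
  ρ = P ∷ φ ∷ Q ∷ R ∷ Q′ ∷ R′ ∷ u ∷ []

  -- 144 D transported to expressions. Stability of an ideal under D thereby becomes an identity of
  -- polynomials in seven variables.
  ∂ : Expr 7 → Expr 7
  ∂ₚ : List ℤ → Expr 7 → Expr 7 → Expr 7
  ∂ₚ []      e de = con (+ 0)
  ∂ₚ (c ∷ p) e de = de :* poly p e :+ e :* ∂ₚ p e de
  ∂^ : ℕ → Expr 7 → Expr 7 → Expr 7
  ∂^ zero    e de = con (+ 0)
  ∂^ (suc k) e de = de :* e :^ k :+ e :* ∂^ k e de
  ∂ (var i)    = dvar i
  ∂ (con c)    = con (+ 0)
  ∂ (e :+ e′)  = ∂ e :+ ∂ e′
  ∂ (e :- e′)  = ∂ e :- ∂ e′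
  ∂ (e :* e′)  = ∂ e :* e′ :+ e :* ∂ e′
  ∂ (:- e)     = :- ∂ e
  ∂ (e :^ k)   = ∂^ k e (∂ e)
  ∂ (poly p e) = ∂ₚ p e (∂ e)

  144D : Series → Series
  144D f = const (+ 144) ⊛ D f

  144D-const : ∀ c → 144D (const c) ≈ 0ₛ
  144D-const c = ≈-trans (⊛-congˡ (D-const c)) (solveₛ (con (+ 144) :* con (+ 0)) (con (+ 0)) refl [])

  144D-⊕ : ∀ {f g f′ g′} → 144D f ≈ f′ → 144D g ≈ g′ → 144D (f ⊕ g) ≈ f′ ⊕ g′
  144D-⊕ {f} {g} p r = ≈-trans (⊛-congˡ (D-⊕ f g)) (≈-trans (⊛-distribˡ _ (D f) (D g)) (⊕-cong p r))

  144D-⊖ : ∀ {f f′} → 144D f ≈ f′ → 144D (⊖ f) ≈ ⊖ f′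
  144D-⊖ {f} {f′} p = ≈-trans (⊛-congˡ (D-⊖ f)) (≈-trans (solveₛ (con (+ 144) :* (:- v0)) (:- (con (+ 144) :* v0)) refl (D f ∷ [])) (⊖-cong p))

  144D-⊛ : ∀ {f g f′ g′} → 144D f ≈ f′ → 144D g ≈ g′ → 144D (f ⊛ g) ≈ f′ ⊛ g ⊕ f ⊛ g′
  144D-⊛ {f} {g} {f′} {g′} p r = begin
    const (+ 144) ⊛ D (f ⊛ g)                            ≈⟨ ⊛-congˡ (D-⊛ f g) ⟩
    const (+ 144) ⊛ (D f ⊛ g ⊕ f ⊛ D g)                  ≈⟨ solveₛ (con (+ 144) :* (v0 :* v1 :+ v2 :* v3)) ((con (+ 144) :* v0) :* v1 :+ v2 :* (con (+ 144) :* v3)) refl (D f ∷ g ∷ f ∷ D g ∷ []) ⟩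
    144D f ⊛ g ⊕ f ⊛ 144D g                              ≈⟨ ⊕-cong (⊛-congʳ p) (⊛-congˡ r) ⟩
    f′ ⊛ g ⊕ f ⊛ g′                                      ∎

  module _ (dvar-sound : ∀ i → 144D (lookup ρ i) ≈ ⟦ dvar i ⟧ ρ) where
    ∂-sound : ∀ e → 144D (⟦ e ⟧ ρ) ≈ ⟦ ∂ e ⟧ ρ
    ∂ₚ-sound : ∀ p e → 144D (⟦ e ⟧ ρ) ≈ ⟦ ∂ e ⟧ ρ → 144D (ev p (⟦ e ⟧ ρ)) ≈ ⟦ ∂ₚ p e (∂ e) ⟧ ρ
    ∂ₚ-sound []      e de = 144D-const (+ 0)
    ∂ₚ-sound (c ∷ p) e de = ≈-trans (144D-⊕ (144D-const c) (144D-⊛ de (∂ₚ-sound p e de)))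
      (solveₛ (con (+ 0) :+ v0) v0 refl (⟦ ∂ₚ (c ∷ p) e (∂ e) ⟧ ρ ∷ []))
    ∂^-sound : ∀ k e → 144D (⟦ e ⟧ ρ) ≈ ⟦ ∂ e ⟧ ρ → 144D (⟦ e ⟧ ρ ↑ k) ≈ ⟦ ∂^ k e (∂ e) ⟧ ρ
    ∂^-sound zero    e de = 144D-const (+ 1)
    ∂^-sound (suc k) e de = 144D-⊛ de (∂^-sound k e de)
    ∂-sound (var i)    = dvar-sound i
    ∂-sound (con c)    = 144D-const c
    ∂-sound (e :+ e′)  = 144D-⊕ (∂-sound e) (∂-sound e′)
    ∂-sound (e :- e′)  = 144D-⊕ (∂-sound e) (144D-⊖ (∂-sound e′))
    ∂-sound (e :* e′)  = 144D-⊛ (∂-sound e) (∂-sound e′)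
    ∂-sound (:- e)     = 144D-⊖ (∂-sound e)
    ∂-sound (e :^ k)   = ∂^-sound k e (∂-sound e)
    ∂-sound (poly p e) = ∂ₚ-sound p e (∂-sound e)

  V-linear : ∀ k {f g} → const k ⊛ f ≈ g → const k ⊛ V f ≈ V g
  V-linear k {f} p = ≈-trans (≈-trans (⊛-congʳ (≈-sym (V-const k))) (≈-sym (V-⊛ (const k) f))) (V-cong p)

  12DP′ : const (+ 12) ⊛ V (D P) ≈ P′ ⊛ P′ ⊕ ⊖ Q′
  12DP′ = ≈-trans (V-linear (+ 12) D-P) (≈-trans (V-⊕ (P ⊛ P) (⊖ Q)) (⊕-cong (V-⊛ P P) (V-⊖ Q)))

  3DQ′ : const (+ 3) ⊛ V (D Q) ≈ P′ ⊛ Q′ ⊕ ⊖ R′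
  3DQ′ = ≈-trans (V-linear (+ 3) D-Q) (≈-trans (V-⊕ (P ⊛ Q) (⊖ R)) (⊕-cong (V-⊛ P Q) (V-⊖ R)))

  2DR′ : const (+ 2) ⊛ V (D R) ≈ P′ ⊛ R′ ⊕ ⊖ (Q′ ⊛ Q′)
  2DR′ = ≈-trans (V-linear (+ 2) D-R) (≈-trans (V-⊕ (P ⊛ R) (⊖ (Q ⊛ Q))) (⊕-cong (V-⊛ P R) (≈-trans (V-⊖ (Q ⊛ Q)) (⊖-cong (V-⊛ Q Q)))))

  dvar-sound : ∀ i → 144D (lookup ρ i) ≈ ⟦ dvar i ⟧ ρ
  dvar-sound zero = ≈-trans (solveₛ (con (+ 144) :* v0) (con (+ 12) :* (con (+ 12) :* v0)) refl (D P ∷ [])) (⊛-congˡ D-P)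
  dvar-sound (suc zero) = begin
    const (+ 144) ⊛ D φ
      -- Dφ is obtained by differentiating 13P′ = P + 12φ. The factor 169 combines this 13 with the
      -- one in D V = 13 V D.
      ≈⟨ solveₛ (con (+ 144) :* v0) (con (+ 12) :* ((v1 :+ con (+ 12) :* v0) :- v1)) refl (D φ ∷ D P ∷ []) ⟩
    const (+ 12) ⊛ ((D P ⊕ const (+ 12) ⊛ D φ) ⊕ ⊖ D P)
      ≈⟨ ⊛-congˡ (⊕-congʳ (⊖ D P) DP′) ⟨
    const (+ 12) ⊛ ((const (+ 13) ⊛ (const (+ 13) ⊛ V (D P))) ⊕ ⊖ D P)
      ≈⟨ solveₛ (con (+ 12) :* ((con (+ 13) :* (con (+ 13) :* v0)) :- v1)) (con (+ 169) :* (con (+ 12) :* v0) :- con (+ 12) :* v1) refl (V (D P) ∷ D P ∷ []) ⟩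
    const (+ 169) ⊛ (const (+ 12) ⊛ V (D P)) ⊕ ⊖ (const (+ 12) ⊛ D P)
      ≈⟨ ⊕-cong (⊛-congˡ 12DP′) (⊖-cong D-P) ⟩
    const (+ 169) ⊛ (P′ ⊛ P′ ⊕ ⊖ Q′) ⊕ ⊖ (P ⊛ P ⊕ ⊖ Q)
      ≈⟨ solveₛ (con (+ 169) :* (v0 :* v0 :- v1) :- (v2 :* v2 :- v3)) ((con (+ 13) :* v0) :* (con (+ 13) :* v0) :- (con (+ 169) :* v1 :+ (v2 :* v2 :- v3))) refl (P′ ∷ Q′ ∷ P ∷ Q ∷ []) ⟩
    (const (+ 13) ⊛ P′) ⊛ (const (+ 13) ⊛ P′) ⊕ ⊖ (const (+ 169) ⊛ Q′ ⊕ (P ⊛ P ⊕ ⊖ Q))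
      ≈⟨ ⊕-congʳ (⊖ (const (+ 169) ⊛ Q′ ⊕ (P ⊛ P ⊕ ⊖ Q))) (⊛-cong 13P′ 13P′) ⟩
    (P ⊕ const (+ 12) ⊛ φ) ⊛ (P ⊕ const (+ 12) ⊛ φ) ⊕ ⊖ (const (+ 169) ⊛ Q′ ⊕ (P ⊛ P ⊕ ⊖ Q))
      ≈⟨ solveₛ ((v0 :+ con (+ 12) :* v1) :* (v0 :+ con (+ 12) :* v1) :- (con (+ 169) :* v4 :+ (v0 :* v0 :- v2))) (dvar (suc zero)) refl ρ ⟩
    ⟦ dvar (suc zero) ⟧ ρ ∎
    where
    DP′ : const (+ 13) ⊛ (const (+ 13) ⊛ V (D P)) ≈ D P ⊕ const (+ 12) ⊛ D φ
    DP′ = begin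
      const (+ 13) ⊛ (const (+ 13) ⊛ V (D P))     ≈⟨ ⊛-congˡ (D-V P) ⟨
      const (+ 13) ⊛ D P′                         ≈⟨ solveₛ v0 (con (+ 0) :* v1 :+ v0) refl (const (+ 13) ⊛ D P′ ∷ P′ ∷ []) ⟩
      0ₛ ⊛ P′ ⊕ const (+ 13) ⊛ D P′               ≈⟨ ⊕-congʳ (const (+ 13) ⊛ D P′) (⊛-congʳ (D-const (+ 13))) ⟨
      D (const (+ 13)) ⊛ P′ ⊕ const (+ 13) ⊛ D P′ ≈⟨ D-⊛ (const (+ 13)) P′ ⟨
      D (const (+ 13) ⊛ P′)                       ≈⟨ D-cong 13P′ ⟩
      D (P ⊕ const (+ 12) ⊛ φ)                    ≈⟨ D-⊕ P (const (+ 12) ⊛ φ) ⟩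
      D P ⊕ D (const (+ 12) ⊛ φ)                  ≈⟨ ⊕-congˡ (D P) (≈-trans (D-⊛ (const (+ 12)) φ) (⊕-congʳ (const (+ 12) ⊛ D φ) (⊛-congʳ (D-const (+ 12))))) ⟩
      D P ⊕ (0ₛ ⊛ φ ⊕ const (+ 12) ⊛ D φ)         ≈⟨ solveₛ (v0 :+ (con (+ 0) :* v1 :+ v2)) (v0 :+ v2) refl (D P ∷ φ ∷ const (+ 12) ⊛ D φ ∷ []) ⟩
      D P ⊕ const (+ 12) ⊛ D φ                    ∎
  dvar-sound (suc (suc zero)) = ≈-trans (solveₛ (con (+ 144) :* v0) (con (+ 48) :* (con (+ 3) :* v0)) refl (D Q ∷ [])) (⊛-congˡ D-Q)
  dvar-sound (suc (suc (suc zero))) = ≈-trans (solveₛ (con (+ 144) :* v0) (con (+ 72) :* (con (+ 2) :* v0)) refl (D R ∷ [])) (⊛-congˡ D-R)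
  dvar-sound (suc (suc (suc (suc zero)))) = begin
    const (+ 144) ⊛ D Q′                                     ≈⟨ ⊛-congˡ (D-V Q) ⟩
    const (+ 144) ⊛ (const (+ 13) ⊛ V (D Q))                 ≈⟨ solveₛ (con (+ 144) :* (con (+ 13) :* v0)) (con (+ 624) :* (con (+ 3) :* v0)) refl (V (D Q) ∷ []) ⟩
    const (+ 624) ⊛ (const (+ 3) ⊛ V (D Q))                  ≈⟨ ⊛-congˡ 3DQ′ ⟩
    const (+ 624) ⊛ (P′ ⊛ Q′ ⊕ ⊖ R′)                         ≈⟨ solveₛ (con (+ 624) :* (v0 :* v1 :- v2)) (con (+ 48) :* ((con (+ 13) :* v0) :* v1 :- con (+ 13) :* v2)) refl (P′ ∷ Q′ ∷ R′ ∷ []) ⟩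
    const (+ 48) ⊛ ((const (+ 13) ⊛ P′) ⊛ Q′ ⊕ ⊖ (const (+ 13) ⊛ R′))
      ≈⟨ ⊛-congˡ (⊕-congʳ (⊖ (const (+ 13) ⊛ R′)) (⊛-congʳ 13P′)) ⟩
    ⟦ dvar (suc (suc (suc (suc zero)))) ⟧ ρ                  ∎
  dvar-sound (suc (suc (suc (suc (suc zero))))) = begin
    const (+ 144) ⊛ D R′                                     ≈⟨ ⊛-congˡ (D-V R) ⟩
    const (+ 144) ⊛ (const (+ 13) ⊛ V (D R))                 ≈⟨ solveₛ (con (+ 144) :* (con (+ 13) :* v0)) (con (+ 936) :* (con (+ 2) :* v0)) refl (V (D R) ∷ []) ⟩
    const (+ 936) ⊛ (const (+ 2) ⊛ V (D R))                  ≈⟨ ⊛-congˡ 2DR′ ⟩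
    const (+ 936) ⊛ (P′ ⊛ R′ ⊕ ⊖ (Q′ ⊛ Q′))                  ≈⟨ solveₛ (con (+ 936) :* (v0 :* v1 :- v2 :* v2)) (con (+ 72) :* ((con (+ 13) :* v0) :* v1 :- con (+ 13) :* v2 :* v2)) refl (P′ ∷ R′ ∷ Q′ ∷ []) ⟩
    const (+ 72) ⊛ ((const (+ 13) ⊛ P′) ⊛ R′ ⊕ ⊖ (const (+ 13) ⊛ Q′ ⊛ Q′))
      ≈⟨ ⊛-congˡ (⊕-congʳ (⊖ (const (+ 13) ⊛ Q′ ⊛ Q′)) (⊛-congʳ 13P′)) ⟩
    ⟦ dvar (suc (suc (suc (suc (suc zero))))) ⟧ ρ            ∎
  dvar-sound (suc (suc (suc (suc (suc (suc zero)))))) = ≈-trans (⊛-congˡ D-u) (solveₛ (con (+ 144) :* (v0 :* v1)) (con (+ 144) :* v0 :* v1) refl (u ∷ φ ∷ []))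

open Level13

-- The four relations between Eisenstein series, φ and u, and their linear system.

module RelationIdeal where

  open SetoidReasoning (CommutativeRing.setoid seriesRing)

  -- For s = (η(τ)/η(13τ))² = 1/u one has j(13τ) = (s² + 5s + 13) A(s)³ / s and
  -- j(13τ) − 1728 = (s² + 6s + 13) B(s)² / s, while j(τ) is the same function of 13/s = 13u.
  -- Here lA, lB are A(13u), −B(13u) and lA*, lB* are u⁴ A(1/u), u⁶ B(1/u).
  lA lA* lB lB* l5 l6 : List ℤ
  lA  = + 1 ∷ + 247 ∷ + 3380 ∷ + 15379 ∷ + 28561 ∷ []
  lA* = + 1 ∷ + 7 ∷ + 20 ∷ + 19 ∷ + 1 ∷ []
  lB  = + 1 ∷ -[1+ 493 ] ∷ -[1+ 20617 ] ∷ -[1+ 237275 ] ∷ -[1+ 1313805 ] ∷ -[1+ 3712929 ] ∷ -[1+ 4826808 ] ∷ []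
  lB* = + 1 ∷ + 10 ∷ + 46 ∷ + 108 ∷ + 122 ∷ + 38 ∷ -[1+ 0 ] ∷ []
  l5  = + 1 ∷ + 5 ∷ + 13 ∷ []
  l6  = + 1 ∷ + 6 ∷ + 13 ∷ []

  private
    A° A* B° B* q₅ q₆ S K : ∀ {n} → Expr n → Expr n
    A° = poly lA
    A* = poly lA*
    B° = poly lB
    B* = poly lB*
    q₅ = poly l5
    q₆ = poly l6
    S t = q₅ t :* q₆ t
    K t = q₅ t :* S t

  -- From E₄ = (Dj)²/(j(j - 1728)) and E₆ = -(Dj)³/(j²(j - 1728)): for j a rational function of s
  -- one has Dj = -s (dj/ds) φ, since Ds/s = -φ. As j involves q₅A³ and j - 1728 involves q₆B², most
  -- factors cancel and the denominators q₅q₆ and q₅²q₆ are left, which are `S` and `K`.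
  relation : ∀ {n} → Fin 4 → (p f a b a′ b′ t : Expr n) → Expr n
  relation zero                   p f a b a′ b′ t = a :* S t :- f :^ 2 :* A° t
  relation (suc zero)             p f a b a′ b′ t = b :* K t :- f :^ 3 :* B° t
  relation (suc (suc zero))       p f a b a′ b′ t = a′ :* S t :- f :^ 2 :* A* t
  relation (suc (suc (suc zero))) p f a b a′ b′ t = b′ :* K t :- f :^ 3 :* B* t

  relationᵥ : Fin 4 → Expr 7
  relationᵥ i = relation i v0 v1 v2 v3 v4 v5 v6

  r : Fin 4 → Series
  r i = ⟦ relationᵥ i ⟧ ρ

  pattern i0 = zero
  pattern i1 = suc zero
  pattern i2 = suc (suc zero)
  pattern i3 = suc (suc (suc zero))

  -- u dS/du and u dK/du
  uS′ uK′ : Expr 7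
  uS′ = poly (+ 0 ∷ + 11 ∷ + 112 ∷ + 429 ∷ + 676 ∷ []) v6
  uK′ = v6 :* poly (+ 5 ∷ + 26 ∷ []) v6 :* S v6 :+ q₅ v6 :* uS′

  -- The ideal of the four relations is stable under D: this is the matrix of D on it, up to the factor K.
  factor : Fin 4 → Expr 7
  factor i0 = K v6
  factor i1 = K v6
  factor i2 = K v6
  factor i3 = K v6

  matrix : Fin 4 → Fin 4 → Expr 7
  matrix i0 i0 = con (+ 48) :* v0 :* K v6 :+ con (+ 2) :* v1 :* q₅ v6 :* (con (+ 72) :* uS′ :- A° v6)
  matrix i0 i1 = con -[1+ 47 ] :* S v6
  matrix i0 i2 = con (+ 338) :* A° v6 :* v1 :* q₅ v6
  matrix i0 i3 = con (+ 0)
  matrix i1 i0 = con -[1+ 71 ] :* q₅ v6 :^ 2 :* (v2 :* S v6 :+ v1 :^ 2 :* A° v6) :- con (+ 3) :* B° v6 :* v1 :^ 2 :* q₅ v6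
  matrix i1 i1 = con (+ 72) :* v0 :* K v6 :+ con (+ 144) :* v1 :* uK′
  matrix i1 i2 = con (+ 507) :* B° v6 :* v1 :^ 2 :* q₅ v6
  matrix i1 i3 = con (+ 0)
  matrix i2 i0 = con -[1+ 1 ] :* A* v6 :* v1 :* q₅ v6
  matrix i2 i1 = con (+ 0)
  matrix i2 i2 = con (+ 48) :* (v0 :+ con (+ 12) :* v1) :* K v6 :+ con (+ 2) :* v1 :* q₅ v6 :* (con (+ 72) :* uS′ :+ con (+ 169) :* A* v6)
  matrix i2 i3 = con -[1+ 623 ] :* S v6
  matrix i3 i0 = con -[1+ 2 ] :* B* v6 :* v1 :^ 2 :* q₅ v6
  matrix i3 i1 = con (+ 0)
  matrix i3 i2 = con -[1+ 935 ] :* q₅ v6 :^ 2 :* (v4 :* S v6 :+ v1 :^ 2 :* A* v6) :+ con (+ 507) :* B* v6 :* v1 :^ 2 :* q₅ v6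
  matrix i3 i3 = con (+ 72) :* (v0 :+ con (+ 12) :* v1) :* K v6 :+ con (+ 144) :* v1 :* uK′

  row : Fin 4 → Expr 7
  row i = matrix i i0 :* relationᵥ i0 :+ matrix i i1 :* relationᵥ i1 :+ matrix i i2 :* relationᵥ i2 :+ matrix i i3 :* relationᵥ i3

  ideal-stable : ∀ i → null (norm (factor i :* ∂ (relationᵥ i) :- row i)) ≡ true
  ideal-stable i0 = refl
  ideal-stable i1 = refl
  ideal-stable i2 = refl
  ideal-stable i3 = refl

  linear-system : ∀ i → ⟦ factor i ⟧ ρ ⊛ 144D (r i) ≈ ⟦ row i ⟧ ρ
  linear-system i = ≈-trans (⊛-congˡ (∂-sound dvar-sound (relationᵥ i))) (solveₛ (factor i :* ∂ (relationᵥ i)) (row i) (ideal-stable i) ρ)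

open RelationIdeal

-- Vanishing of the relations: initial coefficients and a recurrence.

module LevelRelations where

  nth : List ℤ → ℕ → ℤ
  nth []      n       = + 0
  nth (c ∷ p) zero    = c
  nth (c ∷ p) (suc n) = nth p n

  ⟦⟧ᵖ-X : ∀ (p : List ℤ) n → ⟦_⟧ᵖ {1} p (X ∷ []) n ≡ nth p n
  ⟦⟧ᵖ-X []      n       = const-0 n
  ⟦⟧ᵖ-X (c ∷ p) zero    = ℤₚ.+-identityʳ c
  ⟦⟧ᵖ-X (c ∷ p) (suc n) = trans (ℤₚ.+-identityˡ _) (trans (at (X-⊛ (⟦_⟧ᵖ {1} p (X ∷ []))) (suc n)) (⟦⟧ᵖ-X p n))

  ev-X : ∀ p n → ev p X n ≡ nth p n
  ev-X []      n       = const-0 n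
  ev-X (c ∷ p) zero    = ℤₚ.+-identityʳ c
  ev-X (c ∷ p) (suc n) = trans (ℤₚ.+-identityˡ _) (trans (at (X-⊛ (ev p X)) (suc n)) (ev-X p n))

  Agree : ℕ → Series → Series → Set
  Agree N f g = ∀ n → n ℕ.≤ N → f n ≡ g n

  Agree-⊛ : ∀ {N f f′ g g′} → Agree N f f′ → Agree N g g′ → Agree N (f ⊛ g) (f′ ⊛ g′)
  Agree-⊛ p q n n≤N = ⊛-local n (λ i i≤n → p i (ℕₚ.≤-trans i≤n n≤N)) (λ i i≤n → q i (ℕₚ.≤-trans i≤n n≤N))

  Agree-ev : ∀ {N} p {f g} → Agree N f g → Agree N (ev p f) (ev p g)
  Agree-ev []      eq n n≤N = refl
  Agree-ev (c ∷ p) eq n n≤N = cong (λ t → const c n ℤ.+ t) (Agree-⊛ eq (Agree-ev p eq) n n≤N)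

  Agree-⟦⟧ : ∀ {N m} (e : Expr m) {σ τ} → (∀ i → Agree N (lookup σ i) (lookup τ i)) → Agree N (⟦ e ⟧ σ) (⟦ e ⟧ τ)
  Agree-⟦⟧ (var i)    p = p i
  Agree-⟦⟧ (con c)    p n n≤N = refl
  Agree-⟦⟧ (e :+ e′)  p n n≤N = cong₂ ℤ._+_ (Agree-⟦⟧ e p n n≤N) (Agree-⟦⟧ e′ p n n≤N)
  Agree-⟦⟧ (e :- e′)  p n n≤N = cong₂ ℤ._-_ (Agree-⟦⟧ e p n n≤N) (Agree-⟦⟧ e′ p n n≤N)
  Agree-⟦⟧ (e :* e′)  p = Agree-⊛ (Agree-⟦⟧ e p) (Agree-⟦⟧ e′ p)
  Agree-⟦⟧ (:- e)     p n n≤N = cong ℤ.-_ (Agree-⟦⟧ e p n n≤N)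
  Agree-⟦⟧ {N} (e :^ k) {σ} {τ} p = go k
    where
    go : ∀ k → Agree N (⟦ e ⟧ σ ↑ k) (⟦ e ⟧ τ ↑ k)
    go zero    n n≤N = refl
    go (suc k) = Agree-⊛ (Agree-⟦⟧ e p) (go k)
  Agree-⟦⟧ (poly q e) p = Agree-ev q (Agree-⟦⟧ e p)

  matches : ℕ → Series → List ℤ → Bool
  matches zero    f l = true
  matches (suc N) f l = ⌊ f N ℤ.≟ nth l N ⌋ ∧ matches N f l

  matches-sound : ∀ N f l → matches N f l ≡ true → ∀ n → n ℕ.< N → f n ≡ nth l n
  matches-sound (suc N) f l eq n (ℕ.s≤s n≤N) with f N ℤ.≟ nth l N | matches N f l in rest
  matches-sound (suc N) f l eq n (ℕ.s≤s n≤N) | yes p | true with ℕₚ.m≤n⇒m<n∨m≡n n≤N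
  ... | inj₁ n<N  = matches-sound N f l rest n n<N
  ... | inj₂ refl = p

  -- Coefficients up to q¹³ of P, φ, Q, R, Q′, R′, u. They have to reach q¹³ because 13 is an
  -- exponent of the linear system at q = 0, where a non-zero solution could still begin.
  initial : Vec (List ℤ) 7
  initial = (+ 1 ∷ -[1+ 23 ] ∷ -[1+ 71 ] ∷ -[1+ 95 ] ∷ -[1+ 167 ] ∷ -[1+ 143 ] ∷ -[1+ 287 ] ∷ -[1+ 191 ] ∷ -[1+ 359 ] ∷ -[1+ 311 ] ∷ -[1+ 431 ] ∷ -[1+ 287 ] ∷ -[1+ 671 ] ∷ -[1+ 335 ] ∷ []) ∷ (+ 1 ∷ + 2 ∷ + 6 ∷ + 8 ∷ + 14 ∷ + 12 ∷ + 24 ∷ + 16 ∷ + 30 ∷ + 26 ∷ + 36 ∷ + 24 ∷ + 56 ∷ + 2 ∷ []) ∷ (+ 1 ∷ + 240 ∷ + 2160 ∷ + 6720 ∷ + 17520 ∷ + 30240 ∷ + 60480 ∷ + 82560 ∷ + 140400 ∷ + 181680 ∷ + 272160 ∷ + 319680 ∷ + 490560 ∷ + 527520 ∷ []) ∷ (+ 1 ∷ -[1+ 503 ] ∷ -[1+ 16631 ] ∷ -[1+ 122975 ] ∷ -[1+ 532727 ] ∷ -[1+ 1575503 ] ∷ -[1+ 4058207 ] ∷ -[1+ 8471231 ] ∷ -[1+ 17047799 ] ∷ -[1+ 29883671 ] ∷ -[1+ 51991631 ] ∷ -[1+ 81170207 ] ∷ -[1+ 129985631 ] ∷ -[1+ 187132175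 ] ∷ []) ∷ (+ 1 ∷ + 0 ∷ + 0 ∷ + 0 ∷ + 0 ∷ + 0 ∷ + 0 ∷ + 0 ∷ + 0 ∷ + 0 ∷ + 0 ∷ + 0 ∷ + 0 ∷ + 240 ∷ []) ∷ (+ 1 ∷ + 0 ∷ + 0 ∷ + 0 ∷ + 0 ∷ + 0 ∷ + 0 ∷ + 0 ∷ + 0 ∷ + 0 ∷ + 0 ∷ + 0 ∷ + 0 ∷ -[1+ 503 ] ∷ []) ∷ (+ 0 ∷ + 1 ∷ + 2 ∷ + 5 ∷ + 10 ∷ + 20 ∷ + 36 ∷ + 65 ∷ + 110 ∷ + 185 ∷ + 300 ∷ + 481 ∷ + 752 ∷ + 1165 ∷ []) ∷ []

  initial-correct : ∀ i → matches 14 (lookup ρ i) (lookup initial i) ≡ true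
  initial-correct zero = refl
  initial-correct (suc zero) = refl
  initial-correct (suc (suc zero)) = refl
  initial-correct (suc (suc (suc zero))) = refl
  initial-correct (suc (suc (suc (suc zero)))) = refl
  initial-correct (suc (suc (suc (suc (suc zero))))) = refl
  initial-correct (suc (suc (suc (suc (suc (suc zero)))))) = refl

  -- The relation evaluated on the truncated series, as a polynomial in q. Only its first 14
  -- coefficients carry information about `r i`.
  truncated : Fin 4 → List ℤ
  truncated i = norm (sub (relationᵥ i) (Vec.map (λ l → poly l v0) initial))

  zeros : ℕ → List ℤ → Bool
  zeros zero    l       = true
  zeros (suc N) []      = true
  zeros (suc N) (c ∷ l) = ⌊ c ℤ.≟ + 0 ⌋ ∧ zeros N l

  zeros-sound : ∀ N l → zeros N l ≡ true → ∀ n → n ℕ.< N → nth l n ≡ + 0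
  zeros-sound (suc N) []      eq n       lt = refl
  zeros-sound (suc N) (c ∷ l) eq n       lt with c ℤ.≟ + 0 | zeros N l in rest
  zeros-sound (suc N) (c ∷ l) eq zero    lt         | yes p | true = p
  zeros-sound (suc N) (c ∷ l) eq (suc n) (ℕ.s≤s lt) | yes p | true = zeros-sound N l rest n lt

  truncated-zero : ∀ i → zeros 14 (truncated i) ≡ true
  truncated-zero i0 = refl
  truncated-zero i1 = refl
  truncated-zero i2 = refl
  truncated-zero i3 = refl

  r-low : ∀ i n → n ℕ.< 14 → r i n ≡ + 0
  r-low i n (ℕ.s≤s n≤13) = trans
    (Agree-⟦⟧ (relationᵥ i) {ρ} {Vec.map (λ l → ev l X) initial} agree n n≤13)
    (trans (cong (λ f → f n) (sym (trans (S.sub-sound (relationᵥ i) (Vec.map (λ l → poly l v0) initial) (X ∷ []))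
                                          (cong ⟦ relationᵥ i ⟧ (sym (Vecₚ.map-∘ (λ t → ⟦ t ⟧ (X ∷ [])) (λ l → poly l v0) initial))))))
    (trans (sym (at (norm-sound (sub (relationᵥ i) (Vec.map (λ l → poly l v0) initial)) (X ∷ [])) n))
    (trans (⟦⟧ᵖ-X (truncated i) n) (zeros-sound 14 (truncated i) (truncated-zero i) n (ℕ.s≤s n≤13)))))
    where
    agree : ∀ i → Agree 13 (lookup ρ i) (lookup (Vec.map (λ l → ev l X) initial) i)
    agree i m m≤13 = trans (matches-sound 14 (lookup ρ i) (lookup initial i) (initial-correct i) m (ℕ.s≤s m≤13))
      (trans (sym (ev-X (lookup initial i) m)) (cong (λ f → f m) (sym (Vecₚ.lookup-map i (λ l → ev l X) initial))))

  -- At the first exponent where a solution might be non-zero, only the constant terms of the matrix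
  -- are felt. This reduces the system to four integer equations.
  leading : ∀ f n g → (∀ i → i ℕ.< n → g i ≡ + 0) → (f ⊛ g) n ≡ f 0 ℤ.* g n
  leading f zero    g p = refl
  leading f (suc n) g p = trans (⊛-suc-right f g n) (trans
    (cong (λ t → f (suc n) ℤ.* t ℤ.+ (f ⊛ shift g) n) (p 0 (ℕ.s≤s ℕ.z≤n)))
    (trans (cong (ℤ._+ (f ⊛ shift g) n) (ℤₚ.*-zeroʳ (f (suc n)))) (trans (ℤₚ.+-identityˡ _)
      (leading f n (shift g) λ i i<n → p (suc i) (ℕ.s≤s i<n)))))

  matrix₀ : Fin 4 → Fin 4 → ℤ
  matrix₀ i j = ⟦ matrix i j ⟧ ρ 0

  -- At q = 0 the system decouples along 2 r₁ − 3 r₀ and 2 r₃ − 3 r₂ with eigenvalues 1 and 13; the rest is nilpotent.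
  module _ (n : ℕ) (13<n : 13 ℕ.< n) (below : ∀ i m → m ℕ.< n → r i m ≡ + 0) where
    private
      N a b c d : ℤ
      N = + n
      a = r i0 n
      b = r i1 n
      c = r i2 n
      d = r i3 n

      equation : ∀ i → ⟦ factor i ⟧ ρ 0 ℤ.* (+ 144 ℤ.* (N ℤ.* r i n)) ≡
        matrix₀ i i0 ℤ.* a ℤ.+ matrix₀ i i1 ℤ.* b ℤ.+ matrix₀ i i2 ℤ.* c ℤ.+ matrix₀ i i3 ℤ.* d
      equation i = trans (sym (trans (leading (⟦ factor i ⟧ ρ) n (144D (r i)) λ m m<n → trans (at (const-⊛ (+ 144) (D (r i))) m)
          (trans (cong (λ t → + 144 ℤ.* (+ m ℤ.* t)) (below i m m<n)) (cong (+ 144 ℤ.*_) (ℤₚ.*-zeroʳ (+ m)))))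
          (cong (⟦ factor i ⟧ ρ 0 ℤ.*_) (at (const-⊛ (+ 144) (D (r i))) n))))
        (trans (at (linear-system i) n) (cong₂ ℤ._+_ (cong₂ ℤ._+_ (cong₂ ℤ._+_ (entry i0) (entry i1)) (entry i2)) (entry i3)))
        where
        entry : ∀ j → (⟦ matrix i j ⟧ ρ ⊛ r j) n ≡ matrix₀ i j ℤ.* r j n
        entry j = leading (⟦ matrix i j ⟧ ρ) n (r j) (below j)

      e0 : + 1 ℤ.* (+ 144 ℤ.* (N ℤ.* a)) ≡ + 46 ℤ.* a ℤ.+ -[1+ 47 ] ℤ.* b ℤ.+ + 338 ℤ.* c ℤ.+ + 0 ℤ.* d
      e0 = equation i0
      e1 : + 1 ℤ.* (+ 144 ℤ.* (N ℤ.* b)) ≡ -[1+ 146 ] ℤ.* a ℤ.+ + 72 ℤ.* b ℤ.+ + 507 ℤ.* c ℤ.+ + 0 ℤ.* d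
      e1 = equation i1
      e2 : + 1 ℤ.* (+ 144 ℤ.* (N ℤ.* c)) ≡ -[1+ 1 ] ℤ.* a ℤ.+ + 0 ℤ.* b ℤ.+ + 962 ℤ.* c ℤ.+ -[1+ 623 ] ℤ.* d
      e2 = equation i2
      e3 : + 1 ℤ.* (+ 144 ℤ.* (N ℤ.* d)) ≡ -[1+ 2 ] ℤ.* a ℤ.+ + 0 ℤ.* b ℤ.+ -[1+ 1364 ] ℤ.* c ℤ.+ + 936 ℤ.* d
      e3 = equation i3

      nonzero-product : ∀ {s t} → s ≢ + 0 → s ℤ.* t ≡ + 0 → t ≡ + 0
      nonzero-product {s} s≢0 eq with ℤₚ.i*j≡0⇒i≡0∨j≡0 s eq
      ... | inj₁ s≡0 = ⊥-elim (s≢0 s≡0)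
      ... | inj₂ t≡0 = t≡0

      N-minus : ∀ k → k ℕ.< n → N ℤ.- + k ≢ + 0
      N-minus k k<n eq = ℕₚ.<⇒≢ k<n (sym (ℤₚ.+-injective (ℤₚ.i-j≡0⇒i≡j N (+ k) eq)))

      diff : ∀ {s t} → s ≡ t → s ℤ.- t ≡ + 0
      diff = ℤₚ.i≡j⇒i-j≡0

      times-0 : ∀ k {s} → s ≡ + 0 → k ℤ.* s ≡ + 0
      times-0 k refl = ℤₚ.*-zeroʳ k

      2b-3a : + 2 ℤ.* b ℤ.- + 3 ℤ.* a ≡ + 0
      2b-3a = nonzero-product (N-minus 1 (ℕₚ.<-trans (ℕ.s≤s (ℕ.s≤s ℕ.z≤n)) 13<n)) (nonzero-product {+ 144} (λ ())
        (trans (combine N a b c d) (cong₂ (λ s t → + 2 ℤ.* s ℤ.- + 3 ℤ.* t) (diff e1) (diff e0))))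
        where
        combine : ∀ N a b c d → + 144 ℤ.* ((N ℤ.- + 1) ℤ.* (+ 2 ℤ.* b ℤ.- + 3 ℤ.* a)) ≡
          + 2 ℤ.* (+ 1 ℤ.* (+ 144 ℤ.* (N ℤ.* b)) ℤ.- (-[1+ 146 ] ℤ.* a ℤ.+ + 72 ℤ.* b ℤ.+ + 507 ℤ.* c ℤ.+ + 0 ℤ.* d)) ℤ.-
          + 3 ℤ.* (+ 1 ℤ.* (+ 144 ℤ.* (N ℤ.* a)) ℤ.- (+ 46 ℤ.* a ℤ.+ -[1+ 47 ] ℤ.* b ℤ.+ + 338 ℤ.* c ℤ.+ + 0 ℤ.* d))
        combine = solve-∀

      2d-3c : + 2 ℤ.* d ℤ.- + 3 ℤ.* c ≡ + 0
      2d-3c = nonzero-product (N-minus 13 13<n) (nonzero-product {+ 144} (λ ())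
        (trans (combine N a b c d) (cong₂ (λ s t → + 2 ℤ.* s ℤ.- + 3 ℤ.* t) (diff e3) (diff e2))))
        where
        combine : ∀ N a b c d → + 144 ℤ.* ((N ℤ.- + 13) ℤ.* (+ 2 ℤ.* d ℤ.- + 3 ℤ.* c)) ≡
          + 2 ℤ.* (+ 1 ℤ.* (+ 144 ℤ.* (N ℤ.* d)) ℤ.- (-[1+ 2 ] ℤ.* a ℤ.+ + 0 ℤ.* b ℤ.+ -[1+ 1364 ] ℤ.* c ℤ.+ + 936 ℤ.* d)) ℤ.-
          + 3 ℤ.* (+ 1 ℤ.* (+ 144 ℤ.* (N ℤ.* c)) ℤ.- (-[1+ 1 ] ℤ.* a ℤ.+ + 0 ℤ.* b ℤ.+ + 962 ℤ.* c ℤ.+ -[1+ 623 ] ℤ.* d))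
        combine = solve-∀

      N≢0 : N ≢ + 0
      N≢0 eq = N-minus 0 (ℕₚ.<-trans (ℕ.s≤s ℕ.z≤n) 13<n) (trans (ℤₚ.+-identityʳ N) eq)

      -- With 2b = 3a and 2d = 3c the equations read 144 N a = -26 (a - 13c) and 144 N c = -2 (a -
      -- 13c). The combination a - 13c is then annihilated by 144 N, which is the nilpotency.
      a-13c : a ℤ.- + 13 ℤ.* c ≡ + 0
      a-13c = nonzero-product N≢0 (nonzero-product {+ 144} (λ ()) (trans (combine N a b c d)
        (trans (cong₂ ℤ._+_ (cong₂ ℤ._+_ (diff e0) (times-0 -[1+ 23 ] 2b-3a)) (cong₂ ℤ._+_ (times-0 -[1+ 12 ] (diff e2)) (times-0 (+ 4056) 2d-3c))) refl)))
        where
        combine : ∀ N a b c d → + 144 ℤ.* (N ℤ.* (a ℤ.- + 13 ℤ.* c)) ≡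
          ((+ 1 ℤ.* (+ 144 ℤ.* (N ℤ.* a)) ℤ.- (+ 46 ℤ.* a ℤ.+ -[1+ 47 ] ℤ.* b ℤ.+ + 338 ℤ.* c ℤ.+ + 0 ℤ.* d)) ℤ.+ -[1+ 23 ] ℤ.* (+ 2 ℤ.* b ℤ.- + 3 ℤ.* a)) ℤ.+
          (-[1+ 12 ] ℤ.* (+ 1 ℤ.* (+ 144 ℤ.* (N ℤ.* c)) ℤ.- (-[1+ 1 ] ℤ.* a ℤ.+ + 0 ℤ.* b ℤ.+ + 962 ℤ.* c ℤ.+ -[1+ 623 ] ℤ.* d)) ℤ.+ + 4056 ℤ.* (+ 2 ℤ.* d ℤ.- + 3 ℤ.* c))
        combine = solve-∀

      c≡0 : c ≡ + 0
      c≡0 = nonzero-product N≢0 (nonzero-product {+ 144} (λ ()) (trans (combine N a b c d)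
        (trans (cong₂ ℤ._+_ (cong₂ ℤ._+_ (diff e2) (times-0 -[1+ 311 ] 2d-3c)) (times-0 -[1+ 1 ] a-13c)) refl)))
        where
        combine : ∀ N a b c d → + 144 ℤ.* (N ℤ.* c) ≡
          ((+ 1 ℤ.* (+ 144 ℤ.* (N ℤ.* c)) ℤ.- (-[1+ 1 ] ℤ.* a ℤ.+ + 0 ℤ.* b ℤ.+ + 962 ℤ.* c ℤ.+ -[1+ 623 ] ℤ.* d)) ℤ.+ -[1+ 311 ] ℤ.* (+ 2 ℤ.* d ℤ.- + 3 ℤ.* c)) ℤ.+
          -[1+ 1 ] ℤ.* (a ℤ.- + 13 ℤ.* c)
        combine = solve-∀

      double-0 : ∀ s t → t ≡ + 0 → + 2 ℤ.* s ℤ.- + 3 ℤ.* t ≡ + 0 → s ≡ + 0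
      double-0 s t refl eq = nonzero-product {+ 2} (λ ()) (trans (sym (ℤₚ.+-identityʳ _)) eq)

      a≡0 : a ≡ + 0
      a≡0 = trans (sym (ℤₚ.+-identityʳ a)) (trans (cong (λ t → a ℤ.- + 13 ℤ.* t) (sym c≡0)) a-13c)

    r-step : ∀ i → r i n ≡ + 0
    r-step i0 = a≡0
    r-step i1 = double-0 b a a≡0 2b-3a
    r-step i2 = c≡0
    r-step i3 = double-0 d c c≡0 2d-3c

  r-zero : ∀ i → r i ≈ 0ₛ
  r-zero i = mk λ n → trans (go (suc n) i n (ℕₚ.n<1+n n)) (sym (const-0 n))
    where
    go : ∀ N i m → m ℕ.< N → r i m ≡ + 0
    go (suc N) i m (ℕ.s≤s m≤N) with m ℕₚ.<? 14
    ... | yes lt = r-low i m lt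
    ... | no ≥14 = r-step m (ℕₚ.≮⇒≥ ≥14) (λ j k k<m → go N j k (ℕₚ.<-≤-trans k<m m≤N)) i

  S₁₃ K₁₃ : Series
  S₁₃ = ev l5 u ⊛ ev l6 u
  K₁₃ = ev l5 u ⊛ S₁₃

  Q-relation : Q ⊛ S₁₃ ≈ φ ↑ 2 ⊛ ev lA u
  Q-relation = minus-0 (r-zero i0)

  R-relation : R ⊛ K₁₃ ≈ φ ↑ 3 ⊛ ev lB u
  R-relation = minus-0 (r-zero i1)

  Q′-relation : Q′ ⊛ S₁₃ ≈ φ ↑ 2 ⊛ ev lA* u
  Q′-relation = minus-0 (r-zero i2)

  R′-relation : R′ ⊛ K₁₃ ≈ φ ↑ 3 ⊛ ev lB* u
  R′-relation = minus-0 (r-zero i3)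

open LevelRelations

-- The modular equation between u and x.

module ModularEquation where

  open SetoidReasoning (CommutativeRing.setoid seriesRing)

  -- The modular equation u¹³ = Σ Φₖ(x) uᵏ and the two halves of the equation
  -- Z u⁶ = x Σ αₖ(x) Z uᵏ + x Σ βₖ(x) uᵏ.
  Φ α β : List (List ℤ)
  Φ =
      (+ 0 ∷ + 1 ∷ [])
    ∷ (+ 0 ∷ + 26 ∷ + 13 ∷ [])
    ∷ (+ 0 ∷ + 325 ∷ + 338 ∷ + 169 ∷ [])
    ∷ (+ 0 ∷ + 2548 ∷ + 4225 ∷ + 4394 ∷ + 2197 ∷ [])
    ∷ (+ 0 ∷ + 13832 ∷ + 33124 ∷ + 54925 ∷ + 57122 ∷ + 28561 ∷ [])
    ∷ (+ 0 ∷ + 54340 ∷ + 179816 ∷ + 430612 ∷ + 714025 ∷ + 742586 ∷ + 371293 ∷ [])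
    ∷ (+ 0 ∷ + 157118 ∷ + 706420 ∷ + 2337608 ∷ + 5597956 ∷ + 9282325 ∷ + 9653618 ∷ + 4826809 ∷ [])
    ∷ (+ 0 ∷ + 333580 ∷ + 2042534 ∷ + 9183460 ∷ + 30388904 ∷ + 72773428 ∷ + 120670225 ∷ + 125497034 ∷ + 62748517 ∷ [])
    ∷ (+ 0 ∷ + 509366 ∷ + 4336540 ∷ + 26552942 ∷ + 119384980 ∷ + 395055752 ∷ + 946054564 ∷ + 1568712925 ∷ + 1631461442 ∷ + 815730721 ∷ [])
    ∷ (+ 0 ∷ + 534820 ∷ + 6621758 ∷ + 56375020 ∷ + 345188246 ∷ + 1552004740 ∷ + 5135724776 ∷ + 12298709332 ∷ + 20393268025 ∷ + 21208998746 ∷ + 10604499373 ∷ [])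
    ∷ (+ 0 ∷ + 354536 ∷ + 6952660 ∷ + 86082854 ∷ + 732875260 ∷ + 4487447198 ∷ + 20176061620 ∷ + 66764422088 ∷ + 159883221316 ∷ + 265112484325 ∷ + 275716983698 ∷ + 137858491849 ∷ [])
    ∷ (+ 0 ∷ + 124852 ∷ + 4608968 ∷ + 90384580 ∷ + 1119077102 ∷ + 9527378380 ∷ + 58336813574 ∷ + 262288801060 ∷ + 867937487144 ∷ + 2078481877108 ∷ + 3446462296225 ∷ + 3584320788074 ∷ + 1792160394037 ∷ [])
    ∷ (+ 0 ∷ + 15145 ∷ + 1623076 ∷ + 59916584 ∷ + 1174999540 ∷ + 14548002326 ∷ + 123855918940 ∷ + 758378576462 ∷ + 3409754413780 ∷ + 11283187332872 ∷ + 27020264402404 ∷ + 44804009850925 ∷ + 46596170244962 ∷ + 23298085122481 ∷ [])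
    ∷ []
  α =
      (-[1+ 12 ] ∷ [])
    ∷ (-[1+ 168 ] ∷ -[1+ 506 ] ∷ [])
    ∷ (-[1+ 961 ] ∷ -[1+ 6252 ] ∷ -[1+ 10984 ] ∷ [])
    ∷ (-[1+ 2885 ] ∷ -[1+ 31095 ] ∷ -[1+ 112046 ] ∷ -[1+ 142804 ] ∷ [])
    ∷ (-[1+ 4497 ] ∷ -[1+ 71317 ] ∷ -[1+ 404247 ] ∷ -[1+ 1056756 ] ∷ -[1+ 1113878 ] ∷ [])
    ∷ (-[1+ 2651 ] ∷ -[1+ 58473 ] ∷ -[1+ 487733 ] ∷ -[1+ 2113513 ] ∷ -[1+ 4826808 ] ∷ -[1+ 4826808 ] ∷ [])
    ∷ []
  β =
      (+ 1 ∷ [])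
    ∷ (+ 13 ∷ + 91 ∷ [])
    ∷ (+ 78 ∷ + 1183 ∷ + 2535 ∷ [])
    ∷ (+ 260 ∷ + 6422 ∷ + 28561 ∷ + 41743 ∷ [])
    ∷ (+ 494 ∷ + 17238 ∷ + 123032 ∷ + 371293 ∷ + 428415 ∷ [])
    ∷ (+ 468 ∷ + 21294 ∷ + 224094 ∷ + 1085318 ∷ + 2599051 ∷ + 2599051 ∷ [])
    ∷ (+ 143 ∷ + 6084 ∷ + 83486 ∷ + 571220 ∷ + 2227758 ∷ + 4826809 ∷ + 4826809 ∷ [])
    ∷ []

  -- rowsE p y x is Σ pₖ(x) yᵏ.
  modular-polynomial : Expr 2
  modular-polynomial = rowsE Φ v1 v0 :- v1 :^ 13

  by-multiples : ∀ {f g h k h′ k′} c c′ → f ⊕ ⊖ g ≈ c ⊛ (h ⊕ ⊖ k) ⊕ c′ ⊛ (h′ ⊕ ⊖ k′) → h ≈ k → h′ ≈ k′ → f ≈ g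
  by-multiples {f} {g} {h} {k} {h′} {k′} c c′ p h≈k h′≈k′ = minus-0 (begin
    f ⊕ ⊖ g                                  ≈⟨ p ⟩
    c ⊛ (h ⊕ ⊖ k) ⊕ c′ ⊛ (h′ ⊕ ⊖ k′)         ≈⟨ ⊕-cong (⊛-congˡ (0-minus h≈k)) (⊛-congˡ (0-minus h′≈k′)) ⟩
    c ⊛ 0ₛ ⊕ c′ ⊛ 0ₛ                          ≈⟨ solveₛ (v0 :* con (+ 0) :+ v1 :* con (+ 0)) (con (+ 0)) refl (c ∷ c′ ∷ []) ⟩
    0ₛ                                       ∎)

  private
    A° A* B° B* q₅ q₆ : ∀ {n} → Expr n → Expr n
    A° = poly lA
    A* = poly lA*
    B° = poly lB
    B* = poly lB*
    q₅ = poly l5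
    q₆ = poly l6

  Δ : Series
  Δ = Q ↑ 3 ⊕ ⊖ (R ↑ 2)

  -- The cube of the weight four relation and the square of the weight six relation share the factor
  -- φ⁶ and the denominator S³q₅ = K²q₆. Their difference therefore reduces to the polynomial
  -- identity in the last premise.
  discriminant : ∀ (a b A B : Series) k → a ⊛ S₁₃ ≈ φ ↑ 2 ⊛ A → b ⊛ K₁₃ ≈ φ ↑ 3 ⊛ B →
    A ↑ 3 ⊛ ev l5 u ⊕ ⊖ (B ↑ 2 ⊛ ev l6 u) ≈ k →
    S₁₃ ↑ 3 ⊛ ev l5 u ⊛ (a ↑ 3 ⊕ ⊖ (b ↑ 2)) ≈ φ ↑ 6 ⊛ k
  discriminant a b A B k p r eq = begin
    S₁₃ ↑ 3 ⊛ ev l5 u ⊛ (a ↑ 3 ⊕ ⊖ (b ↑ 2))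
      ≈⟨ solveₛ ((v0 :* v1) :^ 3 :* v0 :* (v2 :^ 3 :- v3 :^ 2)) (v0 :* (v2 :* (v0 :* v1)) :^ 3 :- v1 :* (v3 :* (v0 :* (v0 :* v1))) :^ 2) refl
           (ev l5 u ∷ ev l6 u ∷ a ∷ b ∷ []) ⟩
    ev l5 u ⊛ (a ⊛ S₁₃) ↑ 3 ⊕ ⊖ (ev l6 u ⊛ (b ⊛ K₁₃) ↑ 2)
      ≈⟨ ⊕-cong (⊛-congˡ (^-cong 3 p)) (⊖-cong (⊛-congˡ (^-cong 2 r))) ⟩
    ev l5 u ⊛ (φ ↑ 2 ⊛ A) ↑ 3 ⊕ ⊖ (ev l6 u ⊛ (φ ↑ 3 ⊛ B) ↑ 2)
      ≈⟨ solveₛ (v0 :* (v2 :^ 2 :* v3) :^ 3 :- v1 :* (v2 :^ 3 :* v4) :^ 2) (v2 :^ 6 :* (v3 :^ 3 :* v0 :- v4 :^ 2 :* v1)) refl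
           (ev l5 u ∷ ev l6 u ∷ φ ∷ A ∷ B ∷ []) ⟩
    φ ↑ 6 ⊛ (A ↑ 3 ⊛ ev l5 u ⊕ ⊖ (B ↑ 2 ⊛ ev l6 u))
      ≈⟨ ⊛-congˡ eq ⟩
    φ ↑ 6 ⊛ k ∎

  cubed : ∀ (a A : Series) → a ⊛ S₁₃ ≈ φ ↑ 2 ⊛ A → S₁₃ ↑ 3 ⊛ ev l5 u ⊛ a ↑ 3 ≈ φ ↑ 6 ⊛ (A ↑ 3 ⊛ ev l5 u)
  cubed a A p = begin
    S₁₃ ↑ 3 ⊛ ev l5 u ⊛ a ↑ 3         ≈⟨ solveₛ (v0 :^ 3 :* v1 :* v2 :^ 3) ((v2 :* v0) :^ 3 :* v1) refl (S₁₃ ∷ ev l5 u ∷ a ∷ []) ⟩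
    (a ⊛ S₁₃) ↑ 3 ⊛ ev l5 u           ≈⟨ ⊛-congʳ (^-cong 3 p) ⟩
    (φ ↑ 2 ⊛ A) ↑ 3 ⊛ ev l5 u         ≈⟨ solveₛ ((v0 :^ 2 :* v1) :^ 3 :* v2) (v0 :^ 6 :* (v1 :^ 3 :* v2)) refl (φ ∷ A ∷ ev l5 u ∷ []) ⟩
    φ ↑ 6 ⊛ (A ↑ 3 ⊛ ev l5 u)         ∎

  N₁₃ : Series
  N₁₃ = S₁₃ ↑ 3 ⊛ ev l5 u

  N₁₃-Δ : N₁₃ ⊛ Δ ≈ φ ↑ 6 ⊛ (const (+ 1728) ⊛ u)
  N₁₃-Δ = discriminant Q R (ev lA u) (ev lB u) (const (+ 1728) ⊛ u) Q-relation R-relation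
    (solveₛ (A° v0 :^ 3 :* q₅ v0 :- B° v0 :^ 2 :* q₆ v0) (con (+ 1728) :* v0) refl (u ∷ []))

  Δ′ : Series
  Δ′ = Q′ ↑ 3 ⊕ ⊖ (R′ ↑ 2)

  V-Δ : V Δ ≈ Δ′
  V-Δ = ≈-trans (V-⊕ (Q ↑ 3) (⊖ (R ↑ 2))) (⊕-cong (V-↑ Q 3) (≈-trans (V-⊖ (R ↑ 2)) (⊖-cong (V-↑ R 2))))

  N₁₃-Δ′ : N₁₃ ⊛ Δ′ ≈ φ ↑ 6 ⊛ (const (+ 1728) ⊛ u ↑ 13)
  N₁₃-Δ′ = discriminant Q′ R′ (ev lA* u) (ev lB* u) (const (+ 1728) ⊛ u ↑ 13) Q′-relation R′-relation
    (solveₛ (A* v0 :^ 3 :* q₅ v0 :- B* v0 :^ 2 :* q₆ v0) (con (+ 1728) :* v0 :^ 13) refl (u ∷ []))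

  -- j(s) = q₅ A³ / s at s = 13u and s = 1/u.
  j-invariant : ∀ a A y d → N₁₃ ⊛ a ↑ 3 ≈ φ ↑ 6 ⊛ (A ↑ 3 ⊛ ev l5 u) → N₁₃ ⊛ d ≈ φ ↑ 6 ⊛ (const (+ 1728) ⊛ y) →
    const (+ 1728) ⊛ y ⊛ a ↑ 3 ≈ d ⊛ (A ↑ 3 ⊛ ev l5 u)
  j-invariant a A y d p r = cancelˡ N₁₃ (λ ()) (by-multiples (const (+ 1728) ⊛ y) (⊖ (A ↑ 3 ⊛ ev l5 u))
    (solveₛ (v0 :* (v1 :* v2) :- v0 :* (v3 :* v4))
      (v1 :* (v0 :* v2 :- v5 :* v4) :+ (:- v4) :* (v0 :* v3 :- v5 :* v1)) refl
      (N₁₃ ∷ const (+ 1728) ⊛ y ∷ a ↑ 3 ∷ d ∷ A ↑ 3 ⊛ ev l5 u ∷ φ ↑ 6 ∷ [])) p r)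

  j₁ : const (+ 1728) ⊛ u ⊛ Q ↑ 3 ≈ Δ ⊛ (ev lA u ↑ 3 ⊛ ev l5 u)
  j₁ = j-invariant Q (ev lA u) u Δ (cubed Q (ev lA u) Q-relation) N₁₃-Δ

  j₁₃ : const (+ 1728) ⊛ u ↑ 13 ⊛ Q′ ↑ 3 ≈ Δ′ ⊛ (ev lA* u ↑ 3 ⊛ ev l5 u)
  j₁₃ = j-invariant Q′ (ev lA* u) (u ↑ 13) Δ′ (cubed Q′ (ev lA* u) Q′-relation) N₁₃-Δ′

  V-j₁ : const (+ 1728) ⊛ x ⊛ Q′ ↑ 3 ≈ Δ′ ⊛ (ev lA x ↑ 3 ⊛ ev l5 x)
  V-j₁ = begin
    const (+ 1728) ⊛ x ⊛ Q′ ↑ 3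
      ≈⟨ ⊛-cong (⊛-congʳ (V-const (+ 1728))) (V-↑ Q 3) ⟨
    V (const (+ 1728)) ⊛ V u ⊛ V (Q ↑ 3)
      ≈⟨ ≈-trans (V-⊛ (const (+ 1728) ⊛ u) (Q ↑ 3)) (⊛-congʳ (V-⊛ (const (+ 1728)) u)) ⟨
    V (const (+ 1728) ⊛ u ⊛ Q ↑ 3)
      ≈⟨ V-cong j₁ ⟩
    V (Δ ⊛ (ev lA u ↑ 3 ⊛ ev l5 u))
      ≈⟨ ≈-trans (V-⊛ Δ (ev lA u ↑ 3 ⊛ ev l5 u)) (⊛-cong V-Δ (≈-trans (V-⊛ (ev lA u ↑ 3) (ev l5 u))
           (⊛-cong (≈-trans (V-↑ (ev lA u) 3) (^-cong 3 (V-ev lA u))) (V-ev l5 u)))) ⟩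
    Δ′ ⊛ (ev lA x ↑ 3 ⊛ ev l5 x) ∎

  ũ : Series
  ũ = (V E ⊛ V E) ⊛ (G ⊛ G)

  u-factored : u ≈ X ⊛ ũ
  u-factored = ⊛-assoc X (V E ⊛ V E) (G ⊛ G)

  cancel-u : ∀ k {g h} → u ↑ k ⊛ g ≈ u ↑ k ⊛ h → g ≈ h
  cancel-u zero    p = ≈-trans (≈-sym (⊛-identityˡ _)) (≈-trans p (⊛-identityˡ _))
  cancel-u (suc k) {g} {h} p = cancel-u k (cancelˡ ũ (λ ()) (cancelˡ-X 1 (begin
    X ↑ 1 ⊛ (ũ ⊛ (u ↑ k ⊛ g))    ≈⟨ regroup g ⟩
    (X ⊛ ũ) ⊛ u ↑ k ⊛ g          ≈⟨ ⊛-congʳ (⊛-congʳ u-factored) ⟨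
    u ↑ suc k ⊛ g                ≈⟨ p ⟩
    u ↑ suc k ⊛ h                ≈⟨ ⊛-congʳ (⊛-congʳ u-factored) ⟩
    (X ⊛ ũ) ⊛ u ↑ k ⊛ h          ≈⟨ regroup h ⟨
    X ↑ 1 ⊛ (ũ ⊛ (u ↑ k ⊛ h))    ∎)))
    where
    regroup : ∀ g → X ↑ 1 ⊛ (ũ ⊛ (u ↑ k ⊛ g)) ≈ (X ⊛ ũ) ⊛ u ↑ k ⊛ g
    regroup g = solveₛ (v0 :^ 1 :* (v1 :* (v2 :* v3))) ((v0 :* v1) :* v2 :* v3) refl (X ∷ ũ ∷ u ↑ k ∷ g ∷ [])

  -- `j₁₃` and `V-j₁` give j(13τ) as one rational function of degree 14, taken at 1/u and at 13x.
  -- The comparison contains the trivial solution 1/u = 13x; its factor 1 - 13ux has constant term 1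
  -- and cancels, which lowers the degree to 13.
  modular-equation : ⟦ modular-polynomial ⟧ (x ∷ u ∷ []) ≈ 0ₛ
  modular-equation = cancelˡ (1ₛ ⊕ ⊖ (const (+ 13) ⊛ u ⊛ x)) (λ ()) (begin
    (1ₛ ⊕ ⊖ (const (+ 13) ⊛ u ⊛ x)) ⊛ ⟦ modular-polynomial ⟧ (x ∷ u ∷ [])
      ≈⟨ solveₛ ((con (+ 1) :- con (+ 13) :* v1 :* v0) :* modular-polynomial) (v0 :* (A* v1 :^ 3 :* q₅ v1) :- v1 :^ 13 :* (A° v0 :^ 3 :* q₅ v0)) refl (x ∷ u ∷ []) ⟩
    x ⊛ (ev lA* u ↑ 3 ⊛ ev l5 u) ⊕ ⊖ (u ↑ 13 ⊛ (ev lA x ↑ 3 ⊛ ev l5 x))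
      ≈⟨ F≈0 ⟩
    0ₛ
      ≈⟨ solveₛ (con (+ 0)) (v0 :* con (+ 0)) refl (_ ∷ []) ⟩
    (1ₛ ⊕ ⊖ (const (+ 13) ⊛ u ⊛ x)) ⊛ 0ₛ ∎)
    where
    F = x ⊛ (ev lA* u ↑ 3 ⊛ ev l5 u) ⊕ ⊖ (u ↑ 13 ⊛ (ev lA x ↑ 3 ⊛ ev l5 x))
    Δ′F≈0 : Δ′ ⊛ F ≈ 0ₛ
    Δ′F≈0 = by-multiples (⊖ x) (u ↑ 13)
      (solveₛ (v0 :* (v1 :* v2 :- v3 :* v4) :- con (+ 0))
        ((:- v1) :* (con (+ 1728) :* v3 :* v5 :- v0 :* v2) :+ v3 :* (con (+ 1728) :* v1 :* v5 :- v0 :* v4)) refl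
        (Δ′ ∷ x ∷ ev lA* u ↑ 3 ⊛ ev l5 u ∷ u ↑ 13 ∷ ev lA x ↑ 3 ⊛ ev l5 x ∷ Q′ ↑ 3 ∷ [])) j₁₃ V-j₁
    F≈0 : F ≈ 0ₛ
    F≈0 = cancel-0 (φ ↑ 6 ⊛ const (+ 1728)) F (λ ()) (cancel-u 13 (begin
      u ↑ 13 ⊛ (φ ↑ 6 ⊛ const (+ 1728) ⊛ F)     ≈⟨ solveₛ (v0 :* (v1 :* con (+ 1728) :* v2)) (v1 :* (con (+ 1728) :* v0) :* v2) refl (u ↑ 13 ∷ φ ↑ 6 ∷ F ∷ []) ⟩
      φ ↑ 6 ⊛ (const (+ 1728) ⊛ u ↑ 13) ⊛ F     ≈⟨ ⊛-congʳ N₁₃-Δ′ ⟨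
      N₁₃ ⊛ Δ′ ⊛ F                              ≈⟨ ⊛-assoc N₁₃ Δ′ F ⟩
      N₁₃ ⊛ (Δ′ ⊛ F)                            ≈⟨ ⊛-congˡ Δ′F≈0 ⟩
      N₁₃ ⊛ 0ₛ                                  ≈⟨ solveₛ (v0 :* con (+ 0)) (v1 :* con (+ 0)) refl (N₁₃ ∷ u ↑ 13 ∷ []) ⟩
      u ↑ 13 ⊛ 0ₛ                               ∎))

open ModularEquation

-- The equation for Z, and the form W under U.

module WeightSix where

  open SetoidReasoning (CommutativeRing.setoid seriesRing)

  VE-VG : V E ⊛ V G ≈ 1ₛ
  VE-VG = ≈-trans (≈-sym (V-⊛ E G)) (≈-trans (V-cong (≈-trans (⊛-comm E G) G-E)) (V-const (+ 1)))

  V-X : V X ≈ X ↑ 13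
  V-X = ≈-trans (mk go) (≈-sym X↑13)
    where
    q13 : Series
    q13 = qs (qs (qs (qs (qs (qs (qs (qs (qs (qs (qs (qs (qs 1ₛ))))))))))))
    go : ∀ n → V X n ≡ q13 n
    go 0 = refl
    go 1 = refl
    go 2 = refl
    go 3 = refl
    go 4 = refl
    go 5 = refl
    go 6 = refl
    go 7 = refl
    go 8 = refl
    go 9 = refl
    go 10 = refl
    go 11 = refl
    go 12 = refl
    go (suc (suc (suc (suc (suc (suc (suc (suc (suc (suc (suc (suc (suc n))))))))))))) =
      trans (at (V-cong {shift X} {1ₛ} (mk λ _ → refl)) n) (at (V-const (+ 1)) n)
    step : ∀ {f g} → f ≈ g → X ⊛ f ≈ qs g
    step {f} p = ≈-trans (X-⊛ f) (qs-cong p)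
    X↑13 : X ↑ 13 ≈ q13
    X↑13 = step (step (step (step (step (step (step (step (step (step (step (step (step ≈-refl))))))))))))

  x̃ : Series
  x̃ = V ũ

  x-factored : x ≈ X ↑ 13 ⊛ x̃
  x-factored = ≈-trans (V-cong u-factored) (≈-trans (V-⊛ X ũ) (⊛-congʳ V-X))

  Z̃ : Series
  Z̃ = V (V E) ⊛ G

  Z-factored : Z ≈ X ↑ 7 ⊛ Z̃
  Z-factored = ⊛-assoc (X ↑ 7) (V (V E)) G

  Vũ : V ũ ≈ (V (V E) ⊛ V (V E)) ⊛ (V G ⊛ V G)
  Vũ = ≈-trans (V-⊛ (V E ⊛ V E) (G ⊛ G)) (⊛-cong (V-⊛ (V E) (V E)) (V-⊛ G G))

  Z² : Z ⊛ Z ≈ u ⊛ x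
  Z² = begin
    Z ⊛ Z
      ≈⟨ ⊛-cong Z-factored Z-factored ⟩
    (X ↑ 7 ⊛ (V (V E) ⊛ G)) ⊛ (X ↑ 7 ⊛ (V (V E) ⊛ G))
      ≈⟨ solveₛ ((v0 :^ 7 :* (v1 :* v2)) :* (v0 :^ 7 :* (v1 :* v2))) (v0 :* (con (+ 1) :* con (+ 1)) :* (v2 :* v2) :* (v0 :^ 13 :* (v1 :* v1))) refl (X ∷ V (V E) ∷ G ∷ []) ⟩
    X ⊛ (1ₛ ⊛ 1ₛ) ⊛ (G ⊛ G) ⊛ (X ↑ 13 ⊛ (V (V E) ⊛ V (V E)))
      ≈⟨ ⊛-congʳ (⊛-congʳ (⊛-congˡ (⊛-cong VE-VG VE-VG))) ⟨
    X ⊛ ((V E ⊛ V G) ⊛ (V E ⊛ V G)) ⊛ (G ⊛ G) ⊛ (X ↑ 13 ⊛ (V (V E) ⊛ V (V E)))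
      ≈⟨ solveₛ (v0 :* ((v1 :* v2) :* (v1 :* v2)) :* (v3 :* v3) :* (v5 :* (v4 :* v4)))
                ((v0 :* (v1 :* v1) :* (v3 :* v3)) :* (v5 :* ((v4 :* v4) :* (v2 :* v2)))) refl
                (X ∷ V E ∷ V G ∷ G ∷ V (V E) ∷ X ↑ 13 ∷ []) ⟩
    u ⊛ (X ↑ 13 ⊛ ((V (V E) ⊛ V (V E)) ⊛ (V G ⊛ V G)))
      ≈⟨ ⊛-congˡ (≈-trans x-factored (⊛-congˡ Vũ)) ⟨
    u ⊛ x ∎

  -- Z den = num: together with Z² = u x, its square is the modular equation.
  denE numE : ∀ {n} → Expr n → Expr n → Expr n
  denE x u = u :^ 6 :- x :* rowsE α u x
  numE x u = x :* rowsE β u x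

  den num : Series
  den = ⟦ denE v0 v1 ⟧ (x ∷ u ∷ [])
  num = ⟦ numE v0 v1 ⟧ (x ∷ u ∷ [])

  -- The product of Z den - num and Z den + num vanishes. The sign is decided at q¹³, where Z u⁶ and
  -- x both begin with coefficient 1: the sum begins with 2q¹³ and can be cancelled.
  Z-den≈num : Z ⊛ den ≈ num
  Z-den≈num = minus-0 (cancel-0 d⁺ d⁻ (λ ()) (cancelˡ-X 13 (begin
    X ↑ 13 ⊛ (d⁺ ⊛ d⁻)                    ≈⟨ ⊛-assoc (X ↑ 13) d⁺ d⁻ ⟨
    X ↑ 13 ⊛ d⁺ ⊛ d⁻                      ≈⟨ ⊛-congʳ plus ⟨
    (Z ⊛ den ⊕ num) ⊛ d⁻                      ≈⟨ solveₛ ((v0 :* v1 :+ v2) :* (v0 :* v1 :- v2)) ((v0 :* v0) :* (v1 :* v1) :- v2 :* v2) refl (Z ∷ den ∷ num ∷ []) ⟩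
    (Z ⊛ Z) ⊛ (den ⊛ den) ⊕ ⊖ (num ⊛ num)         ≈⟨ ⊕-congʳ (⊖ (num ⊛ num)) (⊛-congʳ Z²) ⟩
    (u ⊛ x) ⊛ (den ⊛ den) ⊕ ⊖ (num ⊛ num)         ≈⟨ solveₛ ((v1 :* v0) :* (denE v0 v1 :* denE v0 v1) :- numE v0 v1 :* numE v0 v1) (:- v0 :* modular-polynomial) refl (x ∷ u ∷ []) ⟩
    ⊖ x ⊛ ⟦ modular-polynomial ⟧ (x ∷ u ∷ [])   ≈⟨ ⊛-congˡ modular-equation ⟩
    ⊖ x ⊛ 0ₛ                              ≈⟨ solveₛ (:- v0 :* con (+ 0)) (v1 :* con (+ 0)) refl (x ∷ X ↑ 13 ∷ []) ⟩
    X ↑ 13 ⊛ 0ₛ                           ∎)))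
    where
    d⁻ d⁺ α′ β′ : Series
    d⁻ = Z ⊛ den ⊕ ⊖ num
    α′ = ⟦ rowsE α v1 v0 ⟧ (x ∷ u ∷ [])
    β′ = ⟦ rowsE β v1 v0 ⟧ (x ∷ u ∷ [])
    d⁺ = Z̃ ⊛ ũ ↑ 6 ⊕ x̃ ⊛ (β′ ⊕ ⊖ (Z ⊛ α′))
    plus : Z ⊛ den ⊕ num ≈ X ↑ 13 ⊛ d⁺
    plus = begin
      Z ⊛ (u ↑ 6 ⊕ ⊖ (x ⊛ α′)) ⊕ x ⊛ β′
        ≈⟨ solveₛ (v0 :* (v1 :^ 6 :- v2 :* v3) :+ v2 :* v4) (v0 :* v1 :^ 6 :+ v2 :* (v4 :- v0 :* v3)) refl (Z ∷ u ∷ x ∷ α′ ∷ β′ ∷ []) ⟩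
      Z ⊛ u ↑ 6 ⊕ x ⊛ (β′ ⊕ ⊖ (Z ⊛ α′))
        ≈⟨ ⊕-cong (⊛-cong Z-factored (^-cong 6 u-factored)) (⊛-congʳ x-factored) ⟩
      (X ↑ 7 ⊛ Z̃) ⊛ (X ⊛ ũ) ↑ 6 ⊕ (X ↑ 13 ⊛ x̃) ⊛ (β′ ⊕ ⊖ (Z ⊛ α′))
        ≈⟨ solveₛ ((v0 :^ 7 :* v1) :* (v0 :* v2) :^ 6 :+ (v0 :^ 13 :* v3) :* v4) (v0 :^ 13 :* (v1 :* v2 :^ 6 :+ v3 :* v4)) refl
             (X ∷ Z̃ ∷ ũ ∷ x̃ ∷ β′ ⊕ ⊖ (Z ⊛ α′) ∷ []) ⟩
      X ↑ 13 ⊛ d⁺ ∎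

  -- The weight six form W with R = W B(13u), R′ = W B*(u).

  W : Series
  W = φ ↑ 3 ⊛ inv K₁₃

  W-K : W ⊛ K₁₃ ≈ φ ↑ 3
  W-K = begin
    φ ↑ 3 ⊛ inv K₁₃ ⊛ K₁₃      ≈⟨ solveₛ (v0 :* v1 :* v2) (v0 :* (v2 :* v1)) refl (φ ↑ 3 ∷ inv K₁₃ ∷ K₁₃ ∷ []) ⟩
    φ ↑ 3 ⊛ (K₁₃ ⊛ inv K₁₃)    ≈⟨ ⊛-congˡ (⊛-inv K₁₃ refl) ⟩
    φ ↑ 3 ⊛ 1ₛ                 ≈⟨ ⊛-identityʳ (φ ↑ 3) ⟩
    φ ↑ 3                      ∎

  divide-by-K : ∀ f B → f ⊛ K₁₃ ≈ φ ↑ 3 ⊛ B → f ≈ W ⊛ B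
  divide-by-K f B p = cancelˡ K₁₃ (λ ()) (begin
    K₁₃ ⊛ f             ≈⟨ ⊛-comm K₁₃ f ⟩
    f ⊛ K₁₃             ≈⟨ p ⟩
    φ ↑ 3 ⊛ B           ≈⟨ ⊛-congʳ W-K ⟨
    W ⊛ K₁₃ ⊛ B         ≈⟨ solveₛ (v0 :* v1 :* v2) (v1 :* (v0 :* v2)) refl (W ∷ K₁₃ ∷ B ∷ []) ⟩
    K₁₃ ⊛ (W ⊛ B)       ∎)

  R≈WB : R ≈ W ⊛ ev lB u
  R≈WB = divide-by-K R (ev lB u) R-relation

  R′≈WB : R′ ≈ W ⊛ ev lB* u
  R′≈WB = divide-by-K R′ (ev lB* u) R′-relation

  -- Since W K = φ³ and K²q₆ = S³q₅, the factor φ⁶ is absorbed by W². For d = Δ this says Δ = 1728 u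
  -- W²/q₆.
  discriminant-W : ∀ d y → N₁₃ ⊛ d ≈ φ ↑ 6 ⊛ (const (+ 1728) ⊛ y) → d ⊛ ev l6 u ≈ const (+ 1728) ⊛ y ⊛ (W ⊛ W)
  discriminant-W d y p = cancelˡ N₁₃ (λ ()) (begin
    N₁₃ ⊛ (d ⊛ ev l6 u)                                  ≈⟨ ⊛-assoc N₁₃ d (ev l6 u) ⟨
    N₁₃ ⊛ d ⊛ ev l6 u                                    ≈⟨ ⊛-congʳ p ⟩
    φ ↑ 6 ⊛ (const (+ 1728) ⊛ y) ⊛ ev l6 u               ≈⟨ solveₛ (v0 :^ 6 :* v1 :* v2) (v2 :* (v0 :^ 3) :^ 2 :* v1) refl (φ ∷ const (+ 1728) ⊛ y ∷ ev l6 u ∷ []) ⟩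
    ev l6 u ⊛ (φ ↑ 3) ↑ 2 ⊛ (const (+ 1728) ⊛ y)         ≈⟨ ⊛-congʳ (⊛-congˡ (^-cong 2 W-K)) ⟨
    ev l6 u ⊛ (W ⊛ K₁₃) ↑ 2 ⊛ (const (+ 1728) ⊛ y)       ≈⟨ solveₛ (v1 :* (v2 :* (v0 :* (v0 :* v1))) :^ 2 :* v3) ((v0 :* v1) :^ 3 :* v0 :* (v3 :* (v2 :* v2))) refl
                                                              (ev l5 u ∷ ev l6 u ∷ W ∷ const (+ 1728) ⊛ y ∷ []) ⟩
    N₁₃ ⊛ (const (+ 1728) ⊛ y ⊛ (W ⊛ W))                 ∎)

  -- W = V(Δ / R) h B* q₆ with h = x / u¹³.
  U-W : ∀ h f → u ↑ 13 ⊛ h ≈ x → ev lB u ⊛ ev l6 u ⊛ U (W ⊛ f) ≈ W ⊛ U (ev l6 u ⊛ ev lB* u ⊛ (h ⊛ f))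
  U-W h f hx = cancelˡ (const (+ 1728) ⊛ W) (λ ()) (cancel-u 1 (begin
    -- The extra factor 1728 u W completes `ev lB u` to R · 1728 u, which enters U as the series V
    -- (R · 1728 u). There it supplies a second W, and W² turns into V Δ, which leaves U again.
    u ↑ 1 ⊛ (const (+ 1728) ⊛ W ⊛ (ev lB u ⊛ ev l6 u ⊛ U (W ⊛ f)))
      ≈⟨ solveₛ (v0 :^ 1 :* (con (+ 1728) :* v1 :* (v2 :* v3 :* v4))) (v3 :* ((v1 :* v2) :* (con (+ 1728) :* v0) :* v4)) refl (u ∷ W ∷ ev lB u ∷ ev l6 u ∷ U (W ⊛ f) ∷ []) ⟩
    ev l6 u ⊛ ((W ⊛ ev lB u) ⊛ (const (+ 1728) ⊛ u) ⊛ U (W ⊛ f))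
      ≈⟨ ⊛-congˡ (⊛-congʳ (⊛-congʳ R≈WB)) ⟨
    ev l6 u ⊛ (R ⊛ (const (+ 1728) ⊛ u) ⊛ U (W ⊛ f))
      ≈⟨ ⊛-congˡ (U-V (R ⊛ (const (+ 1728) ⊛ u)) (W ⊛ f)) ⟨
    ev l6 u ⊛ U (V (R ⊛ (const (+ 1728) ⊛ u)) ⊛ (W ⊛ f))
      ≈⟨ ⊛-congˡ (U-cong inner) ⟩
    ev l6 u ⊛ U (V Δ ⊛ (ev l6 u ⊛ ev lB* u ⊛ (h ⊛ f)))
      ≈⟨ ⊛-congˡ (U-V Δ _) ⟩
    ev l6 u ⊛ (Δ ⊛ U (ev l6 u ⊛ ev lB* u ⊛ (h ⊛ f)))
      ≈⟨ solveₛ (v0 :* (v1 :* v2)) ((v1 :* v0) :* v2) refl (ev l6 u ∷ Δ ∷ U (ev l6 u ⊛ ev lB* u ⊛ (h ⊛ f)) ∷ []) ⟩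
    (Δ ⊛ ev l6 u) ⊛ U (ev l6 u ⊛ ev lB* u ⊛ (h ⊛ f))
      ≈⟨ ⊛-congʳ (discriminant-W Δ u N₁₃-Δ) ⟩
    (const (+ 1728) ⊛ u ⊛ (W ⊛ W)) ⊛ U (ev l6 u ⊛ ev lB* u ⊛ (h ⊛ f))
      ≈⟨ solveₛ ((con (+ 1728) :* v0 :* (v1 :* v1)) :* v2) (v0 :^ 1 :* (con (+ 1728) :* v1 :* (v1 :* v2))) refl (u ∷ W ∷ U (ev l6 u ⊛ ev lB* u ⊛ (h ⊛ f)) ∷ []) ⟩
    u ↑ 1 ⊛ (const (+ 1728) ⊛ W ⊛ (W ⊛ U (ev l6 u ⊛ ev lB* u ⊛ (h ⊛ f)))) ∎))
    where
    inner : V (R ⊛ (const (+ 1728) ⊛ u)) ⊛ (W ⊛ f) ≈ V Δ ⊛ (ev l6 u ⊛ ev lB* u ⊛ (h ⊛ f))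
    inner = cancel-u 13 (begin
      u ↑ 13 ⊛ (V (R ⊛ (const (+ 1728) ⊛ u)) ⊛ (W ⊛ f))
        ≈⟨ ⊛-congˡ (⊛-congʳ (≈-trans (V-⊛ R (const (+ 1728) ⊛ u)) (⊛-cong R′≈WB (≈-trans (V-⊛ (const (+ 1728)) u) (⊛-congʳ (V-const (+ 1728))))))) ⟩
      u ↑ 13 ⊛ ((W ⊛ ev lB* u) ⊛ (const (+ 1728) ⊛ x) ⊛ (W ⊛ f))
        ≈⟨ solveₛ (v0 :* ((v1 :* v2) :* (con (+ 1728) :* v3) :* (v1 :* v4))) ((con (+ 1728) :* v0 :* (v1 :* v1)) :* (v2 :* v4 :* v3)) refl
             (u ↑ 13 ∷ W ∷ ev lB* u ∷ x ∷ f ∷ []) ⟩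
      (const (+ 1728) ⊛ u ↑ 13 ⊛ (W ⊛ W)) ⊛ (ev lB* u ⊛ f ⊛ x)
        ≈⟨ ⊛-cong (discriminant-W Δ′ (u ↑ 13) N₁₃-Δ′) (⊛-congˡ hx) ⟨
      (Δ′ ⊛ ev l6 u) ⊛ (ev lB* u ⊛ f ⊛ (u ↑ 13 ⊛ h))
        ≈⟨ solveₛ ((v5 :* v1) :* (v2 :* v3 :* (v0 :* v4))) (v0 :* (v5 :* (v1 :* v2 :* (v4 :* v3)))) refl
             (u ↑ 13 ∷ ev l6 u ∷ ev lB* u ∷ f ∷ h ∷ Δ′ ∷ []) ⟩
      u ↑ 13 ⊛ (Δ′ ⊛ (ev l6 u ⊛ ev lB* u ⊛ (h ⊛ f)))
        ≈⟨ ⊛-congˡ (⊛-congʳ V-Δ) ⟨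
      u ↑ 13 ⊛ (V Δ ⊛ (ev l6 u ⊛ ev lB* u ⊛ (h ⊛ f))) ∎)

open WeightSix

-- Arithmetic in the ℤ[x]-module spanned by 1, u, ..., u⁶, Z, Zu, ..., Zu⁵.

module Elements where

  open SetoidReasoning (CommutativeRing.setoid seriesRing)

  ev-as-⟦⟧ᵖ : ∀ p y → ev p y ≈ ⟦_⟧ᵖ {1} p (y ∷ [])
  ev-as-⟦⟧ᵖ []      y = ≈-refl
  ev-as-⟦⟧ᵖ (c ∷ p) y = ⊕-congˡ (const c) (⊛-congˡ (ev-as-⟦⟧ᵖ p y))

  ev-+ : ∀ (p q : List ℤ) y → ev (_+ᵖ_ {1} p q) y ≈ ev p y ⊕ ev q y
  ev-+ p q y = ≈-trans (ev-as-⟦⟧ᵖ (_+ᵖ_ {1} p q) y) (≈-trans (S.+-sound {1} p q (y ∷ [])) (≈-sym (⊕-cong (ev-as-⟦⟧ᵖ p y) (ev-as-⟦⟧ᵖ q y))))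

  ev-* : ∀ (p q : List ℤ) y → ev (_*ᵖ_ {1} p q) y ≈ ev p y ⊛ ev q y
  ev-* p q y = ≈-trans (ev-as-⟦⟧ᵖ (_*ᵖ_ {1} p q) y) (≈-trans (S.*-sound {1} p q (y ∷ [])) (≈-sym (⊛-cong (ev-as-⟦⟧ᵖ p y) (ev-as-⟦⟧ᵖ q y))))

  Pol : Set
  Pol = List ℤ

  infixl 6 _+ₚ_
  infixl 7 _*ₚ_
  _+ₚ_ _*ₚ_ : Pol → Pol → Pol
  _+ₚ_ = _+ᵖ_ {1}
  _*ₚ_ = _*ᵖ_ {1}

  -- Σ pₖ(x) uᵏ
  rows : ∀ {n} → Vec Pol n → Series
  rows []      = 0ₛ
  rows (p ∷ v) = ev p x ⊕ u ⊛ rows v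

  -- (e , o) stands for Σ eₖ(x) uᵏ + Z Σ oₖ(x) uᵏ.
  Elem : Set
  Elem = Vec Pol 7 × Vec Pol 6

  ⟪_⟫ₑ : Elem → Series
  ⟪ e , o ⟫ₑ = rows e ⊕ Z ⊛ rows o

  rows-+ : ∀ {n} (v w : Vec Pol n) → rows (Vec.zipWith _+ₚ_ v w) ≈ rows v ⊕ rows w
  rows-+ []      []      = solveₛ (con (+ 0)) (con (+ 0) :+ con (+ 0)) refl []
  rows-+ (p ∷ v) (q ∷ w) = ≈-trans (⊕-cong (ev-+ p q x) (⊛-congˡ (rows-+ v w)))
    (solveₛ ((v0 :+ v1) :+ v2 :* (v3 :+ v4)) ((v0 :+ v2 :* v3) :+ (v1 :+ v2 :* v4)) refl (ev p x ∷ ev q x ∷ u ∷ rows v ∷ rows w ∷ []))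

  rows-* : ∀ {n} p (v : Vec Pol n) → rows (Vec.map (p *ₚ_) v) ≈ ev p x ⊛ rows v
  rows-* p []      = solveₛ (con (+ 0)) (v0 :* con (+ 0)) refl (ev p x ∷ [])
  rows-* p (q ∷ v) = ≈-trans (⊕-cong (ev-* p q x) (⊛-congˡ (rows-* p v)))
    (solveₛ (v0 :* v1 :+ v2 :* (v0 :* v3)) (v0 :* (v1 :+ v2 :* v3)) refl (ev p x ∷ ev q x ∷ u ∷ rows v ∷ []))

  times-x : ∀ {n} → Vec Pol n → Vec Pol n
  times-x = Vec.map (+ 0 ∷_)

  rows-x : ∀ {n} (v : Vec Pol n) → rows (times-x v) ≈ x ⊛ rows v
  rows-x []      = solveₛ (con (+ 0)) (v0 :* con (+ 0)) refl (x ∷ [])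
  rows-x (p ∷ v) = ≈-trans (⊕-congˡ (ev (+ 0 ∷ p) x) (⊛-congˡ (rows-x v)))
    (solveₛ ((con (+ 0) :+ v0 :* v1) :+ v2 :* (v0 :* v3)) (v0 :* (v1 :+ v2 :* v3)) refl (x ∷ ev p x ∷ u ∷ rows v ∷ []))

  infixl 6 _+ₑ_
  _+ₑ_ : Elem → Elem → Elem
  (e , o) +ₑ (e′ , o′) = Vec.zipWith _+ₚ_ e e′ , Vec.zipWith _+ₚ_ o o′

  +ₑ-sound : ∀ v w → ⟪ v +ₑ w ⟫ₑ ≈ ⟪ v ⟫ₑ ⊕ ⟪ w ⟫ₑ
  +ₑ-sound (e , o) (e′ , o′) = ≈-trans (⊕-cong (rows-+ e e′) (⊛-congˡ (rows-+ o o′)))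
    (solveₛ ((v0 :+ v1) :+ v2 :* (v3 :+ v4)) ((v0 :+ v2 :* v3) :+ (v1 :+ v2 :* v4)) refl (rows e ∷ rows e′ ∷ Z ∷ rows o ∷ rows o′ ∷ []))

  infixr 7 _*ₑ_
  _*ₑ_ : Pol → Elem → Elem
  p *ₑ (e , o) = Vec.map (p *ₚ_) e , Vec.map (p *ₚ_) o

  *ₑ-sound : ∀ p v → ⟪ p *ₑ v ⟫ₑ ≈ ev p x ⊛ ⟪ v ⟫ₑ
  *ₑ-sound p (e , o) = ≈-trans (⊕-cong (rows-* p e) (⊛-congˡ (rows-* p o)))
    (solveₛ (v0 :* v1 :+ v2 :* (v0 :* v3)) (v0 :* (v1 :+ v2 :* v3)) refl (ev p x ∷ rows e ∷ Z ∷ rows o ∷ []))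

  first : {A : Set} → Vec A 7 → Vec A 6
  first (a ∷ b ∷ c ∷ d ∷ e ∷ f ∷ g ∷ []) = a ∷ b ∷ c ∷ d ∷ e ∷ f ∷ []

  last : {A : Set} → Vec A 7 → A
  last (a ∷ b ∷ c ∷ d ∷ e ∷ f ∷ g ∷ []) = g

  -- The two monomials just outside the span. The equation for Z rewrites Z u⁶; multiplying it by Z,
  -- with Z² = ux, and cancelling x rewrites u⁷.
  Zu⁶ u⁷ : Elem
  Zu⁶ = times-x (Vec.fromList β) , times-x (Vec.fromList α)
  u⁷ = (([] ∷ times-x (Vec.fromList α)) , first (Vec.fromList β)) +ₑ last (Vec.fromList β) *ₑ Zu⁶

  mulU mulZ : Elem → Elem
  mulU (e₀ ∷ e₁ ∷ e₂ ∷ e₃ ∷ e₄ ∷ e₅ ∷ e₆ ∷ [] , o₀ ∷ o₁ ∷ o₂ ∷ o₃ ∷ o₄ ∷ o₅ ∷ []) =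
    ([] ∷ e₀ ∷ e₁ ∷ e₂ ∷ e₃ ∷ e₄ ∷ e₅ ∷ [] , [] ∷ o₀ ∷ o₁ ∷ o₂ ∷ o₃ ∷ o₄ ∷ []) +ₑ (e₆ *ₑ u⁷ +ₑ o₅ *ₑ Zu⁶)
  mulZ (e₀ ∷ e₁ ∷ e₂ ∷ e₃ ∷ e₄ ∷ e₅ ∷ e₆ ∷ [] , o) =
    ([] ∷ times-x o , e₀ ∷ e₁ ∷ e₂ ∷ e₃ ∷ e₄ ∷ e₅ ∷ []) +ₑ e₆ *ₑ Zu⁶

  rows-top₆ : ∀ o₀ o₁ o₂ o₃ o₄ o₅ → u ⊛ rows (o₀ ∷ o₁ ∷ o₂ ∷ o₃ ∷ o₄ ∷ o₅ ∷ []) ≈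
              rows ([] ∷ o₀ ∷ o₁ ∷ o₂ ∷ o₃ ∷ o₄ ∷ []) ⊕ ev o₅ x ⊛ u ↑ 6
  rows-top₆ o₀ o₁ o₂ o₃ o₄ o₅ = solveₛ
    (y :* (v0 :+ y :* (v1 :+ y :* (v2 :+ y :* (v3 :+ y :* (v4 :+ y :* (v5 :+ y :* con (+ 0))))))))
    ((con (+ 0) :+ y :* (v0 :+ y :* (v1 :+ y :* (v2 :+ y :* (v3 :+ y :* (v4 :+ y :* con (+ 0))))))) :+ v5 :* y :^ 6) refl
    (ev o₀ x ∷ ev o₁ x ∷ ev o₂ x ∷ ev o₃ x ∷ ev o₄ x ∷ ev o₅ x ∷ u ∷ [])
    where y = v6

  rows-top₇ : ∀ e₀ e₁ e₂ e₃ e₄ e₅ e₆ → rows (e₀ ∷ e₁ ∷ e₂ ∷ e₃ ∷ e₄ ∷ e₅ ∷ e₆ ∷ []) ≈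
              rows (e₀ ∷ e₁ ∷ e₂ ∷ e₃ ∷ e₄ ∷ e₅ ∷ []) ⊕ ev e₆ x ⊛ u ↑ 6
  rows-top₇ e₀ e₁ e₂ e₃ e₄ e₅ e₆ = solveₛ
    (v0 :+ y :* (v1 :+ y :* (v2 :+ y :* (v3 :+ y :* (v4 :+ y :* (v5 :+ y :* (v6 :+ y :* con (+ 0))))))))
    ((v0 :+ y :* (v1 :+ y :* (v2 :+ y :* (v3 :+ y :* (v4 :+ y :* (v5 :+ y :* con (+ 0))))))) :+ v6 :* y :^ 6) refl
    (ev e₀ x ∷ ev e₁ x ∷ ev e₂ x ∷ ev e₃ x ∷ ev e₄ x ∷ ev e₅ x ∷ ev e₆ x ∷ u ∷ [])
    where y = var (suc (suc (suc (suc (suc (suc (suc zero)))))))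

  rows-top : ∀ v → rows v ≈ rows (first v) ⊕ ev (last v) x ⊛ u ↑ 6
  rows-top (e₀ ∷ e₁ ∷ e₂ ∷ e₃ ∷ e₄ ∷ e₅ ∷ e₆ ∷ []) = rows-top₇ e₀ e₁ e₂ e₃ e₄ e₅ e₆

  Zu⁶-sound : Z ⊛ u ↑ 6 ≈ ⟪ Zu⁶ ⟫ₑ
  Zu⁶-sound = begin
    Z ⊛ u ↑ 6                          ≈⟨ solveₛ (v0 :* v1 :^ 6) (v0 :* (v1 :^ 6 :- v2 :* v3) :+ v0 :* (v2 :* v3)) refl (Z ∷ u ∷ x ∷ α′ ∷ []) ⟩
    Z ⊛ den ⊕ Z ⊛ (x ⊛ α′)               ≈⟨ ⊕-cong Z-den≈num (⊛-congˡ (≈-sym (rows-x (Vec.fromList α)))) ⟩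
    num ⊕ Z ⊛ rows (times-x (Vec.fromList α))   ≈⟨ ⊕-congʳ (Z ⊛ rows (times-x (Vec.fromList α))) (≈-sym (rows-x (Vec.fromList β))) ⟩
    ⟪ Zu⁶ ⟫ₑ                           ∎
    where
    α′ = rows (Vec.fromList α)

  cancel-x : ∀ {f g} → x ⊛ f ≈ x ⊛ g → f ≈ g
  cancel-x {f} {g} p = cancelˡ x̃ (λ ()) (cancelˡ-X 13 (≈-trans (regroup f) (≈-trans p (≈-sym (regroup g)))))
    where
    regroup : ∀ f → X ↑ 13 ⊛ (x̃ ⊛ f) ≈ x ⊛ f
    regroup f = ≈-trans (≈-sym (⊛-assoc (X ↑ 13) x̃ f)) (⊛-congʳ (≈-sym x-factored))

  u⁷-sound : u ↑ 7 ≈ ⟪ u⁷ ⟫ₑ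
  u⁷-sound = cancel-x (begin
    x ⊛ u ↑ 7
      ≈⟨ solveₛ (v0 :* v1 :^ 7) ((v1 :* v0) :* v1 :^ 6) refl (x ∷ u ∷ []) ⟩
    (u ⊛ x) ⊛ u ↑ 6
      ≈⟨ ⊛-congʳ Z² ⟨
    (Z ⊛ Z) ⊛ u ↑ 6
      ≈⟨ ⊛-assoc Z Z (u ↑ 6) ⟩
    Z ⊛ (Z ⊛ u ↑ 6)
      ≈⟨ ⊛-congˡ (≈-trans Zu⁶-sound (⊕-cong (rows-x (Vec.fromList β)) (⊛-congˡ (rows-x (Vec.fromList α))))) ⟩
    Z ⊛ (x ⊛ rows (Vec.fromList β) ⊕ Z ⊛ (x ⊛ α′))
      ≈⟨ solveₛ (v0 :* (v1 :* v2 :+ v0 :* (v1 :* v3))) (v0 :* (v1 :* v2) :+ (v0 :* v0) :* (v1 :* v3)) refl (Z ∷ x ∷ rows (Vec.fromList β) ∷ α′ ∷ []) ⟩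
    Z ⊛ (x ⊛ rows (Vec.fromList β)) ⊕ (Z ⊛ Z) ⊛ (x ⊛ α′)
      ≈⟨ ⊕-cong (⊛-congˡ (⊛-congˡ (rows-top (Vec.fromList β)))) (⊛-congʳ Z²) ⟩
    Z ⊛ (x ⊛ (β′ ⊕ ev β₆ x ⊛ u ↑ 6)) ⊕ (u ⊛ x) ⊛ (x ⊛ α′)
      ≈⟨ solveₛ (v0 :* (v1 :* (v2 :+ v3 :* v4)) :+ (v5 :* v1) :* (v1 :* v6)) (v1 :* (((con (+ 0) :+ v5 :* (v1 :* v6)) :+ v0 :* v2) :+ v3 :* (v0 :* v4))) refl
           (Z ∷ x ∷ β′ ∷ ev β₆ x ∷ u ↑ 6 ∷ u ∷ α′ ∷ []) ⟩
    x ⊛ (((0ₛ ⊕ u ⊛ (x ⊛ α′)) ⊕ Z ⊛ β′) ⊕ ev β₆ x ⊛ (Z ⊛ u ↑ 6))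
      ≈⟨ ⊛-congˡ (⊕-cong (⊕-congʳ (Z ⊛ β′) (⊕-congˡ 0ₛ (⊛-congˡ (≈-sym (rows-x (Vec.fromList α))))))
           (≈-trans (⊛-congˡ Zu⁶-sound) (≈-sym (*ₑ-sound β₆ Zu⁶)))) ⟩
    x ⊛ (⟪ head ⟫ₑ ⊕ ⟪ β₆ *ₑ Zu⁶ ⟫ₑ)
      ≈⟨ ⊛-congˡ (+ₑ-sound head (β₆ *ₑ Zu⁶)) ⟨
    x ⊛ ⟪ u⁷ ⟫ₑ ∎)
    where
    α′ = rows (Vec.fromList α)
    β₆ = last (Vec.fromList β)
    head : Elem
    head = ([] ∷ times-x (Vec.fromList α)) , first (Vec.fromList β)
    β′ = rows (first (Vec.fromList β))

  mulU-sound : ∀ v → ⟪ mulU v ⟫ₑ ≈ u ⊛ ⟪ v ⟫ₑ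
  mulU-sound (e@(e₀ ∷ e₁ ∷ e₂ ∷ e₃ ∷ e₄ ∷ e₅ ∷ e₆ ∷ []) , o@(o₀ ∷ o₁ ∷ o₂ ∷ o₃ ∷ o₄ ∷ o₅ ∷ [])) = ≈-sym (begin
    u ⊛ (rows e ⊕ Z ⊛ rows o)
      ≈⟨ solveₛ (v0 :* (v1 :+ v2 :* v3)) (v0 :* v1 :+ v2 :* (v0 :* v3)) refl (u ∷ rows e ∷ Z ∷ rows o ∷ []) ⟩
    u ⊛ rows e ⊕ Z ⊛ (u ⊛ rows o)
      ≈⟨ ⊕-cong (⊛-congˡ (rows-top₇ e₀ e₁ e₂ e₃ e₄ e₅ e₆)) (⊛-congˡ (rows-top₆ o₀ o₁ o₂ o₃ o₄ o₅)) ⟩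
    u ⊛ (rows e′ ⊕ ev e₆ x ⊛ u ↑ 6) ⊕ Z ⊛ (rows o″ ⊕ ev o₅ x ⊛ u ↑ 6)
      ≈⟨ solveₛ (v0 :* (v1 :+ v2 :* v3 :^ 6) :+ v4 :* (v5 :+ v6 :* v3 :^ 6)) (((con (+ 0) :+ v0 :* v1) :+ v4 :* v5) :+ (v2 :* (v0 :* v3 :^ 6) :+ v6 :* (v4 :* v3 :^ 6))) refl
           (u ∷ rows e′ ∷ ev e₆ x ∷ u ∷ Z ∷ rows o″ ∷ ev o₅ x ∷ []) ⟩
    ⟪ [] ∷ e′ , o″ ⟫ₑ ⊕ (ev e₆ x ⊛ u ↑ 7 ⊕ ev o₅ x ⊛ (Z ⊛ u ↑ 6))
      ≈⟨ ⊕-congˡ ⟪ [] ∷ e′ , o″ ⟫ₑ (⊕-cong (≈-trans (⊛-congˡ u⁷-sound) (≈-sym (*ₑ-sound e₆ u⁷))) (≈-trans (⊛-congˡ Zu⁶-sound) (≈-sym (*ₑ-sound o₅ Zu⁶)))) ⟩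
    ⟪ [] ∷ e′ , o″ ⟫ₑ ⊕ (⟪ e₆ *ₑ u⁷ ⟫ₑ ⊕ ⟪ o₅ *ₑ Zu⁶ ⟫ₑ)
      ≈⟨ ≈-sym (≈-trans (+ₑ-sound ([] ∷ e′ , o″) (e₆ *ₑ u⁷ +ₑ o₅ *ₑ Zu⁶)) (⊕-congˡ ⟪ [] ∷ e′ , o″ ⟫ₑ (+ₑ-sound (e₆ *ₑ u⁷) (o₅ *ₑ Zu⁶)))) ⟩
    ⟪ mulU (e , o) ⟫ₑ ∎)
    where
    e′ = e₀ ∷ e₁ ∷ e₂ ∷ e₃ ∷ e₄ ∷ e₅ ∷ []
    o″ = [] ∷ o₀ ∷ o₁ ∷ o₂ ∷ o₃ ∷ o₄ ∷ []

  mulZ-sound : ∀ v → ⟪ mulZ v ⟫ₑ ≈ Z ⊛ ⟪ v ⟫ₑ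
  mulZ-sound (e@(e₀ ∷ e₁ ∷ e₂ ∷ e₃ ∷ e₄ ∷ e₅ ∷ e₆ ∷ []) , o) = ≈-sym (begin
    Z ⊛ (rows e ⊕ Z ⊛ rows o)
      ≈⟨ ⊛-congˡ (⊕-congʳ (Z ⊛ rows o) (rows-top₇ e₀ e₁ e₂ e₃ e₄ e₅ e₆)) ⟩
    Z ⊛ ((rows e′ ⊕ ev e₆ x ⊛ u ↑ 6) ⊕ Z ⊛ rows o)
      ≈⟨ solveₛ (v0 :* ((v1 :+ v2 :* v3) :+ v0 :* v4)) (((v0 :* v0) :* v4 :+ v0 :* v1) :+ v2 :* (v0 :* v3)) refl (Z ∷ rows e′ ∷ ev e₆ x ∷ u ↑ 6 ∷ rows o ∷ []) ⟩
    ((Z ⊛ Z) ⊛ rows o ⊕ Z ⊛ rows e′) ⊕ ev e₆ x ⊛ (Z ⊛ u ↑ 6)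
      ≈⟨ ⊕-cong (⊕-congʳ (Z ⊛ rows e′) (≈-trans (⊛-congʳ Z²)
           (≈-trans (solveₛ ((v0 :* v1) :* v2) (con (+ 0) :+ v0 :* (v1 :* v2)) refl (u ∷ x ∷ rows o ∷ [])) (⊕-congˡ 0ₛ (⊛-congˡ (≈-sym (rows-x o)))))))
           (≈-trans (⊛-congˡ Zu⁶-sound) (≈-sym (*ₑ-sound e₆ Zu⁶))) ⟩
    ⟪ [] ∷ times-x o , e′ ⟫ₑ ⊕ ⟪ e₆ *ₑ Zu⁶ ⟫ₑ
      ≈⟨ +ₑ-sound ([] ∷ times-x o , e′) (e₆ *ₑ Zu⁶) ⟨
    ⟪ mulZ (e , o) ⟫ₑ ∎)
    where
    e′ = e₀ ∷ e₁ ∷ e₂ ∷ e₃ ∷ e₄ ∷ e₅ ∷ []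

open Elements

-- The traces of the basis elements and the coordinates of x/u¹³.

module TraceTable where

  open SetoidReasoning (CommutativeRing.setoid seriesRing)

  one : Elem
  one = ((+ 1 ∷ []) ∷ Vec.replicate 6 []) , Vec.replicate 6 []

  one-sound : ⟪ one ⟫ₑ ≈ 1ₛ
  one-sound = solveₛ ((poly (+ 1 ∷ []) v0 :+ v1 :* (z :+ v1 :* (z :+ v1 :* (z :+ v1 :* (z :+ v1 :* (z :+ v1 :* (z :+ v1 :* z)))))))
    :+ v2 :* (z :+ v1 :* (z :+ v1 :* (z :+ v1 :* (z :+ v1 :* (z :+ v1 :* (z :+ v1 :* z))))))) (con (+ 1)) refl (x ∷ u ∷ Z ∷ [])
    where
    z : Expr 3
    z = con (+ 0)

  powU : ℕ → Elem → Elem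
  powU zero    v = v
  powU (suc k) v = powU k (mulU v)

  powU-sound : ∀ k v → ⟪ powU k v ⟫ₑ ≈ u ↑ k ⊛ ⟪ v ⟫ₑ
  powU-sound zero    v = ≈-sym (⊛-identityˡ _)
  powU-sound (suc k) v = ≈-trans (powU-sound k (mulU v)) (≈-trans (⊛-congˡ (mulU-sound v))
    (solveₛ (v0 :* (v1 :* v2)) ((v1 :* v0) :* v2) refl (u ↑ k ∷ u ∷ ⟪ v ⟫ₑ ∷ [])))

  one-powU : ∀ k → ⟪ powU k one ⟫ₑ ≈ u ↑ k
  one-powU k = ≈-trans (powU-sound k one) (≈-trans (⊛-congˡ one-sound) (⊛-identityʳ (u ↑ k)))

  -- The basis 1, u, …, u⁶, Z, Zu, …, Zu⁵ of ℤ[[q]] over ℤ[[q¹³]].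
  unit : ℕ → Elem
  unit (suc (suc (suc (suc (suc (suc (suc m))))))) = mulZ (powU m one)
  unit 0 = powU 0 one
  unit 1 = powU 1 one
  unit 2 = powU 2 one
  unit 3 = powU 3 one
  unit 4 = powU 4 one
  unit 5 = powU 5 one
  unit 6 = powU 6 one

  -- uˡ begins with qˡ and Z uᵐ with q^(7+m), so the leading exponents are 0, ..., 12, each once,
  -- and `g̃` strips off the leading power. Having Z among the members lets both u and Z act by
  -- matrices over ℤ[x].
  g̃ basis : ℕ → Series
  g̃ (suc (suc (suc (suc (suc (suc (suc m))))))) = Z̃ ⊛ ũ ↑ m
  g̃ 0 = ũ ↑ 0
  g̃ 1 = ũ ↑ 1
  g̃ 2 = ũ ↑ 2
  g̃ 3 = ũ ↑ 3
  g̃ 4 = ũ ↑ 4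
  g̃ 5 = ũ ↑ 5
  g̃ 6 = ũ ↑ 6

  basis (suc (suc (suc (suc (suc (suc (suc m))))))) = Z ⊛ u ↑ m
  basis 0 = u ↑ 0
  basis 1 = u ↑ 1
  basis 2 = u ↑ 2
  basis 3 = u ↑ 3
  basis 4 = u ↑ 4
  basis 5 = u ↑ 5
  basis 6 = u ↑ 6

  ũ↑-0 : ∀ k → (ũ ↑ k) 0 ≡ + 1
  ũ↑-0 zero    = refl
  ũ↑-0 (suc k) = cong (ũ 0 ℤ.*_) (ũ↑-0 k)

  g̃-0 : ∀ l → g̃ l 0 ≡ + 1
  g̃-0 (suc (suc (suc (suc (suc (suc (suc m))))))) = cong (Z̃ 0 ℤ.*_) (ũ↑-0 m)
  g̃-0 0 = ũ↑-0 0
  g̃-0 1 = ũ↑-0 1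
  g̃-0 2 = ũ↑-0 2
  g̃-0 3 = ũ↑-0 3
  g̃-0 4 = ũ↑-0 4
  g̃-0 5 = ũ↑-0 5
  g̃-0 6 = ũ↑-0 6

  open Basis g̃ g̃-0 using (g; c; c-expansion; c-unique; trace-U)

  δ-as-X : ∀ k → δ k ≈ X ↑ k
  δ-as-X zero    = δ-0
  δ-as-X (suc k) = ≈-trans (mk λ { zero → refl ; (suc n) → refl }) (≈-trans (≈-sym (X-⊛ (δ k))) (⊛-congˡ (δ-as-X k)))

  even-basis : ∀ k → δ k ⊛ ũ ↑ k ≈ u ↑ k
  even-basis k = ≈-trans (⊛-congʳ (δ-as-X k)) (≈-trans (go k) (^-cong k (≈-sym u-factored)))
    where
    go : ∀ k → X ↑ k ⊛ ũ ↑ k ≈ (X ⊛ ũ) ↑ k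
    go zero    = ⊛-identityˡ 1ₛ
    go (suc k) = ≈-trans (solveₛ ((v0 :* v1) :* (v2 :* v3)) ((v0 :* v2) :* (v1 :* v3)) refl (X ∷ X ↑ k ∷ ũ ∷ ũ ↑ k ∷ [])) (⊛-congˡ (go k))

  g-basis : ∀ l → g l ≈ basis l
  g-basis (suc (suc (suc (suc (suc (suc (suc m))))))) = begin
    δ (7 ℕ.+ m) ⊛ (Z̃ ⊛ ũ ↑ m)             ≈⟨ ⊛-congʳ (δ-⊛ 7 m) ⟨
    (δ 7 ⊛ δ m) ⊛ (Z̃ ⊛ ũ ↑ m)             ≈⟨ solveₛ ((v0 :* v1) :* (v2 :* v3)) ((v0 :* v2) :* (v1 :* v3)) refl (δ 7 ∷ δ m ∷ Z̃ ∷ ũ ↑ m ∷ []) ⟩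
    (δ 7 ⊛ Z̃) ⊛ (δ m ⊛ ũ ↑ m)             ≈⟨ ⊛-cong (≈-trans (⊛-congʳ (δ-as-X 7)) (≈-sym Z-factored)) (even-basis m) ⟩
    Z ⊛ u ↑ m                             ∎
  g-basis 0 = even-basis 0
  g-basis 1 = even-basis 1
  g-basis 2 = even-basis 2
  g-basis 3 = even-basis 3
  g-basis 4 = even-basis 4
  g-basis 5 = even-basis 5
  g-basis 6 = even-basis 6

  unit-sound : ∀ l → ⟪ unit l ⟫ₑ ≈ basis l
  unit-sound (suc (suc (suc (suc (suc (suc (suc m))))))) = ≈-trans (mulZ-sound (powU m one)) (⊛-congˡ (one-powU m))
  unit-sound 0 = one-powU 0
  unit-sound 1 = one-powU 1
  unit-sound 2 = one-powU 2
  unit-sound 3 = one-powU 3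
  unit-sound 4 = one-powU 4
  unit-sound 5 = one-powU 5
  unit-sound 6 = one-powU 6

  nthᵥ : ∀ {n} → Vec Pol n → ℕ → Pol
  nthᵥ []      k       = []
  nthᵥ (p ∷ v) zero    = p
  nthᵥ (p ∷ v) (suc k) = nthᵥ v k

  component : ℕ → Elem → Pol
  component l (e , o) = nthᵥ (e Vec.++ o) l

  -- A coefficient p(x) of the representation is V (p(u)), so the coordinate over ℤ[[q¹³]], read as
  -- a series in q, is p(u).
  c-component : ∀ v l → l ℕ.< 13 → c l ⟪ v ⟫ₑ ≈ ev (component l v) u
  c-component v@(e@(e₀ ∷ e₁ ∷ e₂ ∷ e₃ ∷ e₄ ∷ e₅ ∷ e₆ ∷ []) , o@(o₀ ∷ o₁ ∷ o₂ ∷ o₃ ∷ o₄ ∷ o₅ ∷ [])) =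
    c-unique ⟪ v ⟫ₑ (λ l → ev (component l v) u) (≈-trans expansion (sumₛ-cong 13 {λ l → ev (component l v) x ⊛ basis l} {λ l → V (ev (component l v) u) ⊛ g l}
      λ l _ → ⊛-cong (≈-sym (V-ev (component l v) u)) (≈-sym (g-basis l))))
    where
    y z : Expr 15
    y = var (# 13)
    z = var (# 14)
    κ : Fin 13 → Expr 15
    κ i = var (inject≤ i (ℕₚ.≤ᵇ⇒≤ 13 15 _))
    F : ℕ → Series
    F l = ev (component l v) x ⊛ basis l
    expansion : ⟪ v ⟫ₑ ≈ sumₛ 13 F
    expansion = ≈-trans (solveₛ
      ((κ (# 0) :+ y :* (κ (# 1) :+ y :* (κ (# 2) :+ y :* (κ (# 3) :+ y :* (κ (# 4) :+ y :* (κ (# 5) :+ y :* (κ (# 6) :+ y :* con (+ 0))))))))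
        :+ z :* (κ (# 7) :+ y :* (κ (# 8) :+ y :* (κ (# 9) :+ y :* (κ (# 10) :+ y :* (κ (# 11) :+ y :* (κ (# 12) :+ y :* con (+ 0))))))))
      (con (+ 0) :+ κ (# 0) :* y :^ 0 :+ κ (# 1) :* y :^ 1 :+ κ (# 2) :* y :^ 2 :+ κ (# 3) :* y :^ 3 :+ κ (# 4) :* y :^ 4 :+ κ (# 5) :* y :^ 5 :+ κ (# 6) :* y :^ 6
        :+ κ (# 7) :* (z :* y :^ 0) :+ κ (# 8) :* (z :* y :^ 1) :+ κ (# 9) :* (z :* y :^ 2) :+ κ (# 10) :* (z :* y :^ 3) :+ κ (# 11) :* (z :* y :^ 4) :+ κ (# 12) :* (z :* y :^ 5))
      refl
      (ev e₀ x ∷ ev e₁ x ∷ ev e₂ x ∷ ev e₃ x ∷ ev e₄ x ∷ ev e₅ x ∷ ev e₆ x ∷ ev o₀ x ∷ ev o₁ x ∷ ev o₂ x ∷ ev o₃ x ∷ ev o₄ x ∷ ev o₅ x ∷ u ∷ Z ∷ []))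
      (mk λ n → cong (λ t → t ℤ.+ F 0 n ℤ.+ F 1 n ℤ.+ F 2 n ℤ.+ F 3 n ℤ.+ F 4 n ℤ.+ F 5 n ℤ.+ F 6 n ℤ.+ F 7 n ℤ.+ F 8 n ℤ.+ F 9 n ℤ.+ F 10 n ℤ.+ F 11 n ℤ.+ F 12 n) (const-0 n))

  iterates : (n : ℕ) → Elem → Vec Elem n
  iterates zero    v = []
  iterates (suc n) v = v ∷ iterates n (mulU v)

  iterates-sound : ∀ n v k → ⟪ lookup (iterates n v) k ⟫ₑ ≈ u ↑ toℕ k ⊛ ⟪ v ⟫ₑ
  iterates-sound (suc n) v zero    = ≈-sym (⊛-identityˡ _)
  iterates-sound (suc n) v (suc k) = ≈-trans (iterates-sound n (mulU v) k) (≈-trans (⊛-congˡ (mulU-sound v))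
    (solveₛ (v0 :* (v1 :* v2)) ((v1 :* v0) :* v2) refl (u ↑ toℕ k ∷ u ∷ ⟪ v ⟫ₑ ∷ [])))

  -- The l-th diagonal entries of the matrices of 1, u, …, u⁶ and Z, Zu, …, Zu⁵.
  diagonal : ℕ → Vec Elem 7 → Elem
  diagonal l its = Vec.map (component l) its , Vec.map (component l) (Vec.map mulZ (first its))

  traces : ℕ → Elem
  traces zero    = Vec.replicate 7 [] , Vec.replicate 6 []
  traces (suc l) = traces l +ₑ diagonal l (iterates 7 (unit l))

  traces-even : ∀ N k → ev (lookup (proj₁ (traces N)) k) u ≈ sumₛ N (λ l → ev (component l (lookup (iterates 7 (unit l)) k)) u)
  traces-even zero k = ≈-trans (mk λ n → cong (λ p → ev p u n) (Vecₚ.lookup-replicate k [])) (mk const-0)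
  traces-even (suc N) k = ≈-trans (mk λ n → cong (λ p → ev p u n) (trans (Vecₚ.lookup-zipWith _+ₚ_ k (proj₁ (traces N)) _)
      (cong (lookup (proj₁ (traces N)) k +ₚ_) (Vecₚ.lookup-map k (component N) (iterates 7 (unit N))))))
    (≈-trans (ev-+ (lookup (proj₁ (traces N)) k) _ u) (⊕-congʳ (ev (component N (lookup (iterates 7 (unit N)) k)) u) (traces-even N k)))

  traces-odd : ∀ N k → ev (lookup (proj₂ (traces N)) k) u ≈ sumₛ N (λ l → ev (component l (mulZ (lookup (iterates 6 (unit l)) k))) u)
  traces-odd zero k = ≈-trans (mk λ n → cong (λ p → ev p u n) (Vecₚ.lookup-replicate k [])) (mk const-0)
  traces-odd (suc N) k = ≈-trans (mk λ n → cong (λ p → ev p u n) (trans (Vecₚ.lookup-zipWith _+ₚ_ k (proj₂ (traces N)) _)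
      (cong (lookup (proj₂ (traces N)) k +ₚ_) (trans (Vecₚ.lookup-map k (component N) (Vec.map mulZ (iterates 6 (unit N)))) (cong (component N) (Vecₚ.lookup-map k mulZ (iterates 6 (unit N))))))))
    (≈-trans (ev-+ (lookup (proj₂ (traces N)) k) _ u) (⊕-congʳ (ev (component N (mulZ (lookup (iterates 6 (unit N)) k))) u) (traces-odd N k)))

  trace-of : ∀ f (m : ℕ → Elem) → (∀ l → ⟪ m l ⟫ₑ ≈ f ⊛ ⟪ unit l ⟫ₑ) → const (+ 13) ⊛ U f ≈ sumₛ 13 (λ l → ev (component l (m l)) u)
  trace-of f m p = ≈-trans (≈-sym (trace-U f)) (sumₛ-cong 13 {λ l → c l (f ⊛ g l)} {λ l → ev (component l (m l)) u} λ l l<13 →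
    ≈-trans (Basis.c-cong g̃ g̃-0 l l<13 (≈-sym (≈-trans (p l) (⊛-congˡ (≈-trans (unit-sound l) (≈-sym (g-basis l))))))) (c-component (m l) l l<13))

  U-even : ∀ k → const (+ 13) ⊛ U (u ↑ toℕ {7} k) ≈ ev (lookup (proj₁ (traces 13)) k) u
  U-even k = ≈-trans (trace-of (u ↑ toℕ k) (λ l → lookup (iterates 7 (unit l)) k) (λ l → iterates-sound 7 (unit l) k)) (≈-sym (traces-even 13 k))

  U-odd : ∀ k → const (+ 13) ⊛ U (Z ⊛ u ↑ toℕ {6} k) ≈ ev (lookup (proj₂ (traces 13)) k) u
  U-odd k = ≈-trans (trace-of (Z ⊛ u ↑ toℕ k) (λ l → mulZ (lookup (iterates 6 (unit l)) k)) (λ l →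
      ≈-trans (mulZ-sound (lookup (iterates 6 (unit l)) k)) (≈-trans (⊛-congˡ (iterates-sound 6 (unit l) k)) (≈-sym (⊛-assoc Z (u ↑ toℕ k) ⟪ unit l ⟫ₑ)))))
    (≈-sym (traces-odd 13 k))

  -- By the modular equation u¹³/x is a polynomial in u and x. In rank 13 over ℤ[x] the norm of u is
  -- x, so u¹³/x has norm 1 and its inverse is a polynomial as well. The coordinates are certified
  -- by multiplying with u¹³ and comparing with x.
  x-over-u¹³ : Elem
  x-over-u¹³ = h-even , h-odd
    where
    h-even : Vec Pol 7
    h-even =
        (+ 1 ∷ -[1+ 177101183 ] ∷ + 1594079318 ∷ -[1+ 81938006981 ] ∷ + 1038266837088 ∷ + 8730196714694 ∷ + 22180345789160 ∷ + 6121180581867 ∷ -[1+ 19508200192714 ] ∷ + 44326807379140 ∷ + 146681435327336 ∷ + 351263437231252 ∷ + 582452128062025 ∷ + 605750213184506 ∷ + 302875106592253 ∷ [])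
      ∷ (-[1+ 25 ] ∷ -[1+ 1954178108 ] ∷ + 38208466400 ∷ -[1+ 531261497870 ] ∷ + 14771596398650 ∷ + 199521458019728 ∷ + 814397701158470 ∷ + 1082968183853205 ∷ -[1+ 1108431218309219 ] ∷ -[1+ 3824905065349250 ] ∷ -[1+ 3813717318510735 ] ∷ -[1+ 9132849368012551 ] ∷ -[1+ 15143755329612649 ] ∷ -[1+ 15749505542797155 ] ∷ -[1+ 7874752771398577 ] ∷ [])
      ∷ (+ 351 ∷ -[1+ 8947066179 ] ∷ + 327908893728 ∷ + 673378412850 ∷ + 108936627583979 ∷ + 1829490641521530 ∷ + 10781539400023938 ∷ + 27428452039287312 ∷ + 18577375577096947 ∷ -[1+ 38282603289508681 ] ∷ -[1+ 22960469675942798 ] ∷ + 123293466468169452 ∷ + 204440696949770775 ∷ + 212618324827761606 ∷ + 106309162413880803 ∷ [])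
      ∷ (-[1+ 3223 ] ∷ -[1+ 20439288921 ] ∷ + 1414792796690 ∷ + 16089169051891 ∷ + 454856418672526 ∷ + 8329218435005923 ∷ + 62816638209137046 ∷ + 226058913475057676 ∷ + 322927484011869984 ∷ -[1+ 310053811838305976 ] ∷ -[1+ 1743603324603977823 ] ∷ -[1+ 2358345082202351150 ] ∷ -[1+ 1877825660871968599 ] ∷ -[1+ 1952938687306847343 ] ∷ -[1+ 976469343653423671 ] ∷ [])
      ∷ (+ 22165 ∷ -[1+ 20800252979 ] ∷ + 3080801898915 ∷ + 53998441829306 ∷ + 1078533882050053 ∷ + 19988675656107574 ∷ + 183652177792453487 ∷ + 896781577854048016 ∷ + 2320069747889297300 ∷ + 2216749405706815356 ∷ -[1+ 3204750177418933584 ] ∷ -[1+ 8603674584144458935 ] ∷ + 328735981078206910 ∷ + 13426453475234575490 ∷ + 6713226737617287745 ∷ [])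
      ∷ (-[1+ 117545 ] ∷ -[1+ 6336345560 ] ∷ + 2361503828684 ∷ + 44458466277524 ∷ + 781785277039650 ∷ + 15530315623387123 ∷ + 169529077334100718 ∷ + 994964529967983679 ∷ + 2874225658606821636 ∷ + 135674643666121872 ∷ -[1+ 29569821280678291885 ] ∷ -[1+ 107542027184307130076 ] ∷ -[1+ 183382023769262648719 ] ∷ -[1+ 147530161545979844046 ] ∷ -[1+ 35601757279492971137 ] ∷ [])
      ∷ (+ 468013 ∷ + 866670532 ∷ -[1+ 5790465927 ] ∷ + 213445378276 ∷ + 932108798920 ∷ -[1+ 2018146764607 ] ∷ -[1+ 18074396579264 ] ∷ -[1+ 29367121686720 ] ∷ [])
      ∷ []
    h-odd : Vec Pol 6
    h-odd =
        (-[1+ 1169791 ] ∷ + 1891399497 ∷ -[1+ 28207315954 ] ∷ + 30427289984 ∷ -[1+ 14662552899773 ] ∷ -[1+ 95383682815069 ] ∷ -[1+ 207065086218639 ] ∷ + 14759015935053 ∷ + 381772581927373 ∷ [])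
      ∷ (-[1+ 15768544 ] ∷ + 10070960796 ∷ -[1+ 544375362309 ] ∷ -[1+ 2167339175208 ] ∷ -[1+ 192584124556719 ] ∷ -[1+ 1663167862188143 ] ∷ -[1+ 5346936356624134 ] ∷ -[1+ 4915312713377975 ] ∷ + 8401351001263012 ∷ + 14889130695167547 ∷ [])
      ∷ (-[1+ 72641542 ] ∷ + 7553518037 ∷ -[1+ 3736484623598 ] ∷ -[1+ 28545557124421 ] ∷ -[1+ 1141742878856410 ] ∷ -[1+ 12061037343722561 ] ∷ -[1+ 54428807027480898 ] ∷ -[1+ 106199146443000974 ] ∷ -[1+ 9998059867356248 ] ∷ + 282939390085969110 ∷ + 322597831728630185 ∷ [])
      ∷ (-[1+ 179968918 ] ∷ -[1+ 90144892876 ] ∷ -[1+ 12412335684995 ] ∷ -[1+ 139947562688296 ] ∷ -[1+ 3667840645166593 ] ∷ -[1+ 44637831017803490 ] ∷ -[1+ 263407316278733704 ] ∷ -[1+ 792620408116455268 ] ∷ -[1+ 903919827687975201 ] ∷ + 1281517237935708761 ∷ + 4904017521751813764 ∷ + 4193771812472192405 ∷ [])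
      ∷ (-[1+ 210132194 ] ∷ -[1+ 235017136028 ] ∷ -[1+ 17639881074893 ] ∷ -[1+ 244476583921725 ] ∷ -[1+ 5319408336420268 ] ∷ -[1+ 73490262603434585 ] ∷ -[1+ 540827457937006421 ] ∷ -[1+ 2179991472471966958 ] ∷ -[1+ 4182490756643694377 ] ∷ + 1167782465716873422 ∷ + 23686082471308828389 ∷ + 46973692416286682124 ∷ + 32711420137283100759 ∷ [])
      ∷ (-[1+ 16101409 ] ∷ -[1+ 129178816285 ] ∷ -[1+ 4473964885675 ] ∷ -[1+ 68055217918349 ] ∷ -[1+ 1446590187674865 ] ∷ -[1+ 21834092208006454 ] ∷ -[1+ 176171194096149173 ] ∷ -[1+ 701519113388204110 ] ∷ -[1+ 238388997442048777 ] ∷ + 11742771722697684006 ∷ + 62282566651643537082 ∷ + 162405709319662492775 ∷ + 228991147339925618674 ∷ + 141749487261560103289 ∷ [])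
      ∷ []

open TraceTable

-- The finitely many lattice inclusions, checked by computation.

module LatticeBase where

  open SetoidReasoning (CommutativeRing.setoid seriesRing)

  ∧-true : ∀ {a b} → a ∧ b ≡ true → (a ≡ true) × (b ≡ true)
  ∧-true {true} {true} _ = refl , refl

  allNull : ∀ {n} → Vec Pol n → Bool
  allNull []      = true
  allNull (p ∷ v) = null {1} p ∧ allNull v

  ev-null : ∀ p y → null {1} p ≡ true → ev p y ≈ 0ₛ
  ev-null p y eq = ≈-trans (ev-as-⟦⟧ᵖ p y) (S.null-sound {1} p (y ∷ []) eq)

  rows-null : ∀ {n} (v : Vec Pol n) → allNull v ≡ true → rows v ≈ 0ₛ
  rows-null []      eq = ≈-refl
  rows-null (p ∷ v) eq = ≈-trans (⊕-cong (ev-null p x (proj₁ (∧-true eq))) (⊛-congˡ (rows-null v (proj₂ (∧-true {null {1} p} eq)))))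
    (solveₛ (con (+ 0) :+ v0 :* con (+ 0)) (con (+ 0)) refl (u ∷ []))

  isZero : Elem → Bool
  isZero (e , o) = allNull e ∧ allNull o

  isZero-sound : ∀ v → isZero v ≡ true → ⟪ v ⟫ₑ ≈ 0ₛ
  isZero-sound (e , o) eq = ≈-trans (⊕-cong (rows-null e (proj₁ (∧-true eq))) (⊛-congˡ (rows-null o (proj₂ (∧-true {allNull e} eq)))))
    (solveₛ (con (+ 0) :+ v0 :* con (+ 0)) (con (+ 0)) refl (Z ∷ []))

  minus-x : Elem
  minus-x = (+ 0 ∷ -[1+ 0 ] ∷ []) *ₑ one

  quotient-sound : ∀ v → isZero (powU 13 v +ₑ minus-x) ≡ true → u ↑ 13 ⊛ ⟪ v ⟫ₑ ≈ x
  quotient-sound v eq = minus-0 (begin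
    u ↑ 13 ⊛ ⟪ v ⟫ₑ ⊕ ⊖ x
      ≈⟨ ⊕-cong (powU-sound 13 v) (≈-trans (*ₑ-sound (+ 0 ∷ -[1+ 0 ] ∷ []) one)
           (≈-trans (⊛-congˡ one-sound) (solveₛ (poly (+ 0 ∷ -[1+ 0 ] ∷ []) v0 :* con (+ 1)) (:- v0) refl (x ∷ [])))) ⟨
    ⟪ powU 13 v ⟫ₑ ⊕ ⟪ minus-x ⟫ₑ
      ≈⟨ +ₑ-sound (powU 13 v) minus-x ⟨
    ⟪ powU 13 v +ₑ minus-x ⟫ₑ
      ≈⟨ isZero-sound (powU 13 v +ₑ minus-x) eq ⟩
    0ₛ ∎)

  dot : ∀ {n} → Vec Pol n → Vec Pol n → Pol
  dot []      []      = []
  dot (p ∷ v) (q ∷ w) = p *ₚ q +ₚ dot v w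

  -- The series w is arbitrary because each step of the induction moves one factor u into it. The
  -- cases w = 1 and w = Z give the two halves of the table.
  dot-sound : ∀ {n} (v T : Vec Pol n) w → (∀ k → U (w ⊛ u ↑ toℕ k) ≈ ev (lookup T k) u) → U (w ⊛ rows v) ≈ ev (dot v T) u
  dot-sound []      []      w p = ≈-trans (U-cong (solveₛ (v0 :* con (+ 0)) (con (+ 0)) refl (w ∷ []))) (mk λ n → trans (const-0 (n ℕ.* 13)) (sym (const-0 n)))
  dot-sound (p ∷ v) (q ∷ T) w pr = begin
    U (w ⊛ (ev p x ⊕ u ⊛ rows v))
      ≈⟨ U-cong (≈-trans (solveₛ (v0 :* (v1 :+ v2 :* v3)) (v1 :* (v0 :* con (+ 1)) :+ (v0 :* v2) :* v3) refl (w ∷ ev p x ∷ u ∷ rows v ∷ []))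
           (⊕-congʳ ((w ⊛ u) ⊛ rows v) (⊛-congʳ (≈-sym (V-ev p u))))) ⟩
    U (V (ev p u) ⊛ (w ⊛ 1ₛ)) ⊕ U ((w ⊛ u) ⊛ rows v)
      ≈⟨ ⊕-cong (≈-trans (U-V (ev p u) (w ⊛ 1ₛ)) (⊛-congˡ (pr zero)))
           (dot-sound v T (w ⊛ u) λ k → ≈-trans (U-cong (⊛-assoc w u (u ↑ toℕ k))) (pr (suc k))) ⟩
    ev p u ⊛ ev q u ⊕ ev (dot v T) u
      ≈⟨ ≈-trans (ev-+ (p *ₚ q) (dot v T) u) (⊕-congʳ (ev (dot v T) u) (ev-* p q u)) ⟨
    ev (p *ₚ q +ₚ dot v T) u ∎

  act : Pol → Elem → Elem
  act []      v = [] *ₑ v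
  act (c ∷ p) v = (c ∷ []) *ₑ v +ₑ mulU (act p v)

  act-sound : ∀ p v → ⟪ act p v ⟫ₑ ≈ ev p u ⊛ ⟪ v ⟫ₑ
  act-sound []      v = *ₑ-sound [] v
  act-sound (c ∷ p) v = begin
    ⟪ (c ∷ []) *ₑ v +ₑ mulU (act p v) ⟫ₑ                      ≈⟨ +ₑ-sound ((c ∷ []) *ₑ v) (mulU (act p v)) ⟩
    ⟪ (c ∷ []) *ₑ v ⟫ₑ ⊕ ⟪ mulU (act p v) ⟫ₑ                  ≈⟨ ⊕-cong (*ₑ-sound (c ∷ []) v) (≈-trans (mulU-sound (act p v)) (⊛-congˡ (act-sound p v))) ⟩
    (const c ⊕ x ⊛ 0ₛ) ⊛ ⟪ v ⟫ₑ ⊕ u ⊛ (ev p u ⊛ ⟪ v ⟫ₑ)       ≈⟨ solveₛ ((v0 :+ v1 :* con (+ 0)) :* v2 :+ v3 :* (v4 :* v2)) ((v0 :+ v3 :* v4) :* v2) refl (const c ∷ x ∷ ⟪ v ⟫ₑ ∷ u ∷ ev p u ∷ []) ⟩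
    (const c ⊕ u ⊛ ev p u) ⊛ ⟪ v ⟫ₑ                           ∎

  U-table : Elem → Elem → Pol
  U-table (t , s) (e , o) = dot e t +ₚ dot o s

  -- dilate (+ 1) turns p into p(13u); contract is only a guess for the inverse, checked where it is used.
  dilate : ℤ → Pol → Pol
  dilate d []      = []
  dilate d (c ∷ p) = d ℤ.* c ∷ dilate (+ 13 ℤ.* d) p

  contract : ℕ → Pol → Pol
  contract d []      = []
  -- For the positive d that occur, `suc (d ∸ 1)` is d in a form that is visibly non-zero.
  contract d (c ∷ p) = c ℤ./ℕ suc (d ∸ 1) ∷ contract (13 ℕ.* d) p

  y : Series
  y = const (+ 13) ⊛ u

  dilate-sound : ∀ p d w → const d ⊛ ev p (const (+ 13) ⊛ w) ≈ ev (dilate d p) w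
  dilate-sound []      d w = solveₛ (v0 :* con (+ 0)) (con (+ 0)) refl (const d ∷ [])
  dilate-sound (c ∷ p) d w = begin
    const d ⊛ (const c ⊕ const (+ 13) ⊛ w ⊛ ev p (const (+ 13) ⊛ w))
      ≈⟨ solveₛ (v0 :* (v1 :+ con (+ 13) :* v2 :* v3)) (v0 :* v1 :+ v2 :* ((con (+ 13) :* v0) :* v3)) refl (const d ∷ const c ∷ w ∷ ev p (const (+ 13) ⊛ w) ∷ []) ⟩
    const d ⊛ const c ⊕ w ⊛ ((const (+ 13) ⊛ const d) ⊛ ev p (const (+ 13) ⊛ w))
      ≈⟨ ⊕-cong (const-* d c) (⊛-congˡ (⊛-congʳ (const-* (+ 13) d))) ⟨
    const (d ℤ.* c) ⊕ w ⊛ (const (+ 13 ℤ.* d) ⊛ ev p (const (+ 13) ⊛ w))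
      ≈⟨ ⊕-congˡ (const (d ℤ.* c)) (⊛-congˡ (dilate-sound p (+ 13 ℤ.* d) w)) ⟩
    ev (dilate d (c ∷ p)) w ∎

  dilate-1 : ∀ p w → ev (dilate (+ 1) p) w ≈ ev p (const (+ 13) ⊛ w)
  dilate-1 p w = ≈-trans (≈-sym (dilate-sound p (+ 1) w)) (⊛-identityˡ _)

  -- Division by 1 + X d as power series; the result is only a guess, checked where it is used.
  quotient : ℕ → Pol → Pol → Pol
  quotient zero    d p       = []
  quotient (suc n) d []      = []
  quotient (suc n) d (c ∷ p) = c ∷ quotient n d (p +ₚ ((ℤ.- c) ∷ []) *ₚ d)

  denominator : Pol
  denominator = lB *ₚ l6

  -- `denominator` has degree 8 and constant term 1. An exact quotient therefore has 8 coefficients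
  -- fewer and is found from the bottom without fractions.
  divide : Pol → Pol
  divide p = quotient (List.length p ∸ 8) (List.drop 1 denominator) p

  equal : Pol → Pol → Bool
  equal p q = null {1} (p +ₚ (-[1+ 0 ] ∷ []) *ₚ q)

  equal-sound : ∀ p q w → equal p q ≡ true → ev p w ≈ ev q w
  equal-sound p q w eq = minus-0 (≈-trans (⊕-congˡ (ev p w) (≈-sym (≈-trans (ev-* (-[1+ 0 ] ∷ []) q w)
      (solveₛ (poly (-[1+ 0 ] ∷ []) v1 :* v0) (:- v0) refl (ev q w ∷ w ∷ [])))))
    (≈-trans (≈-sym (ev-+ p ((-[1+ 0 ] ∷ []) *ₚ q) w)) (ev-null (p +ₚ (-[1+ 0 ] ∷ []) *ₚ q) w eq)))

  leading-coefficient : Pol → ℤ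
  leading-coefficient []      = + 0
  leading-coefficient (c ∷ _) = c ℤ./ℕ 169

  -- `U-W` leaves a factor `denominator` on the left. So U (Z w) has to be `denominator` times an
  -- element of u ℤ[13u], and U w has to be 169 times `denominator` times an element of ℤ + ℤu + ℤu²
  -- + u³ ℤ[13u].
  testZ testW : Elem → Elem → Bool
  testZ T w = check (U-table T (mulZ w))
    where
    check : Pol → Bool
    check n = equal n (denominator *ₚ (+ 0 ∷ dilate (+ 1) (contract 1 (List.drop 1 (divide n)))))
  testW T w = check (U-table T w)
    where
    check′ : Pol → Pol → Bool
    check′ n p = equal n ((+ 169 ∷ []) *ₚ (denominator *ₚ
      (leading-coefficient p ∷ leading-coefficient (List.drop 1 p) ∷ leading-coefficient (List.drop 2 p) ∷ dilate (+ 1) (contract 169 (List.drop 3 p)))))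
    check : Pol → Bool
    check n = check′ n (divide n)

  mulY : Elem → Elem
  mulY v = (+ 13 ∷ []) *ₑ mulU v

  tests : (Elem → Bool) → ℕ → Elem → Bool
  tests t zero    w = true
  tests t (suc n) w = t w ∧ tests t n (mulY w)

  -- The traces are 13 times the values of U. The coefficientwise division by 13 is confirmed to be
  -- exact by `consistent`.
  table : Elem → Elem
  table (t , s) = Vec.map (List.map (ℤ._/ℕ 13)) t , Vec.map (List.map (ℤ._/ℕ 13)) s

  consistent : Elem → Elem → Bool
  consistent tr T = isZero d
    where
    d : Elem
    d = tr +ₑ (-[1+ 12 ] ∷ []) *ₑ T

  -- Here f stands for W. The generators are 1, u, u² over ℤ and u³ over ℤ[13u] for the lattice X,
  -- and u over ℤ[13u] for X′. Over ℤ[13u], thirteen powers of 13u are tested, the degree of its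
  -- integral equation.
  battery : Elem → Elem → Bool
  battery T f = testZ T f ∧ (testZ T (mulU f) ∧ (testZ T (mulU (mulU f)) ∧ (tests (testZ T) 13 (mulU (mulU (mulU f))) ∧ tests (testW T) 13 (mulU f))))

  consistent-battery : Elem → Elem → Elem → Bool
  consistent-battery tr f T = consistent tr T ∧ battery T f

  battery-of : Elem → Elem → Bool
  battery-of tr f = consistent-battery tr f (table tr)

  consistent-sound : ∀ tr T → consistent tr T ≡ true →
    (∀ k → ev (lookup (proj₁ tr) k) u ≈ const (+ 13) ⊛ ev (lookup (proj₁ T) k) u) ×
    (∀ k → ev (lookup (proj₂ tr) k) u ≈ const (+ 13) ⊛ ev (lookup (proj₂ T) k) u)
  consistent-sound (t , s) (t′ , s′) eq = go t t′ (proj₁ (∧-true eq)) , go s s′ (proj₂ (∧-true {allNull (Vec.zipWith _+ₚ_ t (Vec.map ((-[1+ 12 ] ∷ []) *ₚ_) t′))} eq))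
    where
    go : ∀ {n} (v w : Vec Pol n) → allNull (Vec.zipWith _+ₚ_ v (Vec.map ((-[1+ 12 ] ∷ []) *ₚ_) w)) ≡ true →
         ∀ k → ev (lookup v k) u ≈ const (+ 13) ⊛ ev (lookup w k) u
    go (p ∷ v) (q ∷ w) eq zero = minus-0 (≈-trans (⊕-congˡ (ev p u) (≈-sym (≈-trans (ev-* (-[1+ 12 ] ∷ []) q u)
        (solveₛ (poly (-[1+ 12 ] ∷ []) v1 :* v0) (:- (con (+ 13) :* v0)) refl (ev q u ∷ u ∷ [])))))
      (≈-trans (≈-sym (ev-+ p ((-[1+ 12 ] ∷ []) *ₚ q) u)) (ev-null (p +ₚ (-[1+ 12 ] ∷ []) *ₚ q) u (proj₁ (∧-true eq)))))
    go (p ∷ v) (q ∷ w) eq (suc k) = go v w (proj₂ (∧-true {null {1} (p +ₚ (-[1+ 12 ] ∷ []) *ₚ q)} eq)) k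

  Table : Elem → Set
  Table T = (∀ k → U (u ↑ toℕ {7} k) ≈ ev (lookup (proj₁ T) k) u) × (∀ k → U (Z ⊛ u ↑ toℕ {6} k) ≈ ev (lookup (proj₂ T) k) u)

  table-sound : ∀ tr → (∀ k → const (+ 13) ⊛ U (u ↑ toℕ {7} k) ≈ ev (lookup (proj₁ tr) k) u) →
    (∀ k → const (+ 13) ⊛ U (Z ⊛ u ↑ toℕ {6} k) ≈ ev (lookup (proj₂ tr) k) u) → ∀ T → consistent tr T ≡ true → Table T
  table-sound tr even odd T eq =
    (λ k → cancelˡ (const (+ 13)) (λ ()) (≈-trans (even k) (proj₁ (consistent-sound tr T eq) k))) ,
    (λ k → cancelˡ (const (+ 13)) (λ ()) (≈-trans (odd k) (proj₂ (consistent-sound tr T eq) k)))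

  U-table-sound : ∀ T → Table T → ∀ v → U ⟪ v ⟫ₑ ≈ ev (U-table T v) u
  U-table-sound (t , s) (pt , ps) (e , o) = begin
    U (rows e) ⊕ U (Z ⊛ rows o)
      ≈⟨ ⊕-cong (≈-trans (U-cong (≈-sym (⊛-identityˡ (rows e)))) (dot-sound e t 1ₛ λ k → ≈-trans (U-cong (⊛-identityˡ _)) (pt k))) (dot-sound o s Z ps) ⟩
    ev (dot e t) u ⊕ ev (dot o s) u
      ≈⟨ ev-+ (dot e t) (dot o s) u ⟨
    ev (dot e t +ₚ dot o s) u ∎

  form : ℤ → ℤ → ℤ → Pol → Series
  form c₀ c₁ c₂ s = const c₀ ⊕ u ⊛ (const c₁ ⊕ u ⊛ (const c₂ ⊕ u ⊛ ev s y))

  -- The lattices W u ℤ[13u] and W (ℤ + ℤu + ℤu² + u³ ℤ[13u]).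
  X′ 𝕏 169𝕏 : Series → Set
  X′ f = ∃ λ s → f ≈ W ⊛ (u ⊛ ev s y)
  𝕏 f = Σ ℤ λ c₀ → Σ ℤ λ c₁ → Σ ℤ λ c₂ → ∃ λ s → f ≈ W ⊛ form c₀ c₁ c₂ s
  169𝕏 f = ∃ λ g → 𝕏 g × f ≈ const (+ 169) ⊛ g

  testZ-sound : ∀ T w → Table T → testZ T w ≡ true → ∃ λ s → U (Z ⊛ ⟪ w ⟫ₑ) ≈ ev denominator u ⊛ (u ⊛ ev s y)
  testZ-sound T w pT eq = contract 1 (List.drop 1 (divide n)) , (begin
    U (Z ⊛ ⟪ w ⟫ₑ)                                           ≈⟨ U-cong (mulZ-sound w) ⟨
    U ⟪ mulZ w ⟫ₑ                                            ≈⟨ U-table-sound T pT (mulZ w) ⟩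
    ev n u                                                   ≈⟨ equal-sound n (denominator *ₚ (+ 0 ∷ dilate (+ 1) s)) u eq ⟩
    ev (denominator *ₚ (+ 0 ∷ dilate (+ 1) s)) u             ≈⟨ ev-* denominator (+ 0 ∷ dilate (+ 1) s) u ⟩
    ev denominator u ⊛ (const (+ 0) ⊕ u ⊛ ev (dilate (+ 1) s) u)   ≈⟨ ⊛-congˡ (⊕-congˡ 0ₛ (⊛-congˡ (dilate-1 s u))) ⟩
    ev denominator u ⊛ (const (+ 0) ⊕ u ⊛ ev s y)            ≈⟨ solveₛ (v0 :* (con (+ 0) :+ v1)) (v0 :* v1) refl (ev denominator u ∷ u ⊛ ev s y ∷ []) ⟩
    ev denominator u ⊛ (u ⊛ ev s y)                          ∎)
    where
    n s : Pol
    n = U-table T (mulZ w)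
    s = contract 1 (List.drop 1 (divide n))

  equal-form : ∀ n c₀ c₁ c₂ s → equal n ((+ 169 ∷ []) *ₚ (denominator *ₚ (c₀ ∷ c₁ ∷ c₂ ∷ dilate (+ 1) s))) ≡ true →
               ev n u ≈ const (+ 169) ⊛ (ev denominator u ⊛ form c₀ c₁ c₂ s)
  equal-form n c₀ c₁ c₂ s eq = begin
    ev n u                                                   ≈⟨ equal-sound n ((+ 169 ∷ []) *ₚ (denominator *ₚ l)) u eq ⟩
    ev ((+ 169 ∷ []) *ₚ (denominator *ₚ l)) u                ≈⟨ ≈-trans (ev-* (+ 169 ∷ []) (denominator *ₚ l) u) (⊛-congˡ (ev-* denominator l u)) ⟩
    (const (+ 169) ⊕ u ⊛ 0ₛ) ⊛ (ev denominator u ⊛ ev l u)   ≈⟨ ⊛-cong (solveₛ (con (+ 169) :+ v0 :* con (+ 0)) (con (+ 169)) refl (u ∷ []))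
                                                                  (⊛-congˡ (⊕-congˡ (const c₀) (⊛-congˡ (⊕-congˡ (const c₁) (⊛-congˡ (⊕-congˡ (const c₂) (⊛-congˡ (dilate-1 s u)))))))) ⟩
    const (+ 169) ⊛ (ev denominator u ⊛ form c₀ c₁ c₂ s)     ∎
    where
    l : Pol
    l = c₀ ∷ c₁ ∷ c₂ ∷ dilate (+ 1) s

  testW-sound : ∀ T w → Table T → testW T w ≡ true →
    Σ ℤ λ c₀ → Σ ℤ λ c₁ → Σ ℤ λ c₂ → ∃ λ s → U ⟪ w ⟫ₑ ≈ const (+ 169) ⊛ (ev denominator u ⊛ form c₀ c₁ c₂ s)
  testW-sound T w pT eq = leading-coefficient q , leading-coefficient (List.drop 1 q) , leading-coefficient (List.drop 2 q) , contract 169 (List.drop 3 q) ,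
    ≈-trans (U-table-sound T pT w) (equal-form n (leading-coefficient q) (leading-coefficient (List.drop 1 q)) (leading-coefficient (List.drop 2 q)) (contract 169 (List.drop 3 q)) eq)
    where
    n q : Pol
    n = U-table T w
    q = divide n

  BaseCases : Set
  BaseCases = X′ (U (W ⊛ (Z ⊛ 1ₛ))) × X′ (U (W ⊛ (Z ⊛ (u ⊛ 1ₛ)))) × X′ (U (W ⊛ (Z ⊛ (u ⊛ (u ⊛ 1ₛ))))) ×
    (∀ j → j ℕ.< 13 → X′ (U (W ⊛ (Z ⊛ (y ↑ j ⊛ (u ⊛ (u ⊛ (u ⊛ 1ₛ)))))))) × (∀ j → j ℕ.< 13 → 169𝕏 (U (W ⊛ (y ↑ j ⊛ (u ⊛ 1ₛ)))))

  module _ (quot : Elem) (h-sound : u ↑ 13 ⊛ ⟪ quot ⟫ₑ ≈ x) where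

    private
      h : Series
      h = ⟪ quot ⟫ₑ

    -- w represents W g up to the factor from U-W.
    Represents : Elem → Series → Set
    Represents w g = ⟪ w ⟫ₑ ≈ ev l6 u ⊛ ev lB* u ⊛ (h ⊛ g)

    module _ {w g} (rep : Represents w g) where

      represents-mulU : Represents (mulU w) (u ⊛ g)
      represents-mulU = ≈-trans (mulU-sound w) (≈-trans (⊛-congˡ rep)
        (solveₛ (v0 :* (v1 :* (v2 :* v3))) (v1 :* (v2 :* (v0 :* v3))) refl (u ∷ ev l6 u ⊛ ev lB* u ∷ h ∷ g ∷ [])))

      represents-mulY : Represents (mulY w) (y ⊛ g)
      represents-mulY = ≈-trans (*ₑ-sound (+ 13 ∷ []) (mulU w)) (≈-trans (⊛-congˡ represents-mulU)
        (solveₛ ((con (+ 13) :+ v4 :* con (+ 0)) :* (v1 :* (v2 :* (v0 :* v3)))) (v1 :* (v2 :* (con (+ 13) :* v0 :* v3))) refl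
          (u ∷ ev l6 u ⊛ ev lB* u ∷ h ∷ g ∷ x ∷ [])))

      private
        divide-by : ∀ {f k} → ev denominator u ⊛ f ≈ ev denominator u ⊛ k → f ≈ k
        divide-by = cancelˡ (ev denominator u) (λ ())

        times-denominator : ∀ g′ v → ev l6 u ⊛ ev lB* u ⊛ (h ⊛ g′) ≈ v → ev denominator u ⊛ U (W ⊛ g′) ≈ W ⊛ U v
        times-denominator g′ v p = ≈-trans (⊛-congʳ (ev-* lB l6 u)) (≈-trans (U-W h g′ h-sound) (⊛-congˡ (U-cong p)))

      testZ-lattice : ∀ T → Table T → testZ T w ≡ true → X′ (U (W ⊛ (Z ⊛ g)))
      testZ-lattice T pT eq = go (testZ-sound T w pT eq)
        where
        go : (∃ λ s → U (Z ⊛ ⟪ w ⟫ₑ) ≈ ev denominator u ⊛ (u ⊛ ev s y)) → X′ (U (W ⊛ (Z ⊛ g)))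
        go (s , p) = s , divide-by (begin
          ev denominator u ⊛ U (W ⊛ (Z ⊛ g))
            ≈⟨ times-denominator (Z ⊛ g) (Z ⊛ ⟪ w ⟫ₑ) (≈-trans (solveₛ (v0 :* (v1 :* (v2 :* v3))) (v2 :* (v0 :* (v1 :* v3))) refl (ev l6 u ⊛ ev lB* u ∷ h ∷ Z ∷ g ∷ [])) (⊛-congˡ (≈-sym rep))) ⟩
          W ⊛ U (Z ⊛ ⟪ w ⟫ₑ)
            ≈⟨ ⊛-congˡ p ⟩
          W ⊛ (ev denominator u ⊛ (u ⊛ ev s y))
            ≈⟨ solveₛ (v0 :* (v1 :* v2)) (v1 :* (v0 :* v2)) refl (W ∷ ev denominator u ∷ u ⊛ ev s y ∷ []) ⟩
          ev denominator u ⊛ (W ⊛ (u ⊛ ev s y)) ∎)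

      testW-lattice : ∀ T → Table T → testW T w ≡ true → 169𝕏 (U (W ⊛ g))
      testW-lattice T pT eq = go (testW-sound T w pT eq)
        where
        go : (Σ ℤ λ c₀ → Σ ℤ λ c₁ → Σ ℤ λ c₂ → ∃ λ s → U ⟪ w ⟫ₑ ≈ const (+ 169) ⊛ (ev denominator u ⊛ form c₀ c₁ c₂ s)) → 169𝕏 (U (W ⊛ g))
        go (c₀ , c₁ , c₂ , s , p) = W ⊛ form c₀ c₁ c₂ s , (c₀ , c₁ , c₂ , s , ≈-refl) , divide-by (begin
          ev denominator u ⊛ U (W ⊛ g)                                       ≈⟨ times-denominator g ⟪ w ⟫ₑ (≈-sym rep) ⟩
          W ⊛ U ⟪ w ⟫ₑ                                                       ≈⟨ ⊛-congˡ p ⟩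
          W ⊛ (const (+ 169) ⊛ (ev denominator u ⊛ form c₀ c₁ c₂ s))         ≈⟨ solveₛ (v0 :* (con (+ 169) :* (v1 :* v2))) (v1 :* (con (+ 169) :* (v0 :* v2))) refl (W ∷ ev denominator u ∷ form c₀ c₁ c₂ s ∷ []) ⟩
          ev denominator u ⊛ (const (+ 169) ⊛ (W ⊛ form c₀ c₁ c₂ s))         ∎)

    tests-sound : ∀ t n w g → Represents w g → tests t n w ≡ true → ∀ j → j ℕ.< n → ∃ λ w′ → Represents w′ (y ↑ j ⊛ g) × t w′ ≡ true
    tests-sound t (suc n) w g rep eq zero    lt         = w , ≈-trans rep (⊛-congˡ (⊛-congˡ (≈-sym (⊛-identityˡ g)))) , proj₁ (∧-true eq)
    tests-sound t (suc n) w g rep eq (suc j) (ℕ.s≤s lt) = go (tests-sound t n (mulY w) (y ⊛ g) (represents-mulY {w} {g} rep) (proj₂ (∧-true {t w} eq)) j lt)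
      where
      go : (∃ λ w′ → Represents w′ (y ↑ j ⊛ (y ⊛ g)) × t w′ ≡ true) → ∃ λ w′ → Represents w′ (y ↑ suc j ⊛ g) × t w′ ≡ true
      go (w′ , rep′ , eq′) = w′ , ≈-trans rep′ (⊛-congˡ (⊛-congˡ (solveₛ (v0 :* (v1 :* v2)) (v1 :* v0 :* v2) refl (y ↑ j ∷ y ∷ g ∷ [])))) , eq′

    act-represents : Represents (act (l6 *ₚ lB*) quot) 1ₛ
    act-represents = ≈-trans (act-sound (l6 *ₚ lB*) quot) (≈-trans (⊛-congʳ (ev-* l6 lB* u)) (⊛-congˡ (≈-sym (⊛-identityʳ h))))

    Passes : Elem → Elem → Set
    Passes T f = testZ T f ≡ true × testZ T (mulU f) ≡ true × testZ T (mulU (mulU f)) ≡ true ×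
      tests (testZ T) 13 (mulU (mulU (mulU f))) ≡ true × tests (testW T) 13 (mulU f) ≡ true

    battery-passes : ∀ T f → battery T f ≡ true → Passes T f
    battery-passes T f eq = proj₁ s₀ , proj₁ s₁ , proj₁ s₂ , proj₁ s₃ , proj₂ s₃
      where
      s₀ = ∧-true {testZ T f} eq
      s₁ = ∧-true {testZ T (mulU f)} (proj₂ s₀)
      s₂ = ∧-true {testZ T (mulU (mulU f))} (proj₂ s₁)
      s₃ = ∧-true {tests (testZ T) 13 (mulU (mulU (mulU f)))} (proj₂ s₂)

    battery-sound : ∀ T f → Table T → Represents f 1ₛ → Passes T f → BaseCases
    battery-sound T f pT r₀ (t₀ , t₁ , t₂ , t₃ , t₄) = testZ-lattice {f} {1ₛ} r₀ T pT t₀ , testZ-lattice {mulU f} {u ⊛ 1ₛ} r₁ T pT t₁ , testZ-lattice {mulU (mulU f)} {u ⊛ (u ⊛ 1ₛ)} r₂ T pT t₂ ,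
      (λ j j<13 → zs {y ↑ j ⊛ (u ⊛ (u ⊛ (u ⊛ 1ₛ)))} (tests-sound (testZ T) 13 (mulU (mulU (mulU f))) (u ⊛ (u ⊛ (u ⊛ 1ₛ))) (represents-mulU {mulU (mulU f)} {u ⊛ (u ⊛ 1ₛ)} r₂) t₃ j j<13)) ,
      (λ j j<13 → ws {y ↑ j ⊛ (u ⊛ 1ₛ)} (tests-sound (testW T) 13 (mulU f) (u ⊛ 1ₛ) r₁ t₄ j j<13))
      where
      r₁ : Represents (mulU f) (u ⊛ 1ₛ)
      r₁ = represents-mulU {f} {1ₛ} r₀
      r₂ : Represents (mulU (mulU f)) (u ⊛ (u ⊛ 1ₛ))
      r₂ = represents-mulU {mulU f} {u ⊛ 1ₛ} r₁
      zs : ∀ {g} → (∃ λ w → Represents w g × testZ T w ≡ true) → X′ (U (W ⊛ (Z ⊛ g)))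
      zs {g} (w , rep , t) = testZ-lattice {w} {g} rep T pT t
      ws : ∀ {g} → (∃ λ w → Represents w g × testW T w ≡ true) → 169𝕏 (U (W ⊛ g))
      ws {g} (w , rep , t) = testW-lattice {w} {g} rep T pT t

    battery-of-sound : ∀ tr f → (∀ T → consistent tr T ≡ true → Table T) → Represents f 1ₛ → battery-of tr f ≡ true → BaseCases
    battery-of-sound tr f sound rep eq = battery-sound (table tr) f (sound (table tr) (proj₁ s)) rep (battery-passes (table tr) f (proj₂ s))
      where
      s : (consistent tr (table tr) ≡ true) × (battery (table tr) f ≡ true)
      s = ∧-true {consistent tr (table tr)} eq

  -- Stated for arbitrary data, so that the concrete coefficients enter through two boolean checks
  -- alone.
  base-cases-from : ∀ quot tr → isZero (powU 13 quot +ₑ minus-x) ≡ true →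
    (∀ T → consistent tr T ≡ true → Table T) → battery-of tr (act (l6 *ₚ lB*) quot) ≡ true → BaseCases
  base-cases-from quot tr eq sound eq′ = battery-of-sound quot h-sound tr (act (l6 *ₚ lB*) quot) sound (act-represents quot h-sound) eq′
    where
    h-sound : u ↑ 13 ⊛ ⟪ quot ⟫ₑ ≈ x
    h-sound = quotient-sound quot eq

  abstract
    -- Opaque, because the witnesses are large polynomials and everything that follows needs only
    -- that they exist.
    base-cases : BaseCases
    base-cases = base-cases-from x-over-u¹³ (traces 13) refl (table-sound (traces 13) U-even U-odd) refl

open LatticeBase

-- From the generators to the whole lattices.

open SetoidReasoning (CommutativeRing.setoid seriesRing)

-- The equation of 13u over ℤ[13x].
Ψ : List (List ℤ)
Ψ =
    (+ 0 ∷ + 23298085122481 ∷ [])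
  ∷ (+ 0 ∷ + 46596170244962 ∷ + 1792160394037 ∷ [])
  ∷ (+ 0 ∷ + 44804009850925 ∷ + 3584320788074 ∷ + 137858491849 ∷ [])
  ∷ (+ 0 ∷ + 27020264402404 ∷ + 3446462296225 ∷ + 275716983698 ∷ + 10604499373 ∷ [])
  ∷ (+ 0 ∷ + 11283187332872 ∷ + 2078481877108 ∷ + 265112484325 ∷ + 21208998746 ∷ + 815730721 ∷ [])
  ∷ (+ 0 ∷ + 3409754413780 ∷ + 867937487144 ∷ + 159883221316 ∷ + 20393268025 ∷ + 1631461442 ∷ + 62748517 ∷ [])
  ∷ (+ 0 ∷ + 758378576462 ∷ + 262288801060 ∷ + 66764422088 ∷ + 12298709332 ∷ + 1568712925 ∷ + 125497034 ∷ + 4826809 ∷ [])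
  ∷ (+ 0 ∷ + 123855918940 ∷ + 58336813574 ∷ + 20176061620 ∷ + 5135724776 ∷ + 946054564 ∷ + 120670225 ∷ + 9653618 ∷ + 371293 ∷ [])
  ∷ (+ 0 ∷ + 14548002326 ∷ + 9527378380 ∷ + 4487447198 ∷ + 1552004740 ∷ + 395055752 ∷ + 72773428 ∷ + 9282325 ∷ + 742586 ∷ + 28561 ∷ [])
  ∷ (+ 0 ∷ + 1174999540 ∷ + 1119077102 ∷ + 732875260 ∷ + 345188246 ∷ + 119384980 ∷ + 30388904 ∷ + 5597956 ∷ + 714025 ∷ + 57122 ∷ + 2197 ∷ [])
  ∷ (+ 0 ∷ + 59916584 ∷ + 90384580 ∷ + 86082854 ∷ + 56375020 ∷ + 26552942 ∷ + 9183460 ∷ + 2337608 ∷ + 430612 ∷ + 54925 ∷ + 4394 ∷ + 169 ∷ [])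
  ∷ (+ 0 ∷ + 1623076 ∷ + 4608968 ∷ + 6952660 ∷ + 6621758 ∷ + 4336540 ∷ + 2042534 ∷ + 706420 ∷ + 179816 ∷ + 33124 ∷ + 4225 ∷ + 338 ∷ + 13 ∷ [])
  ∷ (+ 0 ∷ + 15145 ∷ + 124852 ∷ + 354536 ∷ + 534820 ∷ + 509366 ∷ + 333580 ∷ + 157118 ∷ + 54340 ∷ + 13832 ∷ + 2548 ∷ + 325 ∷ + 26 ∷ + 1 ∷ [])
  ∷ []

yrows : List Pol → Series
yrows []       = 0ₛ
yrows (p ∷ ps) = ev p (const (+ 13) ⊛ x) ⊕ y ⊛ yrows ps

-- Multiplied by 13¹³, a term c xⁱ uᵏ of the modular equation becomes c 13^(13-i-k) (13x)ⁱ (13u)ᵏ.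
-- For i + k > 13 the coefficients in `Φ` contain the missing powers of 13.
y-integral : y ↑ 13 ≈ yrows Ψ
y-integral = begin
  y ↑ 13
    ≈⟨ solveₛ ((con (+ 13) :* v0) :^ 13) (con (+ 13) :^ 13 :* v0 :^ 13) refl (u ∷ []) ⟩
  const (+ 13) ↑ 13 ⊛ u ↑ 13
    ≈⟨ ⊛-congˡ (minus-0 modular-equation) ⟨
  const (+ 13) ↑ 13 ⊛ ⟦ rowsE Φ v1 v0 ⟧ (x ∷ u ∷ [])
    ≈⟨ solveₛ (con (+ 13) :^ 13 :* rowsE Φ v1 v0) (rowsE Ψ (con (+ 13) :* v1) (con (+ 13) :* v0)) refl (x ∷ u ∷ []) ⟩
  yrows Ψ ∎

V-y : V y ≈ const (+ 13) ⊛ x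
V-y = ≈-trans (V-⊛ (const (+ 13)) u) (⊛-congʳ (V-const (+ 13)))

↑-+ : ∀ f i j → f ↑ (i ℕ.+ j) ≈ f ↑ i ⊛ f ↑ j
↑-+ f zero    j = ≈-sym (⊛-identityˡ (f ↑ j))
↑-+ f (suc i) j = ≈-trans (⊛-congˡ (↑-+ f i j)) (≈-sym (⊛-assoc f (f ↑ i) (f ↑ j)))

record Lattice (M : Series → Set) : Set where
  field
    resp : ∀ {f g} → f ≈ g → M f → M g
    zero-closed : M 0ₛ
    +-closed : ∀ {f g} → M f → M g → M (f ⊕ g)
    y-closed : ∀ p {f} → M f → M (ev p y ⊛ f)

module _ {M : Series → Set} (lattice : Lattice M) where
  open Lattice lattice

  -- Because V (13u) = 13x, coefficients in ℤ[13x] leave U as elements of ℤ[13u], and M is closed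
  -- under those.
  U-yrows : ∀ ps w → (∀ k → k ℕ.< List.length ps → M (U (y ↑ k ⊛ w))) → M (U (yrows ps ⊛ w))
  U-yrows []       w m = resp (≈-sym (≈-trans (U-cong (solveₛ (con (+ 0) :* v0) (con (+ 0)) refl (w ∷ []))) (mk λ n → trans (const-0 (n ℕ.* 13)) (sym (const-0 n))))) zero-closed
  U-yrows (p ∷ ps) w m = resp (≈-sym (begin
    U ((ev p (const (+ 13) ⊛ x) ⊕ y ⊛ yrows ps) ⊛ w)
      ≈⟨ U-cong (≈-trans (solveₛ ((v0 :+ v1 :* v2) :* v3) (v0 :* (con (+ 1) :* v3) :+ v2 :* (v1 :* v3)) refl (ev p (const (+ 13) ⊛ x) ∷ y ∷ yrows ps ∷ w ∷ []))
           (⊕-congʳ (yrows ps ⊛ (y ⊛ w)) (⊛-congʳ (≈-sym (≈-trans (V-ev p y) (ev-cong p V-y)))))) ⟩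
    U (V (ev p y) ⊛ (1ₛ ⊛ w)) ⊕ U (yrows ps ⊛ (y ⊛ w))
      ≈⟨ ⊕-congʳ (U (yrows ps ⊛ (y ⊛ w))) (U-V (ev p y) (1ₛ ⊛ w)) ⟩
    ev p y ⊛ U (1ₛ ⊛ w) ⊕ U (yrows ps ⊛ (y ⊛ w)) ∎))
    (+-closed (y-closed p (m 0 (ℕ.s≤s ℕ.z≤n)))
      (U-yrows ps (y ⊛ w) λ k k<n → resp (U-cong (solveₛ (v0 :* v1 :* v2) (v1 :* (v0 :* v2)) refl (y ∷ y ↑ k ∷ w ∷ []))) (m (suc k) (ℕ.s≤s k<n))))

  -- Strong induction: multiplied by yⁱ, the integral equation expresses y^(13+i) through the
  -- thirteen powers just below it.
  U-powers : ∀ w → (∀ j → j ℕ.< 13 → M (U (y ↑ j ⊛ w))) → ∀ j → M (U (y ↑ j ⊛ w))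
  U-powers w base j = go (suc j) j (ℕₚ.n<1+n j)
    where
    go : ∀ N j → j ℕ.< N → M (U (y ↑ j ⊛ w))
    go (suc N) j (ℕ.s≤s j≤N) with j ℕₚ.<? 13
    ... | yes j<13 = base j j<13
    ... | no j≮13  = resp (U-cong eq) (U-yrows Ψ (y ↑ i ⊛ w) λ k k<13 →
        resp (U-cong (≈-trans (⊛-congʳ (↑-+ y k i)) (⊛-assoc (y ↑ k) (y ↑ i) w))) (go N (k ℕ.+ i) (ℕₚ.<-≤-trans (ℕₚ.+-monoˡ-< i k<13) (ℕₚ.≤-trans (ℕₚ.≤-reflexive 13+i) j≤N))))
      where
      i = j ∸ 13
      13+i : 13 ℕ.+ i ≡ j
      13+i = ℕₚ.m+[n∸m]≡n (ℕₚ.≮⇒≥ j≮13)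
      eq : yrows Ψ ⊛ (y ↑ i ⊛ w) ≈ y ↑ j ⊛ w
      eq = ≈-trans (⊛-congʳ (≈-sym y-integral)) (≈-trans (≈-sym (⊛-assoc (y ↑ 13) (y ↑ i) w))
        (⊛-congʳ (≈-trans (≈-sym (↑-+ y 13 i)) (mk λ n → cong (λ t → (y ↑ t) n) 13+i))))

  U-polynomial : ∀ s w → (∀ j → M (U (y ↑ j ⊛ w))) → M (U (ev s y ⊛ w))
  U-polynomial []      w m = U-yrows [] w (λ k ())
  U-polynomial (c ∷ s) w m = resp (≈-sym (begin
    U ((const c ⊕ y ⊛ ev s y) ⊛ w)
      ≈⟨ U-cong (≈-trans (solveₛ ((v0 :+ v1 :* v2) :* v3) (v0 :* (con (+ 1) :* v3) :+ v2 :* (v1 :* v3)) refl (const c ∷ y ∷ ev s y ∷ w ∷ []))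
           (⊕-congʳ (ev s y ⊛ (y ⊛ w)) (⊛-congʳ (≈-sym (V-const c))))) ⟩
    U (V (const c) ⊛ (1ₛ ⊛ w)) ⊕ U (ev s y ⊛ (y ⊛ w))
      ≈⟨ ⊕-congʳ (U (ev s y ⊛ (y ⊛ w))) (≈-trans (U-V (const c) (1ₛ ⊛ w)) (⊛-congʳ (solveₛ v0 (v0 :+ v1 :* con (+ 0)) refl (const c ∷ y ∷ [])))) ⟩
    ev (c ∷ []) y ⊛ U (1ₛ ⊛ w) ⊕ U (ev s y ⊛ (y ⊛ w)) ∎))
    (+-closed (y-closed (c ∷ []) (m 0))
      (U-polynomial s (y ⊛ w) λ j → resp (U-cong (solveₛ (v0 :* v1 :* v2) (v1 :* (v0 :* v2)) refl (y ∷ y ↑ j ∷ w ∷ []))) (m (suc j))))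

X′-lattice : Lattice X′
X′-lattice = record
  { resp = λ { p (s , q) → s , ≈-trans (≈-sym p) q }
  ; zero-closed = [] , solveₛ (con (+ 0)) (v0 :* (v1 :* con (+ 0))) refl (W ∷ u ∷ [])
  ; +-closed = λ { {f} {g} (s , p) (s′ , p′) → s +ₚ s′ , ≈-trans (⊕-cong p p′) (≈-trans
      (solveₛ (v0 :* (v1 :* v2) :+ v0 :* (v1 :* v3)) (v0 :* (v1 :* (v2 :+ v3))) refl (W ∷ u ∷ ev s y ∷ ev s′ y ∷ []))
      (⊛-congˡ (⊛-congˡ (≈-sym (ev-+ s s′ y))))) }
  ; y-closed = λ { p (s , q) → p *ₚ s , ≈-trans (⊛-congˡ q) (≈-trans
      (solveₛ (v3 :* (v0 :* (v1 :* v2))) (v0 :* (v1 :* (v3 :* v2))) refl (W ∷ u ∷ ev s y ∷ ev p y ∷ []))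
      (⊛-congˡ (⊛-congˡ (≈-sym (ev-* p s y))))) } }

𝕏-resp : ∀ {f g} → f ≈ g → 𝕏 f → 𝕏 g
𝕏-resp p (c₀ , c₁ , c₂ , s , q) = c₀ , c₁ , c₂ , s , ≈-trans (≈-sym p) q

𝕏-+ : ∀ {f g} → 𝕏 f → 𝕏 g → 𝕏 (f ⊕ g)
𝕏-+ (a₀ , a₁ , a₂ , s , p) (b₀ , b₁ , b₂ , t , q) = a₀ ℤ.+ b₀ , a₁ ℤ.+ b₁ , a₂ ℤ.+ b₂ , s +ₚ t , ≈-trans (⊕-cong p q) (≈-trans
  (solveₛ (w :* (v0 :+ z :* (v1 :+ z :* (v2 :+ z :* v3))) :+ w :* (v4 :+ z :* (v5 :+ z :* (v6 :+ z :* v7))))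
          (w :* ((v0 :+ v4) :+ z :* ((v1 :+ v5) :+ z :* ((v2 :+ v6) :+ z :* (v3 :+ v7))))) refl
    (const a₀ ∷ const a₁ ∷ const a₂ ∷ ev s y ∷ const b₀ ∷ const b₁ ∷ const b₂ ∷ ev t y ∷ W ∷ u ∷ []))
  (⊛-congˡ (⊕-cong (≈-sym (const-+ a₀ b₀)) (⊛-congˡ (⊕-cong (≈-sym (const-+ a₁ b₁)) (⊛-congˡ (⊕-cong (≈-sym (const-+ a₂ b₂)) (⊛-congˡ (≈-sym (ev-+ s t y))))))))))
  where
  v7 w z : Expr 10
  v7 = var (suc (suc (suc (suc (suc (suc (suc zero)))))))
  w  = var (suc (suc (suc (suc (suc (suc (suc (suc zero))))))))
  z  = var (suc (suc (suc (suc (suc (suc (suc (suc (suc zero)))))))))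

𝕏-const : ∀ c {f} → 𝕏 f → 𝕏 (const c ⊛ f)
𝕏-const c (a₀ , a₁ , a₂ , s , p) = c ℤ.* a₀ , c ℤ.* a₁ , c ℤ.* a₂ , (c ∷ []) *ₚ s , ≈-trans (⊛-congˡ p) (≈-trans
  (solveₛ (v0 :* (v1 :* (v2 :+ v3 :* (v4 :+ v3 :* (v5 :+ v3 :* v6))))) (v1 :* (v0 :* v2 :+ v3 :* (v0 :* v4 :+ v3 :* (v0 :* v5 :+ v3 :* ((v0 :+ v7 :* con (+ 0)) :* v6))))) refl
    (const c ∷ W ∷ const a₀ ∷ u ∷ const a₁ ∷ const a₂ ∷ ev s y ∷ y ∷ []))
  (⊛-congˡ (⊕-cong (≈-sym (const-* c a₀)) (⊛-congˡ (⊕-cong (≈-sym (const-* c a₁)) (⊛-congˡ (⊕-cong (≈-sym (const-* c a₂)) (⊛-congˡ (≈-sym (ev-* (c ∷ []) s y))))))))))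
  where
  v7 : Expr 8
  v7 = var (suc (suc (suc (suc (suc (suc (suc zero)))))))

𝕏-y : ∀ {f} → 𝕏 f → 𝕏 (y ⊛ f)
𝕏-y (a₀ , a₁ , a₂ , s , p) = + 0 , + 13 ℤ.* a₀ , + 13 ℤ.* a₁ , + 13 ℤ.* a₂ ∷ s , ≈-trans (⊛-congˡ p) (≈-trans
  (solveₛ ((con (+ 13) :* v0) :* (v1 :* (v2 :+ v0 :* (v3 :+ v0 :* (v4 :+ v0 :* v5)))))
          (v1 :* (con (+ 0) :+ v0 :* (con (+ 13) :* v2 :+ v0 :* (con (+ 13) :* v3 :+ v0 :* (con (+ 13) :* v4 :+ (con (+ 13) :* v0) :* v5))))) refl
    (u ∷ W ∷ const a₀ ∷ const a₁ ∷ const a₂ ∷ ev s y ∷ []))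
  (⊛-congˡ (⊕-congˡ 0ₛ (⊛-congˡ (⊕-cong (≈-sym (const-* (+ 13) a₀)) (⊛-congˡ (⊕-cong (≈-sym (const-* (+ 13) a₁)) (⊛-congˡ (⊕-congʳ (y ⊛ ev s y) (≈-sym (const-* (+ 13) a₂)))))))))))

𝕏-ev : ∀ p {f} → 𝕏 f → 𝕏 (ev p y ⊛ f)
𝕏-ev []      m = 𝕏-const (+ 0) m
𝕏-ev (c ∷ p) {f} m = 𝕏-resp (solveₛ (v0 :* v3 :+ v1 :* (v2 :* v3)) ((v0 :+ v1 :* v2) :* v3) refl (const c ∷ y ∷ ev p y ∷ f ∷ []))
  (𝕏-+ (𝕏-const c m) (𝕏-y (𝕏-ev p m)))

169𝕏-lattice : Lattice 169𝕏
169𝕏-lattice = record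
  { resp = λ { p (g , m , q) → g , m , ≈-trans (≈-sym p) q }
  ; zero-closed = W ⊛ form (+ 0) (+ 0) (+ 0) [] , (+ 0 , + 0 , + 0 , [] , ≈-refl) ,
      solveₛ (con (+ 0)) (con (+ 169) :* (v0 :* (con (+ 0) :+ v1 :* (con (+ 0) :+ v1 :* (con (+ 0) :+ v1 :* con (+ 0)))))) refl (W ∷ u ∷ [])
  ; +-closed = λ { (g , m , q) (g′ , m′ , q′) → g ⊕ g′ , 𝕏-+ m m′ , ≈-trans (⊕-cong q q′) (≈-sym (⊛-distribˡ (const (+ 169)) g g′)) }
  ; y-closed = λ { p (g , m , q) → ev p y ⊛ g , 𝕏-ev p m , ≈-trans (⊛-congˡ q) (solveₛ (v0 :* (con (+ 169) :* v1)) (con (+ 169) :* (v0 :* v1)) refl (ev p y ∷ g ∷ [])) } }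

U-const : ∀ c f → U (const c ⊛ f) ≈ const c ⊛ U f
U-const c f = ≈-trans (U-cong (⊛-congʳ (≈-sym (V-const c)))) (U-V (const c) f)

X′-const : ∀ c {f} → X′ f → X′ (const c ⊛ f)
X′-const c {f} m = Lattice.resp X′-lattice (⊛-congʳ (solveₛ (v0 :+ v1 :* con (+ 0)) v0 refl (const c ∷ y ∷ []))) (Lattice.y-closed X′-lattice (c ∷ []) m)

U-Z : ∀ {f} → 𝕏 f → X′ (U (Z ⊛ f))
U-Z {f} (c₀ , c₁ , c₂ , s , p) = resp (≈-sym (begin
  U (Z ⊛ f)
    ≈⟨ U-cong (≈-trans (⊛-congˡ p) (solveₛ (v0 :* (v1 :* (v2 :+ v3 :* (v4 :+ v3 :* (v5 :+ v3 :* v6)))))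
         (v2 :* (v1 :* (v0 :* o)) :+ (v4 :* (v1 :* (v0 :* (v3 :* o))) :+ (v5 :* (v1 :* (v0 :* (v3 :* (v3 :* o)))) :+ v6 :* (v1 :* (v0 :* (v3 :* (v3 :* (v3 :* o)))))))) refl
         (Z ∷ W ∷ const c₀ ∷ u ∷ const c₁ ∷ const c₂ ∷ ev s y ∷ []))) ⟩
  U (const c₀ ⊛ w₀) ⊕ (U (const c₁ ⊛ w₁) ⊕ (U (const c₂ ⊛ w₂) ⊕ U (ev s y ⊛ w₃)))
    ≈⟨ ⊕-cong (U-const c₀ w₀) (⊕-cong (U-const c₁ w₁) (⊕-congʳ (U (ev s y ⊛ w₃)) (U-const c₂ w₂))) ⟩
  const c₀ ⊛ U w₀ ⊕ (const c₁ ⊛ U w₁ ⊕ (const c₂ ⊛ U w₂ ⊕ U (ev s y ⊛ w₃))) ∎))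
  (+-closed (X′-const c₀ m₀) (+-closed (X′-const c₁ m₁) (+-closed (X′-const c₂ m₂) (U-polynomial X′-lattice s w₃ (U-powers X′-lattice w₃ λ j j<13 →
    resp (U-cong (solveₛ (v0 :* (v1 :* (v2 :* v3))) (v2 :* (v0 :* (v1 :* v3))) refl (W ∷ Z ∷ y ↑ j ∷ u ⊛ (u ⊛ (u ⊛ 1ₛ)) ∷ []))) (m₃ j j<13))))))
  where
  open Lattice X′-lattice
  o : Expr 7
  o = con (+ 1)
  w₀ = W ⊛ (Z ⊛ 1ₛ)
  w₁ = W ⊛ (Z ⊛ (u ⊛ 1ₛ))
  w₂ = W ⊛ (Z ⊛ (u ⊛ (u ⊛ 1ₛ)))
  w₃ = W ⊛ (Z ⊛ (u ⊛ (u ⊛ (u ⊛ 1ₛ))))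
  m₀ = proj₁ base-cases
  m₁ = proj₁ (proj₂ base-cases)
  m₂ = proj₁ (proj₂ (proj₂ base-cases))
  m₃ = proj₁ (proj₂ (proj₂ (proj₂ base-cases)))

U-X′ : ∀ {f} → X′ f → 169𝕏 (U f)
U-X′ {f} (s , p) = resp (U-cong (≈-trans (solveₛ (v0 :* (v1 :* (v2 :* con (+ 1)))) (v1 :* (v2 :* v0)) refl (ev s y ∷ W ∷ u ∷ [])) (≈-sym p)))
  (U-polynomial 169𝕏-lattice s w (U-powers 169𝕏-lattice w λ j j<13 →
    resp (U-cong (solveₛ (v0 :* (v1 :* v2)) (v1 :* (v0 :* v2)) refl (W ∷ y ↑ j ∷ u ⊛ 1ₛ ∷ []))) (proj₂ (proj₂ (proj₂ (proj₂ base-cases))) j j<13)))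
  where
  open Lattice 169𝕏-lattice
  w = W ⊛ (u ⊛ 1ₛ)

-- The recursion in k and the arithmetic of the indices.

-- 𝔸 k has the coefficients e₆(169ᵏ m − (169ᵏ − 1)/24), and 𝕃 k = (q;q)_∞ 𝔸 k.
𝕃 : ℕ → Series
𝕃 zero    = R
𝕃 (suc k) = U (U (Z ⊛ 𝕃 k))

-- `lB` is a polynomial in 13u, so the coefficient of u^(3+i) is divisible by 13ⁱ; the last list
-- contains the quotients.
R∈𝕏 : 𝕏 R
R∈𝕏 = + 1 , -[1+ 493 ] , -[1+ 20617 ] , (-[1+ 237275 ] ∷ -[1+ 101061 ] ∷ -[1+ 21969 ] ∷ -[1+ 2196 ] ∷ []) ,
  ≈-trans R≈WB (⊛-congˡ (solveₛ (poly lB v0) (con (+ 1) :+ v0 :* (con -[1+ 493 ] :+ v0 :* (con -[1+ 20617 ] :+ v0 :*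
    poly (-[1+ 237275 ] ∷ -[1+ 101061 ] ∷ -[1+ 21969 ] ∷ -[1+ 2196 ] ∷ []) (con (+ 13) :* v0)))) refl (u ∷ [])))

𝕃-divisible : ∀ k → ∃ λ g → 𝕏 g × 𝕃 k ≈ const (+ (169 ^ k)) ⊛ g
𝕃-divisible zero    = R , R∈𝕏 , ≈-sym (⊛-identityˡ R)
𝕃-divisible (suc k) = step (𝕃-divisible k)
  where
  step : (∃ λ g → 𝕏 g × 𝕃 k ≈ const (+ (169 ^ k)) ⊛ g) → ∃ λ g → 𝕏 g × 𝕃 (suc k) ≈ const (+ (169 ^ suc k)) ⊛ g
  step (g , m , p) = g′ , m′ , (begin
    U (U (Z ⊛ 𝕃 k))                                   ≈⟨ U-cong (U-cong (≈-trans (⊛-congˡ p) (solveₛ (v0 :* (v1 :* v2)) (v1 :* (v0 :* v2)) refl (Z ∷ c ∷ g ∷ [])))) ⟩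
    U (U (c ⊛ (Z ⊛ g)))                               ≈⟨ ≈-trans (U-cong (U-const (+ (169 ^ k)) (Z ⊛ g))) (U-const (+ (169 ^ k)) (U (Z ⊛ g))) ⟩
    c ⊛ U (U (Z ⊛ g))                                 ≈⟨ ⊛-congˡ q ⟩
    c ⊛ (const (+ 169) ⊛ g′)                          ≈⟨ solveₛ (v0 :* (con (+ 169) :* v1)) ((con (+ 169) :* v0) :* v1) refl (c ∷ g′ ∷ []) ⟩
    (const (+ 169) ⊛ c) ⊛ g′                          ≈⟨ ⊛-congʳ (≈-trans (≈-sym (const-* (+ 169) (+ (169 ^ k)))) (mk λ n → cong (λ t → const t n) (sym (ℤₚ.pos-* 169 (169 ^ k))))) ⟩
    const (+ (169 ^ suc k)) ⊛ g′                      ∎)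
    where
    c = const (+ (169 ^ k))
    out = U-X′ (U-Z m)
    g′ = proj₁ out
    m′ = proj₁ (proj₂ out)
    q = proj₂ (proj₂ out)

𝔸 : ℕ → Series
𝔸 zero    = G ⊛ R
𝔸 (suc k) = U (U (X ↑ 7 ⊛ 𝔸 k))

-- Z is q⁷ E(q¹⁶⁹)/E(q). Its denominator cancels the factor E of 𝕃 k, and E(q¹⁶⁹) passes through
-- both U and comes out as E. The exponent 7 is (169 - 1)/24.
𝕃-𝔸 : ∀ k → 𝕃 k ≈ E ⊛ 𝔸 k
𝕃-𝔸 zero    = ≈-trans (≈-sym (⊛-identityˡ R)) (≈-trans (⊛-congʳ (≈-sym G-E)) (solveₛ ((v0 :* v1) :* v2) (v1 :* (v0 :* v2)) refl (G ∷ E ∷ R ∷ [])))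
𝕃-𝔸 (suc k) = begin
  U (U (Z ⊛ 𝕃 k))                                   ≈⟨ U-cong (U-cong (≈-trans (⊛-congˡ (𝕃-𝔸 k))
                                                         (solveₛ ((v0 :* v1 :* v2) :* (v3 :* v4)) (v1 :* ((v2 :* v3) :* (v0 :* v4))) refl (X ↑ 7 ∷ V (V E) ∷ G ∷ E ∷ 𝔸 k ∷ [])))) ⟩
  U (U (V (V E) ⊛ ((G ⊛ E) ⊛ (X ↑ 7 ⊛ 𝔸 k))))       ≈⟨ U-cong (≈-trans (U-V (V E) _) (⊛-congˡ (U-cong (≈-trans (⊛-congʳ G-E) (⊛-identityˡ _))))) ⟩
  U (V E ⊛ U (X ↑ 7 ⊛ 𝔸 k))                         ≈⟨ U-V E _ ⟩
  E ⊛ 𝔸 (suc k)                                     ∎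

𝔸-divisible : ∀ k → ∃ λ g → 𝔸 k ≈ const (+ (169 ^ k)) ⊛ g
𝔸-divisible k = G ⊛ g , (begin
  𝔸 k                                ≈⟨ ⊛-identityˡ (𝔸 k) ⟨
  1ₛ ⊛ 𝔸 k                           ≈⟨ ⊛-congʳ G-E ⟨
  (G ⊛ E) ⊛ 𝔸 k                      ≈⟨ ⊛-assoc G E (𝔸 k) ⟩
  G ⊛ (E ⊛ 𝔸 k)                      ≈⟨ ⊛-congˡ (≈-trans (≈-sym (𝕃-𝔸 k)) (proj₂ (proj₂ (𝕃-divisible k)))) ⟩
  G ⊛ (const (+ (169 ^ k)) ⊛ g)      ≈⟨ solveₛ (v0 :* (v1 :* v2)) (v1 :* (v0 :* v2)) refl (G ∷ const (+ (169 ^ k)) ∷ g ∷ []) ⟩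
  const (+ (169 ^ k)) ⊛ (G ⊛ g)      ∎)
  where
  g = proj₁ (𝕃-divisible k)

X↑-⊛ : ∀ k f n → (X ↑ k ⊛ f) (k ℕ.+ n) ≡ f n
X↑-⊛ zero    f n = at (⊛-identityˡ f) n
X↑-⊛ (suc k) f n = trans (at (≈-trans (⊛-assoc X (X ↑ k) f) (X-⊛ (X ↑ k ⊛ f))) (suc (k ℕ.+ n))) (X↑-⊛ k f n)

-- The exponent 169(m + 1) - 7 equals 169m + 162. The argument m + 1 ensures that the factor q⁷ can
-- be removed.
𝔸-suc : ∀ k m → 𝔸 (suc k) (suc m) ≡ 𝔸 k (suc (169 ℕ.* m ℕ.+ 161))
𝔸-suc k m = trans (cong (X ↑ 7 ⊛ 𝔸 k) (index m)) (X↑-⊛ 7 (𝔸 k) (suc (169 ℕ.* m ℕ.+ 161)))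
  where
  index : ∀ m → suc m ℕ.* 13 ℕ.* 13 ≡ 7 ℕ.+ suc (169 ℕ.* m ℕ.+ 161)
  index = ℕ-solve

-- (23 · 169ᵏ + 1) / 24, the inverse of 24 modulo 169ᵏ
residue : ℕ → ℕ
residue zero    = 1
residue (suc k) = 161 ℕ.* 169 ^ k ℕ.+ residue k

𝔸-index : ∀ k m → 𝔸 k (suc m) ≡ 𝔸 0 (169 ^ k ℕ.* m ℕ.+ residue k)
𝔸-index zero    m = cong (𝔸 0) (trans (ℕₚ.+-comm 1 m) (cong (ℕ._+ 1) (sym (ℕₚ.+-identityʳ m))))
𝔸-index (suc k) m = trans (𝔸-suc k m) (trans (𝔸-index k (169 ℕ.* m ℕ.+ 161)) (cong (𝔸 0) (index (169 ^ k) m (residue k))))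
  where
  index : ∀ M m r → M ℕ.* (169 ℕ.* m ℕ.+ 161) ℕ.+ r ≡ 169 ℕ.* M ℕ.* m ℕ.+ (161 ℕ.* M ℕ.+ r)
  index = ℕ-solve

24-residue : ∀ k → 24 ℕ.* residue k ≡ 23 ℕ.* 169 ^ k ℕ.+ 1
24-residue zero    = refl
24-residue (suc k) = trans (ℕₚ.*-distribˡ-+ 24 (161 ℕ.* 169 ^ k) (residue k)) (trans (cong (24 ℕ.* (161 ℕ.* 169 ^ k) ℕ.+_) (24-residue k)) (collect (169 ^ k)))
  where
  collect : ∀ M → 24 ℕ.* (161 ℕ.* M) ℕ.+ (23 ℕ.* M ℕ.+ 1) ≡ 23 ℕ.* (169 ℕ.* M) ℕ.+ 1
  collect = ℕ-solve

169^-mod-24 : ∀ k → ∃ λ a → 169 ^ k ≡ 24 ℕ.* a ℕ.+ 1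
169^-mod-24 zero    = 0 , refl
169^-mod-24 (suc k) with 169^-mod-24 k
... | a , eq = 169 ℕ.* a ℕ.+ 7 , trans (cong (169 ℕ.*_) eq) (expand a)
  where
  expand : ∀ a → 169 ℕ.* (24 ℕ.* a ℕ.+ 1) ≡ 24 ℕ.* (169 ℕ.* a ℕ.+ 7) ℕ.+ 1
  expand = ℕ-solve

-- Since 169ᵏ ≡ 1 modulo 24, the equation forces t ≡ -1 modulo 24, while δ < 169ᵏ bounds t below 24.
-- Hence t = 23, which determines δ.
residue-unique : ∀ k δ t → δ ℕ.< 169 ^ k → 24 ℕ.* δ ≡ t ℕ.* 169 ^ k ℕ.+ 1 → δ ≡ residue k
residue-unique k δ t δ<M eq = ℕₚ.*-cancelˡ-≡ δ (residue k) 24 (trans eq (trans (cong (λ t → t ℕ.* M ℕ.+ 1) t≡23) (sym (24-residue k))))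
  where
  M = 169 ^ k
  a = proj₁ (169^-mod-24 k)
  t<24 : t ℕ.< 24
  t<24 = ℕₚ.*-cancelʳ-< M t 24 (ℕₚ.<-trans (subst (t ℕ.* M ℕ.<_) (sym eq) (ℕₚ.≤-reflexive (ℕₚ.+-comm 1 (t ℕ.* M)))) (ℕₚ.*-monoʳ-< 24 δ<M))
  24∣suc-t : 24 ℕ∣.∣ suc t
  24∣suc-t = ℕ∣.∣m+n∣m⇒∣n (divides δ (trans (rearrange a t) (trans (cong (λ M → t ℕ.* M ℕ.+ 1) (sym (proj₂ (169^-mod-24 k)))) (trans (sym eq) (ℕₚ.*-comm 24 δ)))))
    (divides (a ℕ.* t) (ℕₚ.*-comm 24 (a ℕ.* t)))
    where
    rearrange : ∀ a t → 24 ℕ.* (a ℕ.* t) ℕ.+ suc t ≡ t ℕ.* (24 ℕ.* a ℕ.+ 1) ℕ.+ 1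
    rearrange = ℕ-solve
  t≡23 : t ≡ 23
  t≡23 = ℕₚ.suc-injective (ℕₚ.≤-antisym t<24 (ℕ∣.∣⇒≤ 24∣suc-t))

-- Identification of 𝔸 0 with the generating series of e₆, and the conclusion.

⊛-as-foldr : ∀ n f g → (f ⊛ g) n ≡ foldr ℤ._+_ (+ 0) (applyUpTo (λ j → f j ℤ.* g (n ∸ j)) (suc n))
⊛-as-foldr zero    f g = sym (ℤₚ.+-identityʳ _)
⊛-as-foldr (suc n) f g = cong (λ t → f 0 ℤ.* g (suc n) ℤ.+ t) (⊛-as-foldr n (shift f) g)

sum-front : ∀ N F → sum (suc N) F ≡ F 0 ℤ.+ sum N (F ∘ suc)
sum-front N F = trans (sum-split 1 N F) (cong (ℤ._+ sum N (F ∘ suc)) (ℤₚ.+-identityˡ (F 0)))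

pos-^ : ∀ d k → + (d ^ k) ≡ (+ d) Z.↑ k
pos-^ d zero    = refl
pos-^ d (suc k) = trans (ℤₚ.pos-* d (d ^ k)) (cong (+ d ℤ.*_) (pos-^ d k))

divisor-term : ∀ n a → ℤ
divisor-term n a = sum n (λ x → (+ suc a) Z.↑ 5 ℤ.* δ (suc a ℕ.* suc x) n)

divisor-term-∣ : ∀ n a → suc a ℕ∣.∣ suc n → divisor-term (suc n) a ≡ + (suc a ^ 5)
divisor-term-∣ n a (divides (suc q) eq) = trans (sum-single (suc n) _ q q<n λ i i≢q → trans (cong ((+ suc a) Z.↑ 5 ℤ.*_) (δ-≢ _ (suc n) λ eq′ →
    i≢q (ℕₚ.suc-injective (ℕₚ.*-cancelˡ-≡ (suc i) (suc q) (suc a) (trans eq′ (trans eq (ℕₚ.*-comm (suc q) (suc a)))))))) (ℤₚ.*-zeroʳ ((+ suc a) Z.↑ 5)))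
  (trans (cong ((+ suc a) Z.↑ 5 ℤ.*_) (trans (cong (λ t → δ t (suc n)) (trans (ℕₚ.*-comm (suc a) (suc q)) (sym eq))) (δ-≡ (suc n)))) (trans (ℤₚ.*-identityʳ _) (sym (pos-^ (suc a) 5))))
  where
  q<n : q ℕ.< suc n
  q<n = subst (suc q ℕ.≤_) (sym eq) (ℕₚ.m≤m*n (suc q) (suc a))

divisor-term-∤ : ∀ n a → ¬ (suc a ℕ∣.∣ n) → divisor-term n a ≡ + 0
divisor-term-∤ n a ∤ = sum-0 n λ x _ → trans (cong ((+ suc a) Z.↑ 5 ℤ.*_) (δ-≢ _ n λ eq → ∤ (divides (suc x) (trans (sym eq) (ℕₚ.*-comm (suc a) (suc x)))))) (ℤₚ.*-zeroʳ ((+ suc a) Z.↑ 5))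

L5-σ₅ : ∀ n → L 5 (suc n) ≡ + σ₅ (suc n)
L5-σ₅ n = sym (trans (cong (λ l → + sumₗ (map (_^ 5) (filter (_∣? suc n) l))) (Listₚ.map-applyUpTo id suc (suc n))) (go (suc n) id))
  where
  go : ∀ N f → + sumₗ (map (_^ 5) (filter (_∣? suc n) (applyUpTo (suc ∘ f) N))) ≡ sum N (λ a → divisor-term (suc n) (f a))
  go zero    f = refl
  go (suc N) f = by-cases (suc (f 0) ∣? suc n)
    where
    rest = sum N (λ a → divisor-term (suc n) (f (suc a)))
    close : ∀ {s t} → s ≡ t → t ≡ divisor-term (suc n) (f 0) ℤ.+ rest → s ≡ sum (suc N) (λ a → divisor-term (suc n) (f a))
    close p q = trans p (trans q (sym (sum-front N (λ a → divisor-term (suc n) (f a)))))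
    by-cases : Dec (suc (f 0) ℕ∣.∣ suc n) →
      + sumₗ (map (_^ 5) (filter (_∣? suc n) (applyUpTo (suc ∘ f) (suc N)))) ≡ sum (suc N) (λ a → divisor-term (suc n) (f a))
    by-cases (yes d) = close (cong (λ l → + sumₗ (map (_^ 5) l)) (Listₚ.filter-accept (_∣? suc n) d))
      (trans (ℤₚ.pos-+ (suc (f 0) ^ 5) (sumₗ (map (_^ 5) (filter (_∣? suc n) (applyUpTo (suc ∘ f ∘ suc) N)))))
        (cong₂ ℤ._+_ (sym (divisor-term-∣ n (f 0) d)) (go N (f ∘ suc))))
    by-cases (no ∤d) = close (cong (λ l → + sumₗ (map (_^ 5) l)) (Listₚ.filter-reject (_∣? suc n) ∤d))
      (trans (go N (f ∘ suc)) (trans (sym (ℤₚ.+-identityˡ rest)) (cong (ℤ._+ rest) (sym (divisor-term-∤ (suc n) (f 0) ∤d)))))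

R-coefficient : ∀ n → R n ≡ E₆coeff n
R-coefficient zero    = refl
R-coefficient (suc n) = trans (ℤₚ.+-identityˡ _) (trans (at (const-⊛ -[1+ 503 ] (L 5)) (suc n)) (trans (cong (-[1+ 503 ] ℤ.*_) (L5-σ₅ n))
  (trans (sym (ℤₚ.neg-distribˡ-* (+ 504) (+ σ₅ (suc n)))) (cong ℤ.-_ (sym (ℤₚ.pos-* 504 (σ₅ (suc n))))))))

𝔸₀-e₆ : ∀ n → 𝔸 0 n ≡ e₆ n
𝔸₀-e₆ n = trans (at (⊛-comm G R) n) (trans (at (⊛-congʳ (mk R-coefficient)) n) (trans (⊛-as-foldr n E₆coeff G)
  (cong (foldr ℤ._+_ (+ 0)) (sym (Listₚ.map-applyUpTo id (λ j → E₆coeff j ℤ.* (+ p (n ∸ j))) (suc n))))))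

theorem6p10 : (k n δ : ℕ) → 1 ≤ k → 0 < δ → δ < 13 ^ (2 N.* k)
    → (+ (13 ^ (2 N.* k))) ∣ (+ (24 N.* δ) - + 1)
    → (+ (13 ^ (2 N.* k))) ∣ e₆ (13 ^ (2 N.* k) N.* n N.+ δ)
-- The rewrite turns 13^(2k) into 169ᵏ. With δ written as a successor, 24δ - 1 computes to a natural
-- number, so the quotient in the hypothesis is the t of `residue-unique`.
theorem6p10 k n (suc d) _ _ δ<M M∣24δ-1 rewrite sym (ℕₚ.^-*-assoc 13 2 k) = go M∣24δ-1
  where
  M = 169 ^ k
  go : M ℕ∣.∣ ℤ.∣ + (24 ℕ.* suc d) - + 1 ∣ → M ℕ∣.∣ ℤ.∣ e₆ (M ℕ.* n ℕ.+ suc d) ∣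
  go (divides t eq) = divides ℤ.∣ proj₁ (𝔸-divisible k) (suc n) ∣ (trans (cong ℤ.∣_∣ value) (trans (ℤₚ.abs-* (+ M) (proj₁ (𝔸-divisible k) (suc n))) (ℕₚ.*-comm M _)))
    where
    δ≡ : suc d ≡ residue k
    δ≡ = residue-unique k (suc d) t δ<M (trans (ℕₚ.+-comm 1 _) (cong (ℕ._+ 1) eq))
    value : e₆ (M ℕ.* n ℕ.+ suc d) ≡ + M ℤ.* proj₁ (𝔸-divisible k) (suc n)
    value = trans (sym (𝔸₀-e₆ (M ℕ.* n ℕ.+ suc d))) (trans (cong (λ r → 𝔸 0 (M ℕ.* n ℕ.+ r)) δ≡) (trans (sym (𝔸-index k n))
      (trans (at (proj₂ (𝔸-divisible k)) (suc n)) (at (const-⊛ (+ M) (proj₁ (𝔸-divisible k))) (suc n)))))
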